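{- Let $\mathcal{L}_n$ be the set of all Latin squares of order $n$, viewed as a family of subsets of $\Omega=\{1,\dots,n\}^3$. Then the recursive teaching dimension of $\mathcal{L}_n$ is at least $n^2-(e+o(1))n^{5/3}$, where $o(1)$ denotes a quantity tending to $0$ as $n\to\infty$.
   Context: A Latin square of order $n$ is an $n\times n$ array filled with elements of $\{1,\dots,n\}$ such that every element occurs exactly once in each row and each column; it is identified with the set of triples $(i,j,k)\in\{1,\dots,n\}^3$ such that the $(i,j)$-th entry equals $k$. For a family (concept class) $\mathcal{C}$ of subsets of a finite set $\Omega$ and $c\in\mathcal{C}$, a set $S\subseteq\Omega$ is a teaching set for $c$ with respect to $\mathcal{C}$ if $c\cap S\ne c'\cap S$ for every $c'\in\mathcal{C}$ with $c'\ne c$; $\mathrm{TD}(c;\mathcal{C})$ is the minimum size of such a teaching set. Define $\mathrm{TD}_{\min}(\mathcal{C})=\min_{c\in\mathcal{C}}\mathrm{TD}(c;\mathcal{C})$ and the recursive teaching dimension $\mathrm{RTD}(\mathcal{C})=\max_{\mathcal{C}'\subseteq\mathcal{C}}\mathrm{TD}_{\min}(\mathcal{C}')$, the maximum being over nonempty subfamilies $\mathcal{C}'$. -}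

module Defs where

open import Level using (Level; _⊔_) renaming (suc to lsuc; zero to lzero)
open import Data.Nat using (ℕ; zero; suc; _+_; _*_; _∸_; _^_; _≤_; _!)

open import Data.Fin using (Fin)
open import Data.Product using (Σ; ∃; _×_; _,_)
open import Data.List using (List; length)
open import Data.List.Membership.Propositional using (_∈_)
open import Relation.Binary.PropositionalEquality using (_≡_)
open import Relation.Nullary using (¬_)
open import Function.Bundles using (_⇔_)

Ω : ℕ → Set
Ω n = Fin n × Fin n × Fin n

record LatinSquare (n : ℕ) : Set where
  field
    entry    : Fin n → Fin n → Fin n
    rowExists : ∀ i k → ∃ λ j → entry i j ≡ k
    rowUnique : ∀ i j j′ → entry i j ≡ entry i j′ → j ≡ j′
    colExists : ∀ j k → ∃ λ i → entry i j ≡ k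
    colUnique : ∀ j i i′ → entry i j ≡ entry i′ j → i ≡ i′
open LatinSquare public

_∈L_ : {n : ℕ} → Ω n → LatinSquare n → Set
(i , j , k) ∈L L = entry L i j ≡ k

SameConcept : {n : ℕ} → LatinSquare n → LatinSquare n → Set
SameConcept {n} c c′ = (ω : Ω n) → (ω ∈L c) ⇔ (ω ∈L c′)

AgreeOn : {n : ℕ} → List (Ω n) → LatinSquare n → LatinSquare n → Set
AgreeOn {n} S c c′ = (ω : Ω n) → ω ∈ S → (ω ∈L c) ⇔ (ω ∈L c′)

Subfamily : ℕ → Set₁
Subfamily n = LatinSquare n → Set

IsTeachingSet : {n : ℕ} → Subfamily n → LatinSquare n → List (Ω n) → Set
IsTeachingSet 𝒞′ c S =
  ∀ c′ → 𝒞′ c′ → ¬ SameConcept c′ c → ¬ AgreeOn S c c′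

TDminAtLeast : {n : ℕ} → Subfamily n → ℕ → Set
TDminAtLeast 𝒞′ x = ∀ c → 𝒞′ c → ∀ S → IsTeachingSet 𝒞′ c S → x ≤ length S

-- RTD(ℒₙ) ≥ x : some nonempty subfamily has TD_min ≥ x
-- (unfolding of max over subfamilies).
RTDAtLeast : (n : ℕ) → ℕ → Set₁
RTDAtLeast n x = Σ (Subfamily n) λ 𝒞′ → (∃ λ c → 𝒞′ c) × TDminAtLeast 𝒞′ x

-- Rational upper bounds for e:  q_m = Σ_{k=0}^m 1/k! + 1/(m·m!)  (m ≥ 1),
-- a strictly decreasing sequence with limit e.
-- eSumNum m = Σ_{k=0}^m m!/k!, via the recursion
--   Σ_{k≤m+1} (m+1)!/k! = (m+1)·Σ_{k≤m} m!/k! + 1.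
eSumNum : ℕ → ℕ
eSumNum zero    = 1
eSumNum (suc m) = suc m * eSumNum m + 1

eUpperNum : ℕ → ℕ
eUpperNum m = m * eSumNum m + 1

eUpperDen : ℕ → ℕ
eUpperDen m = m * (m !)

{-
Suppose that every family of Latin squares of order n has a member taught by fewer than n² − k cells.
Peeling off such members one at a time assigns to each Latin square a mask with at least k holes such
that the pairs (mask, entries outside the mask) are distinct, so it suffices to show that there are
more Latin squares than such pairs. With k = l n and l close to q n^(2/3), q > e, this follows from
two bounds.

Lower bound. A d-regular bipartite graph on n + n vertices has, up to a constant factor, at least
(d/e)^n perfect matchings; building the square row by row gives (n!/e^n)^n Latin squares. The bound on
matchings is a limit of halving. Let C_k count the maps from k copies of each row to adjacent columns
that hit every column k times, so C_1 is the permanent. Pairing the 2k copies of each row turns a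
member of C_2k into a multigraph on the columns with all degrees 2k; its Eulerian orientations, of
which there are at least ((2k−1)!!/k!)^n, split it into two members of C_k. Hence
C_K K!^n ≤ K^(Kn) C_1^K for K a power of 2, while C_K ≥ K!^n Π a_rc^(a_rc)/a_rc! when the weights a_rc
have line sums K. Arbitrary degrees are reduced to a power of 2 by taking a large multiple
of the adjacency matrix and adding a small multiple of the identity.

Upper bound. For a fixed mask with a_i holes in row i and b_j in column j, Brègman's inequality,
applied row by row with the holes unrestricted, and division by Π a_i! (the entries in the holes of a
row can be permuted) bound the number of traces by a product of functions of the a_i and b_j. The
inequality 1/a! ≤ e^l / l^a makes this depend on the number of holes alone, and the sum over all masks
is a binomial sum.

The ratio of the two bounds is about (e³ n²/l³)^(l n), up to a factor exp(O(n^(3/2) log n)).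

No real numbers are used: e is replaced by (1+1/n)^n and (1+1/n)^(n+1), and Brègman's (d!)^(1/d) by a
rational function g with g(d)^d ≥ d g(d−1)^(d−1).
-}

module Submission where

open import Defs
open import Data.Bool using (Bool; true; false; not; _∧_; _∨_; if_then_else_)
import Data.Bool.Properties as Bool
open import Data.Empty using (⊥; ⊥-elim)
open import Data.Fin using (Fin; zero; suc; punchIn; punchOut)
open import Data.Fin.Properties using (_≟_)
import Data.Fin.Properties as Fin
open import Data.List using (List; []; _∷_; length; map; filter; _++_; concatMap; allFin)
import Data.List as List
open import Data.List.Properties using (length-map)
open import Data.List.Membership.Propositional using (_∈_; lose)
import Data.List.Membership.Propositional.Properties as ∈
open import Data.List.Relation.Unary.All using (All; []; _∷_)
import Data.List.Relation.Unary.All as All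
import Data.List.Relation.Unary.All.Properties as All
open import Data.List.Relation.Unary.AllPairs using (AllPairs; []; _∷_)
import Data.List.Relation.Unary.AllPairs as AllPairs
import Data.List.Relation.Unary.AllPairs.Properties as AllPairs
open import Data.List.Relation.Unary.Any using (Any; here; there)
import Data.List.Relation.Unary.Any as Any
open import Data.List.Relation.Unary.Unique.Propositional using (Unique)
import Data.List.Relation.Unary.Unique.Propositional.Properties as Unique
open import Data.Nat hiding (_≟_)
import Data.Nat as ℕ
import Data.Nat.DivMod as ℕ
open import Data.Nat.Properties hiding (_≟_)
open import Data.Nat.Tactic.RingSolver using (solve-∀)
open import Data.Product using (Σ; ∃; _×_; _,_; proj₁; proj₂)
open import Data.Sum using (_⊎_; inj₁; inj₂; [_,_]′)
open import Data.Unit using (⊤; tt)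
open import Data.Vec using (Vec; []; _∷_; lookup; tabulate)
import Data.Vec as Vec
import Data.Vec.Functional as F
import Data.Vec.Properties as Vec
open import Function using (_∘_; case_of_; id)
open import Function.Bundles using (Equivalence; mk⇔)
open import Relation.Binary.PropositionalEquality
open import Relation.Nullary
open import Relation.Nullary.Decidable using (_×-dec_; _⊎-dec_; _→-dec_)
open import Relation.Unary using (Decidable)
import Algebra.Properties.CommutativeMonoid.Sum as CMSum
open CMSum +-0-commutativeMonoid using () renaming
  (sum to ∑; sum-cong-≗ to ∑-cong; sum-remove to ∑-remove; ∑-comm to ∑-swap; ∑-distrib-+ to ∑-+)
open CMSum *-1-commutativeMonoid using () renaming
  (sum to ∏; sum-cong-≗ to ∏-cong; sum-remove to ∏-remove; ∑-comm to ∏-swap; ∑-distrib-+ to ∏-*)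

open ≤-Reasoning
open import Algebra.Properties.CommutativeSemigroup *-commutativeSemigroup using (interchange; x∙yz≈y∙xz)

-- The constant e³ n²/l³ collects three estimates of the same shape. Against this a hole costs about
-- n in Brègman's inequality and n in the mask weights.
--
-- The main terms of the two counts agree, so what decides is the loss per row. Constant factors in
-- the permanent bound are harmless. The function g, which depends on a parameter r, loses about (1
-- + 1/r)^n (n + 2r)^(2r) per row, which is balanced near r = n^(1/2). The gain is (1 + 1/V)^l with
-- V fixed and l of order n^(2/3), that is r times n^(1/6): after an r-th root, an exponential in x,
-- about n^(1/6), meets a polynomial in x.
--
-- The room 1 + 1/V is the quotient of two consecutive rational upper bounds for e, so it depends on
-- m alone.

private variable
  Elem Elem′ : Set

-- Rational approximations to e

-- The curve t^(N+1) lies above its tangent at t = q. The homogeneous form avoids division and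
-- subtraction; `amgm-step`, `weight-step`, `tangent-step` and `growth` are obtained from it.
tangent : ∀ N p q → suc N * p * q ^ N ≤ p ^ suc N + N * q ^ suc N
tangent zero p q = ≤-reflexive (lem p)
  where lem : ∀ p → 1 * p * 1 ≡ p * 1 + 0
        lem = solve-∀
tangent (suc N) p q = +-cancelʳ-≤ (N * p * q ^ suc N) _ _ (begin
  suc (suc N) * p * q ^ suc N + N * p * q ^ suc N
    ≡⟨ e1 N p q (q ^ N) ⟩
  suc N * q ^ N * (2 * p * q)
    ≤⟨ *-monoʳ-≤ (suc N * q ^ N) (sq p q) ⟩
  suc N * q ^ N * (p * p + q * q)
    ≡⟨ e2 N p q (q ^ N) ⟩
  p * (suc N * p * q ^ N) + suc N * q ^ suc (suc N)
    ≤⟨ +-monoˡ-≤ _ (*-monoʳ-≤ p (tangent N p q)) ⟩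
  p * (p ^ suc N + N * q ^ suc N) + suc N * q ^ suc (suc N)
    ≡⟨ e3 N p q (p ^ suc N) (q ^ N) ⟩
  p ^ suc (suc N) + suc N * q ^ suc (suc N) + N * p * q ^ suc N ∎)
  where
  e1 : ∀ N p q Q → suc (suc N) * p * (q * Q) + N * p * (q * Q) ≡ suc N * Q * (2 * p * q)
  e1 = solve-∀
  e2 : ∀ N p q Q → suc N * Q * (p * p + q * q) ≡ p * (suc N * p * Q) + suc N * (q * (q * Q))
  e2 = solve-∀
  e3 : ∀ N p q P Q → p * (P + N * (q * Q)) + suc N * (q * (q * Q)) ≡ p * P + suc N * (q * (q * Q)) + N * p * (q * Q)
  e3 = solve-∀
  sq≤ : ∀ a d → 2 * a * (a + d) ≤ a * a + (a + d) * (a + d)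
  sq≤ a d = ≤-trans (m≤m+n _ (d * d)) (≤-reflexive (l a d))
    where l : ∀ a d → 2 * a * (a + d) + d * d ≡ a * a + (a + d) * (a + d)
          l = solve-∀
  sq : ∀ p q → 2 * p * q ≤ p * p + q * q
  sq p q with ≤-total p q
  ... | inj₁ p≤q = subst (λ z → 2 * p * z ≤ p * p + z * z) (m+[n∸m]≡n p≤q) (sq≤ p (q ∸ p))
  ... | inj₂ q≤p = ≤-trans (≤-reflexive (c p q)) (≤-trans (subst (λ z → 2 * q * z ≤ q * q + z * z) (m+[n∸m]≡n q≤p) (sq≤ q (p ∸ q))) (≤-reflexive (+-comm (q * q) _)))
    where c : ∀ p q → 2 * p * q ≡ 2 * q * p
          c = solve-∀

^-distribʳ-* : ∀ a b m → (a * b) ^ m ≡ a ^ m * b ^ m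
^-distribʳ-* a b zero = refl
^-distribʳ-* a b (suc m) rewrite ^-distribʳ-* a b m = interchange a b (a ^ m) (b ^ m)

self^self>0 : ∀ N → 0 < N ^ N
self^self>0 zero = s≤s z≤n
self^self>0 (suc N) = m^n>0 (suc N) (suc N)

cancelˡ-≤ : ∀ {k a b} → 0 < k → k * a ≤ k * b → a ≤ b
cancelˡ-≤ {suc k} _ h = *-cancelˡ-≤ (suc k) h

-- For given S + x the product S^N x is largest when x is the mean S/N, so the tangent is taken at
-- (N + 1) S. This adjoins x to N numbers with sum S in the proof of AM-GM.
amgm-step : ∀ N S x → suc N ^ suc N * (S ^ N * x) ≤ N ^ N * (S + x) ^ suc N
amgm-step zero S x = ≤-trans (≤-reflexive (l x)) (≤-trans (m≤n+m x S) (≤-reflexive (r S x)))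
  where l : ∀ x → 1 * (1 * x) ≡ x
        l = solve-∀
        r : ∀ S x → S + x ≡ 1 * ((S + x) * 1)
        r = solve-∀
amgm-step N@(suc N') S x = cancelˡ-≤ {N} (s≤s z≤n) (+-cancelʳ-≤ (N * ((suc N * S) ^ suc N)) _ _ (begin
  N * (suc N ^ suc N * (S ^ N * x)) + N * ((suc N * S) ^ suc N)
    ≡⟨ cong (λ z → N * (suc N ^ suc N * (S ^ N * x)) + N * z) (^-distribʳ-* (suc N) S (suc N)) ⟩
  N * (suc N ^ suc N * (S ^ N * x)) + N * (suc N ^ suc N * S ^ suc N)
    ≡⟨ e1 N x S (suc N ^ N) (S ^ N) ⟩
  suc N * (N * (S + x)) * (suc N ^ N * S ^ N)
    ≡⟨ cong (suc N * (N * (S + x)) *_) (^-distribʳ-* (suc N) S N) ⟨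
  suc N * (N * (S + x)) * (suc N * S) ^ N
    ≤⟨ tangent N (N * (S + x)) (suc N * S) ⟩
  (N * (S + x)) ^ suc N + N * (suc N * S) ^ suc N
    ≡⟨ cong (_+ N * (suc N * S) ^ suc N) (trans (^-distribʳ-* N (S + x) (suc N)) (*-assoc N (N ^ N) _)) ⟩
  N * (N ^ N * (S + x) ^ suc N) + N * (suc N * S) ^ suc N ∎))
  where
  e1 : ∀ N x S P Q → N * (suc N * P * (Q * x)) + N * (suc N * P * (S * Q)) ≡ suc N * (N * (S + x)) * (P * Q)
  e1 = solve-∀

amgm : ∀ i j x y → x ^ i * y ^ j * (i + j) ^ (i + j) ≤ (i * x + j * y) ^ (i + j)
amgm i zero x y rewrite +-identityʳ i | +-identityʳ (i * x) = ≤-reflexive (trans (cong (_* i ^ i) (*-identityʳ (x ^ i))) (trans (*-comm (x ^ i) _) (sym (^-distribʳ-* i x i))))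
amgm i (suc j) x y rewrite +-suc i j = cancelˡ-≤ (self^self>0 N) (begin
  N ^ N * (x ^ i * (y * y ^ j) * suc N ^ suc N)
    ≡⟨ e1 (N ^ N) (x ^ i) y (y ^ j) (suc N ^ suc N) ⟩
  suc N ^ suc N * (x ^ i * y ^ j * N ^ N * y)
    ≤⟨ *-monoʳ-≤ (suc N ^ suc N) (*-monoˡ-≤ y (amgm i j x y)) ⟩
  suc N ^ suc N * ((i * x + j * y) ^ N * y)
    ≤⟨ amgm-step N (i * x + j * y) y ⟩
  N ^ N * ((i * x + j * y) + y) ^ suc N
    ≡⟨ cong (λ z → N ^ N * z ^ suc N) (e2 (i * x) j y) ⟩
  N ^ N * (i * x + (y + j * y)) ^ suc N ∎)
  where
  N = i + j
  e1 : ∀ a b c d e → a * (b * (c * d) * e) ≡ e * (b * d * a * c)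
  e1 = solve-∀
  e2 : ∀ a j y → (a + j * y) + y ≡ a + (y + j * y)
  e2 = solve-∀

-- (1 + 1/j)^j ≤ (1 + 1/m)^(m+1), denominators cleared.
e-sandwich : ∀ j m → suc j ^ j * m ^ suc m ≤ suc m ^ suc m * j ^ j
e-sandwich zero m = ≤-trans (≤-reflexive (*-identityˡ _)) (≤-trans (^-monoˡ-≤ (suc m) (n≤1+n m)) (≤-reflexive (sym (*-identityʳ _))))
e-sandwich j@(suc _) m = cancelˡ-≤ {N ^ N * (suc m ^ j * j ^ suc m)}
  (*-mono-≤ (self^self>0 N) (*-mono-≤ (m^n>0 (suc m) j) (m^n>0 j (suc m)))) (begin
  N ^ N * (suc m ^ j * j ^ suc m) * (suc j ^ j * m ^ suc m)
    ≡⟨ e1 (N ^ N) (suc m ^ j) (j ^ suc m) (suc j ^ j) (m ^ suc m) ⟩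
  (suc j ^ j * suc m ^ j) * (m ^ suc m * j ^ suc m) * N ^ N
    ≡⟨ cong₂ (λ a b → a * b * N ^ N) (^-distribʳ-* (suc j) (suc m) j) (^-distribʳ-* m j (suc m)) ⟨
  (suc j * suc m) ^ j * (m * j) ^ suc m * N ^ N
    -- AM-GM for j copies of 1 + 1/j and m + 1 copies of m/(m + 1), all scaled by j (m + 1):
    -- unscaled, their mean is exactly 1.
    ≤⟨ amgm j (suc m) (suc j * suc m) (m * j) ⟩
  (j * (suc j * suc m) + suc m * (m * j)) ^ N
    ≡⟨ cong (_^ N) (e2 j m) ⟩
  (N * (suc m * j)) ^ N
    ≡⟨ trans (^-distribʳ-* N (suc m * j) N) (cong (N ^ N *_) (trans (^-distribʳ-* (suc m) j N) (cong₂ _*_ (^-distribˡ-+-* (suc m) j (suc m)) (^-distribˡ-+-* j j (suc m))))) ⟩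
  N ^ N * ((suc m ^ j * suc m ^ suc m) * (j ^ j * j ^ suc m))
    ≡⟨ e3 (N ^ N) (suc m ^ j) (suc m ^ suc m) (j ^ j) (j ^ suc m) ⟩
  N ^ N * (suc m ^ j * j ^ suc m) * (suc m ^ suc m * j ^ j) ∎)
  where
  N = j + suc m
  e1 : ∀ a b c d e → a * (b * c) * (d * e) ≡ (d * b) * (e * c) * a
  e1 = solve-∀
  e2 : ∀ j m → j * (suc j * suc m) + suc m * (m * j) ≡ (j + suc m) * (suc m * j)
  e2 = solve-∀
  e3 : ∀ a b c d e → a * ((b * c) * (d * e)) ≡ a * (b * e) * (c * d)
  e3 = solve-∀

-- e lies between eLo-num n / eLo-den n = (1 + 1/n)^n and eHi-num n / eHi-den n = (1 + 1/n)^(n+1).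
eLo-num eLo-den eHi-num eHi-den : ℕ → ℕ
eLo-num n = suc n ^ n
eLo-den n = n ^ n
eHi-num n = suc n ^ suc n
eHi-den n = n ^ suc n

eLo≤3 : ∀ n → eLo-num n ≤ 3 * eLo-den n
eLo≤3 n = *-cancelʳ-≤ _ _ 15625 (begin
  suc n ^ n * 15625 ≤⟨ e-sandwich n 5 ⟩
  46656 * n ^ n ≤⟨ *-monoˡ-≤ (n ^ n) (≤ᵇ⇒≤ 46656 46875 _) ⟩
  46875 * n ^ n ≡⟨ l (n ^ n) ⟩
  3 * n ^ n * 15625 ∎)
  where
  l : ∀ x → 46875 * x ≡ 3 * x * 15625
  l = solve-∀

-- K^K / K! telescopes to the product of (1 + 1/j)^j over 0 < j < K, and `e-sandwich` bounds each
-- factor by eHi.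
self^self≤!eHi : ∀ n K → K ^ K * eHi-den n ^ K ≤ K ! * eHi-num n ^ K
self^self≤!eHi n zero = ≤-refl
self^self≤!eHi n (suc K) = begin
  suc K * suc K ^ K * (q * q ^ K) ≡⟨ e1 (suc K) (suc K ^ K) q (q ^ K) ⟩
  suc K * q ^ K * (suc K ^ K * q) ≤⟨ *-monoʳ-≤ (suc K * q ^ K) (e-sandwich K n) ⟩
  suc K * q ^ K * (p * K ^ K) ≡⟨ e2 (suc K) (q ^ K) p (K ^ K) ⟩
  suc K * p * (K ^ K * q ^ K) ≤⟨ *-monoʳ-≤ (suc K * p) (self^self≤!eHi n K) ⟩
  suc K * p * (K ! * p ^ K) ≡⟨ interchange (suc K) p (K !) (p ^ K) ⟩
  suc K * K ! * (p * p ^ K) ∎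
  where
  p = eHi-num n
  q = eHi-den n
  e1 : ∀ a b c d → a * b * (c * d) ≡ a * d * (b * c)
  e1 = solve-∀
  e2 : ∀ a b c d → a * b * (c * d) ≡ a * c * (d * b)
  e2 = solve-∀

-- With exponents j + 1 the same telescoping gives K^(K+1) / K!, now with each of the K - 1 factors
-- at least eLo. The remaining eLo is at most 3. The loss 3K is polynomial and disappears under a
-- K-th root.
!eLo≤self^self : ∀ n a → suc a ! * eLo-num n ^ suc a ≤ 3 * suc a * (suc a ^ suc a * eLo-den n ^ suc a)
!eLo≤self^self n zero = ≤-trans (≤-reflexive (l (eLo-num n))) (≤-trans (eLo≤3 n) (≤-reflexive (r (eLo-den n))))
  where l : ∀ u → 1 * (u * 1) ≡ u
        l = solve-∀
        r : ∀ v → 3 * v ≡ 3 * 1 * (1 * 1 * (v * 1))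
        r = solve-∀
!eLo≤self^self n (suc b) = begin
  suc a * a ! * (u * u ^ a) ≡⟨ interchange (suc a) (a !) u (u ^ a) ⟩
  suc a * u * (a ! * u ^ a) ≤⟨ *-monoʳ-≤ (suc a * u) (!eLo≤self^self n b) ⟩
  suc a * u * (3 * a * (a ^ a * v ^ a)) ≡⟨ e2 (suc a) u a (a ^ a) (v ^ a) ⟩
  3 * suc a * v ^ a * (u * (a * a ^ a)) ≤⟨ *-monoʳ-≤ (3 * suc a * v ^ a) (e-sandwich n a) ⟩
  3 * suc a * v ^ a * (suc a ^ suc a * v) ≡⟨ e3 (suc a) (v ^ a) (suc a ^ suc a) v ⟩
  3 * suc a * (suc a ^ suc a * (v * v ^ a)) ∎
  where
  a = suc b
  u = eLo-num n
  v = eLo-den n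
  e2 : ∀ s u a x y → s * u * (3 * a * (x * y)) ≡ 3 * s * y * (u * (a * x))
  e2 = solve-∀
  e3 : ∀ s y x v → 3 * s * y * (x * v) ≡ 3 * s * (x * (v * y))
  e3 = solve-∀

!≤!^ : ∀ b c → (b + c) ! ≤ b ! * (b + c) ^ c
!≤!^ b zero rewrite +-identityʳ b = ≤-reflexive (sym (*-identityʳ (b !)))
!≤!^ b (suc c) rewrite +-suc b c = begin
  suc (b + c) * (b + c) ! ≤⟨ *-monoʳ-≤ (suc (b + c)) (!≤!^ b c) ⟩
  suc (b + c) * (b ! * (b + c) ^ c) ≤⟨ *-monoʳ-≤ (suc (b + c)) (*-monoʳ-≤ (b !) (^-monoˡ-≤ c (n≤1+n (b + c)))) ⟩
  suc (b + c) * (b ! * suc (b + c) ^ c) ≡⟨ x∙yz≈y∙xz (suc (b + c)) (b !) _ ⟩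
  b ! * (suc (b + c) * suc (b + c) ^ c) ∎

!^≤! : ∀ b c → b ! * b ^ c ≤ (b + c) !
!^≤! b zero rewrite +-identityʳ b = ≤-reflexive (*-identityʳ (b !))
!^≤! b (suc c) rewrite +-suc b c = begin
  b ! * (b * b ^ c) ≡⟨ x∙yz≈y∙xz (b !) b (b ^ c) ⟩
  b * (b ! * b ^ c) ≤⟨ *-mono-≤ (≤-trans (m≤m+n b c) (n≤1+n _)) (!^≤! b c) ⟩
  suc (b + c) * (b + c) ! ∎

poisson-mode : ∀ l a → l ^ a * l ! ≤ l ^ l * a !
poisson-mode l a with ≤-total a l
... | inj₁ a≤l = subst (λ m → m ^ a * m ! ≤ m ^ m * a !) (m+[n∸m]≡n a≤l) (low (l ∸ a))
  where
  e : ∀ a b c → a * (b * c) ≡ a * c * b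
  e = solve-∀
  low : ∀ c → (a + c) ^ a * (a + c) ! ≤ (a + c) ^ (a + c) * a !
  low c = begin
    (a + c) ^ a * (a + c) ! ≤⟨ *-monoʳ-≤ ((a + c) ^ a) (!≤!^ a c) ⟩
    (a + c) ^ a * (a ! * (a + c) ^ c) ≡⟨ e ((a + c) ^ a) (a !) ((a + c) ^ c) ⟩
    (a + c) ^ a * (a + c) ^ c * a ! ≡⟨ cong (_* a !) (^-distribˡ-+-* (a + c) a c) ⟨
    (a + c) ^ (a + c) * a ! ∎
... | inj₂ l≤a = subst (λ m → l ^ m * l ! ≤ l ^ l * m !) (m+[n∸m]≡n l≤a) (high (a ∸ l))
  where
  e : ∀ a b c → a * b * c ≡ a * (c * b)
  e = solve-∀
  high : ∀ c → l ^ (l + c) * l ! ≤ l ^ l * (l + c) !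
  high c = begin
    l ^ (l + c) * l ! ≡⟨ cong (_* l !) (^-distribˡ-+-* l l c) ⟩
    l ^ l * l ^ c * l ! ≡⟨ e (l ^ l) (l ^ c) (l !) ⟩
    l ^ l * (l ! * l ^ c) ≤⟨ *-monoʳ-≤ (l ^ l) (!^≤! l c) ⟩
    l ^ l * (l + c) ! ∎

!>0 : ∀ m → 0 < m !
!>0 zero = s≤s z≤n
!>0 (suc m) = *-mono-≤ (s≤s (z≤n {m})) (!>0 m)

-- In place of the exponential series, its largest term l^l / l! is bounded by `self^self≤!eHi`.
poisson-bound : ∀ n l a → l ^ a * eHi-den n ^ l ≤ a ! * eHi-num n ^ l
poisson-bound n l a = cancelˡ-≤ (!>0 l) (begin
  l ! * (l ^ a * q ^ l) ≡⟨ e1 (l !) (l ^ a) (q ^ l) ⟩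
  l ^ a * l ! * q ^ l ≤⟨ *-monoˡ-≤ (q ^ l) (poisson-mode l a) ⟩
  l ^ l * a ! * q ^ l ≡⟨ e2 (l ^ l) (a !) (q ^ l) ⟩
  a ! * (l ^ l * q ^ l) ≤⟨ *-monoʳ-≤ (a !) (self^self≤!eHi n l) ⟩
  a ! * (l ! * p ^ l) ≡⟨ x∙yz≈y∙xz (a !) (l !) (p ^ l) ⟩
  l ! * (a ! * p ^ l) ∎)
  where
  p = eHi-num n
  q = eHi-den n
  e1 : ∀ a b c → a * (b * c) ≡ b * a * c
  e1 = solve-∀
  e2 : ∀ a b c → a * b * c ≡ b * (a * c)
  e2 = solve-∀

[mn]^k : ∀ m n k → (m ^ n) ^ k ≡ (m ^ k) ^ n
[mn]^k m n k = trans (^-*-assoc m n k) (trans (cong (m ^_) (*-comm n k)) (sym (^-*-assoc m k n)))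

bernoulli : ∀ n l → (n + l) * n ^ l ≤ n * suc n ^ l
bernoulli n zero rewrite +-identityʳ n = ≤-refl
bernoulli n (suc l) = begin
  (n + suc l) * (n * n ^ l) ≡⟨ e1 n l (n ^ l) ⟩
  n * ((n + l) * n ^ l) + n * n ^ l ≤⟨ +-mono-≤ (*-monoʳ-≤ n (bernoulli n l)) (*-monoʳ-≤ n (^-monoˡ-≤ l (n≤1+n n))) ⟩
  n * (n * suc n ^ l) + n * suc n ^ l ≡⟨ e2 n (suc n ^ l) ⟩
  n * (suc n * suc n ^ l) ∎
  where
  e1 : ∀ n l x → (n + suc l) * (n * x) ≡ n * ((n + l) * x) + n * x
  e1 = solve-∀
  e2 : ∀ n x → n * (n * x) + n * x ≡ n * (suc n * x)
  e2 = solve-∀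

-- Bernoulli's 1 + l/n ≤ (1 + 1/n)^l raised to the n-th power gives eLo^l; a further (1 + 1/n)^l
-- turns it into eHi^l.
[n+l]^n-bound : ∀ n l → (n + l) ^ n * eHi-den n ^ l ≤ n ^ n * eHi-num n ^ l
[n+l]^n-bound n l = begin
  (n + l) ^ n * (n * n ^ n) ^ l ≡⟨ cong ((n + l) ^ n *_) (trans (^-distribʳ-* n (n ^ n) l) (cong (n ^ l *_) ([mn]^k n n l))) ⟩
  (n + l) ^ n * (n ^ l * (n ^ l) ^ n) ≡⟨ x∙yz≈y∙xz ((n + l) ^ n) (n ^ l) ((n ^ l) ^ n) ⟩
  n ^ l * ((n + l) ^ n * (n ^ l) ^ n) ≡⟨ cong (n ^ l *_) (^-distribʳ-* (n + l) (n ^ l) n) ⟨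
  n ^ l * ((n + l) * n ^ l) ^ n ≤⟨ *-mono-≤ (^-monoˡ-≤ l (n≤1+n n)) (^-monoˡ-≤ n (bernoulli n l)) ⟩
  suc n ^ l * (n * suc n ^ l) ^ n ≡⟨ cong (suc n ^ l *_) (^-distribʳ-* n (suc n ^ l) n) ⟩
  suc n ^ l * (n ^ n * (suc n ^ l) ^ n) ≡⟨ x∙yz≈y∙xz (suc n ^ l) (n ^ n) _ ⟩
  n ^ n * (suc n ^ l * (suc n ^ l) ^ n) ≡⟨ cong (n ^ n *_) (trans (^-distribʳ-* (suc n) (suc n ^ n) l) (cong (suc n ^ l *_) ([mn]^k (suc n) n l))) ⟨
  n ^ n * (suc n * suc n ^ n) ^ l ∎

-- The numbers g(d) = α(d+2r)/β, with α/β = (1+1/r)/(1+1/n)^n, satisfy g(d)^d ≥ d·g(d-1)^(d-1),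
-- which is all that the induction for Brègman's bound needs.
module Weights (n r : ℕ) where
  α β : ℕ
  α = suc r * eLo-den n
  β = r * eLo-num n

  weight-step : ∀ d → β * suc d * (d + 2 * r) ^ d ≤ α * (suc d + 2 * r) ^ suc d
  weight-step d with suc d ≤? r
  -- Small d: the shift by 2r alone suffices, because eLo ≤ 3 and 3 (d + 1) ≤ d + 1 + 2r.
  ... | yes d<r = begin
    r * u * suc d * X ^ d ≡⟨ e1 r u (suc d) (X ^ d) ⟩
    u * (r * suc d * X ^ d) ≤⟨ *-monoˡ-≤ _ (eLo≤3 n) ⟩
    3 * v * (r * suc d * X ^ d) ≡⟨ e2 v r (suc d) (X ^ d) ⟩
    r * v * (3 * suc d * X ^ d) ≤⟨ *-mono-≤ (*-monoˡ-≤ v (n≤1+n r)) (*-mono-≤ 3d≤ (^-monoˡ-≤ d (n≤1+n X))) ⟩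
    suc r * v * (suc X * suc X ^ d) ∎
    where
    u = eLo-num n
    v = eLo-den n
    X = d + 2 * r
    e1 : ∀ r u d x → r * u * d * x ≡ u * (r * d * x)
    e1 = solve-∀
    e2 : ∀ v r d x → 3 * v * (r * d * x) ≡ r * v * (3 * d * x)
    e2 = solve-∀
    3d≤ : 3 * suc d ≤ suc d + 2 * r
    3d≤ = +-monoʳ-≤ (suc d) (*-monoʳ-≤ 2 d<r)
  ... | no d≮r = cancelˡ-≤ {suc X ^ s} (m^n>0 (suc X) s) (begin
    suc X ^ s * (r * u * suc d * X ^ d) ≡⟨ e1 (suc X ^ s) r u (suc d) (X ^ d) ⟩
    suc X ^ s * X ^ d * u * (r * suc d) ≤⟨ *-monoʳ-≤ (suc X ^ s * X ^ d * u) rd≤ ⟩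
    suc X ^ s * X ^ d * u * (suc r * d) ≡⟨ e2 (suc X ^ s) (X ^ d) u (suc r) d ⟩
    suc r * X ^ d * u * (suc X ^ s * d) ≤⟨ *-monoʳ-≤ (suc r * X ^ d * u) bern ⟩
    suc r * X ^ d * u * X ^ suc s ≡⟨ e3 (suc r) (X ^ d) u (X ^ suc s) ⟩
    suc r * (u * (X ^ d * X ^ suc s)) ≡⟨ cong (λ z → suc r * (u * z)) (trans (sym (^-distribˡ-+-* X d (suc s))) (cong (X ^_) (+-suc d s))) ⟩
    suc r * (u * X ^ suc X) ≤⟨ *-monoʳ-≤ (suc r) (e-sandwich n X) ⟩
    suc r * (suc X ^ suc X * v) ≡⟨ cong (λ z → suc r * (z * v)) (trans (cong (suc X ^_) (trans (cong suc (+-comm d s)) (sym (+-suc s d)))) (^-distribˡ-+-* (suc X) s (suc d))) ⟩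
    suc r * (suc X ^ s * suc X ^ suc d * v) ≡⟨ e4 (suc r) (suc X ^ s) (suc X ^ suc d) v ⟩
    suc X ^ s * (suc r * v * suc X ^ suc d) ∎)
    where
    u = eLo-num n
    v = eLo-den n
    s = 2 * r
    X = d + s
    e1 : ∀ a r u d x → a * (r * u * d * x) ≡ a * x * u * (r * d)
    e1 = solve-∀
    e2 : ∀ a b c e f → a * b * c * (e * f) ≡ e * b * c * (a * f)
    e2 = solve-∀
    e3 : ∀ a b c e → a * b * c * e ≡ a * (c * (b * e))
    e3 = solve-∀
    e4 : ∀ a b c e → a * (b * c * e) ≡ b * (a * e * c)
    e4 = solve-∀
    rd≤ : r * suc d ≤ suc r * d
    rd≤ = ≤-trans (≤-reflexive (*-suc r d)) (+-monoˡ-≤ (r * d) (≤-pred (≰⇒> d≮r)))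
    bern : suc X ^ s * d ≤ X ^ suc s
    bern = +-cancelʳ-≤ (s * suc X ^ suc s) _ _ (≤-trans (≤-reflexive (e d s (suc X ^ s))) (tangent s X (suc X)))
      where e : ∀ d s y → y * d + s * (suc (d + s) * y) ≡ suc s * (d + s) * y
            e = solve-∀

-- Finite sums and products

bit : Bool → ℕ
bit true = 1
bit false = 0

⟦_⟧ : {P : Set} → Dec P → ℕ
⟦ P? ⟧ = bit (does P?)

⟦⟧-yes : {P : Set} (P? : Dec P) → P → ⟦ P? ⟧ ≡ 1
⟦⟧-yes (yes _) _ = refl
⟦⟧-yes (no ¬p) p = ⊥-elim (¬p p)

⟦⟧-no : {P : Set} (P? : Dec P) → ¬ P → ⟦ P? ⟧ ≡ 0
⟦⟧-no (no _) _ = refl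
⟦⟧-no (yes p) ¬p = ⊥-elim (¬p p)

⟦⟧≤1 : {P : Set} (P? : Dec P) → ⟦ P? ⟧ ≤ 1
⟦⟧≤1 (yes _) = ≤-refl
⟦⟧≤1 (no _) = z≤n

⟦⟧-cong : {P Q : Set} (P? : Dec P) (Q? : Dec Q) → (P → Q) → (Q → P) → ⟦ P? ⟧ ≡ ⟦ Q? ⟧
⟦⟧-cong (yes p) Q? f g = sym (⟦⟧-yes Q? (f p))
⟦⟧-cong (no ¬p) Q? f g = sym (⟦⟧-no Q? (¬p ∘ g))

⟦⟧-mono : {P Q : Set} (P? : Dec P) (Q? : Dec Q) → (P → Q) → ⟦ P? ⟧ ≤ ⟦ Q? ⟧
⟦⟧-mono (yes p) Q? f = ≤-reflexive (sym (⟦⟧-yes Q? (f p)))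
⟦⟧-mono (no ¬p) Q? f = z≤n

δ : ∀ {n} → Fin n → Fin n → ℕ
δ i j = ⟦ i ≟ j ⟧

δ-refl : ∀ {n} (i : Fin n) → δ i i ≡ 1
δ-refl i = ⟦⟧-yes (i ≟ i) refl

∑-mono : ∀ {n} {f g : Fin n → ℕ} → (∀ i → f i ≤ g i) → ∑ f ≤ ∑ g
∑-mono {zero} h = z≤n
∑-mono {suc n} h = +-mono-≤ (h zero) (∑-mono (h ∘ suc))

∏-mono : ∀ {n} {f g : Fin n → ℕ} → (∀ i → f i ≤ g i) → ∏ f ≤ ∏ g
∏-mono {zero} h = ≤-refl
∏-mono {suc n} h = *-mono-≤ (h zero) (∏-mono (h ∘ suc))

∏-const : ∀ n c → ∏ {n} (λ _ → c) ≡ c ^ n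
∏-const zero c = refl
∏-const (suc n) c = cong (c *_) (∏-const n c)

∑-const : ∀ n c → ∑ {n} (λ _ → c) ≡ n * c
∑-const zero c = refl
∑-const (suc n) c = cong (c +_) (∑-const n c)

∏>0 : ∀ {n} {f : Fin n → ℕ} → (∀ i → 0 < f i) → 0 < ∏ f
∏>0 {zero} h = s≤s z≤n
∏>0 {suc n} h = *-mono-≤ (h zero) (∏>0 (h ∘ suc))

∏-^ : ∀ {n} (f : Fin n → ℕ) k → ∏ (λ i → f i ^ k) ≡ ∏ f ^ k
∏-^ {zero} f k = sym (^-zeroˡ k)
∏-^ {suc n} f k = trans (cong (f zero ^ k *_) (∏-^ (f ∘ suc) k)) (sym (^-distribʳ-* (f zero) _ k))

∏-^∑ : ∀ {n} c (f : Fin n → ℕ) → ∏ (λ i → c ^ f i) ≡ c ^ ∑ f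
∏-^∑ {zero} c f = refl
∏-^∑ {suc n} c f = trans (cong (c ^ f zero *_) (∏-^∑ c (f ∘ suc))) (sym (^-distribˡ-+-* c (f zero) _))

*-distribˡ-∑ : ∀ {n} c (f : Fin n → ℕ) → c * ∑ f ≡ ∑ (λ i → c * f i)
*-distribˡ-∑ {zero} c f = *-zeroʳ c
*-distribˡ-∑ {suc n} c f = trans (*-distribˡ-+ c (f zero) _) (cong (c * f zero +_) (*-distribˡ-∑ c (f ∘ suc)))

*-distribʳ-∑ : ∀ {n} c (f : Fin n → ℕ) → ∑ f * c ≡ ∑ (λ i → f i * c)
*-distribʳ-∑ c f = trans (*-comm _ c) (trans (*-distribˡ-∑ c f) (∑-cong (λ i → *-comm c (f i))))

∑-zero : ∀ {n} {f : Fin n → ℕ} → (∀ i → f i ≡ 0) → ∑ f ≡ 0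
∑-zero {zero} h = refl
∑-zero {suc n} h = cong₂ _+_ (h zero) (∑-zero (h ∘ suc))

∑-term : ∀ {n} (f : Fin n → ℕ) i → f i ≤ ∑ f
∑-term f zero = m≤m+n _ _
∑-term f (suc i) = ≤-trans (∑-term (f ∘ suc) i) (m≤n+m _ _)

∑-single : ∀ {n} (f : Fin n → ℕ) i → (∀ j → j ≢ i → f j ≡ 0) → ∑ f ≡ f i
∑-single {suc n} f zero h = trans (cong (f zero +_) (∑-zero (λ j → h (suc j) λ ()))) (+-identityʳ _)
∑-single {suc n} f (suc i) h = trans (cong (_+ ∑ (f ∘ suc)) (h zero λ ())) (∑-single (f ∘ suc) i (λ j j≢i → h (suc j) (j≢i ∘ Fin.suc-injective)))

∑-δ : ∀ {n} (i : Fin n) (f : Fin n → ℕ) → ∑ (λ j → δ i j * f j) ≡ f i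
∑-δ i f = trans (∑-single _ i (λ j j≢i → cong (_* f j) (⟦⟧-no (i ≟ j) (j≢i ∘ sym)))) (trans (cong (_* f i) (δ-refl i)) (*-identityˡ _))

∏-δ : ∀ {n} (i : Fin n) (f : Fin n → ℕ) → ∏ (λ j → f j ^ δ i j) ≡ f i
∏-δ {suc n} zero f = trans (cong (f zero * 1 *_) (trans (∏-const n 1) (^-zeroˡ n))) (trans (*-identityʳ _) (*-identityʳ _))
∏-δ {suc n} (suc i) f = trans (*-identityˡ _) (trans (∏-cong (λ j → cong (f (suc j) ^_) (δ-suc i j))) (∏-δ i (f ∘ suc)))
  where δ-suc : ∀ {n} (i j : Fin n) → δ (suc i) (suc j) ≡ δ i j
        δ-suc i j = ⟦⟧-cong (suc i ≟ suc j) (i ≟ j) Fin.suc-injective (cong suc)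

card : ∀ {n} → (Fin n → Bool) → ℕ
card b = ∑ (bit ∘ b)

card-true : ∀ n → card {n} (λ _ → true) ≡ n
card-true n = trans (∑-const n 1) (*-identityʳ n)

-- Multiplied out because the exponent of y in the product is n - card b.
∏-if : ∀ {n} (b : Fin n → Bool) x y → ∏ (λ i → if b i then x else y) * y ^ card b ≡ x ^ card b * y ^ n
∏-if {zero} b x y = refl
∏-if {suc n} b x y with b zero | ∏-if (b ∘ suc) x y
... | true | ih = trans (interchange x (∏ (λ i → if b (suc i) then x else y)) y (y ^ card (b ∘ suc))) (trans (cong (x * y *_) ih) (interchange x y (x ^ card (b ∘ suc)) (y ^ n)))
... | false | ih = trans (*-assoc y _ _) (trans (cong (y *_) ih) (x∙yz≈y∙xz y (x ^ card (b ∘ suc)) (y ^ n)))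

^-cancel-≤ : ∀ k {a b} → 0 < k → a ^ k ≤ b ^ k → a ≤ b
^-cancel-≤ k@(suc _) {a} {b} _ h with a ≤? b
... | yes p = p
... | no ¬p = ⊥-elim (<⇒≱ (^-monoˡ-< k (≰⇒> ¬p)) h)

sumL : List Elem → (Elem → ℕ) → ℕ
sumL [] f = 0
sumL (x ∷ xs) f = f x + sumL xs f

prodL : List Elem → (Elem → ℕ) → ℕ
prodL [] f = 1
prodL (x ∷ xs) f = f x * prodL xs f

sumL-cong : (xs : List Elem) {f g : Elem → ℕ} → (∀ x → f x ≡ g x) → sumL xs f ≡ sumL xs g
sumL-cong [] h = refl
sumL-cong (x ∷ xs) h = cong₂ _+_ (h x) (sumL-cong xs h)

sumL-mono-All : {xs : List Elem} {f g : Elem → ℕ} → All (λ x → f x ≤ g x) xs → sumL xs f ≤ sumL xs g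
sumL-mono-All [] = z≤n
sumL-mono-All (h ∷ hs) = +-mono-≤ h (sumL-mono-All hs)

sumL-mono : (xs : List Elem) {f g : Elem → ℕ} → (∀ x → f x ≤ g x) → sumL xs f ≤ sumL xs g
sumL-mono xs h = sumL-mono-All (All.universal h xs)

prodL-mono-All : {xs : List Elem} {f g : Elem → ℕ} → All (λ x → f x ≤ g x) xs → prodL xs f ≤ prodL xs g
prodL-mono-All [] = ≤-refl
prodL-mono-All (h ∷ hs) = *-mono-≤ h (prodL-mono-All hs)

sumL-const : (xs : List Elem) (c : ℕ) → sumL xs (λ _ → c) ≡ length xs * c
sumL-const [] c = refl
sumL-const (x ∷ xs) c = cong (c +_) (sumL-const xs c)

prodL-const : (xs : List Elem) (c : ℕ) → prodL xs (λ _ → c) ≡ c ^ length xs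
prodL-const [] c = refl
prodL-const (x ∷ xs) c = cong (c *_) (prodL-const xs c)

sumL-+ : (xs : List Elem) (f g : Elem → ℕ) → sumL xs (λ x → f x + g x) ≡ sumL xs f + sumL xs g
sumL-+ [] f g = refl
sumL-+ (x ∷ xs) f g = trans (cong (f x + g x +_) (sumL-+ xs f g)) (l (f x) (g x) _ _)
  where l : ∀ a b c d → a + b + (c + d) ≡ a + c + (b + d)
        l = solve-∀

prodL-* : (xs : List Elem) (f g : Elem → ℕ) → prodL xs (λ x → f x * g x) ≡ prodL xs f * prodL xs g
prodL-* [] f g = refl
prodL-* (x ∷ xs) f g = trans (cong (f x * g x *_) (prodL-* xs f g)) (interchange (f x) (g x) _ _)

*-distribˡ-sumL : ∀ c (xs : List Elem) (f : Elem → ℕ) → c * sumL xs f ≡ sumL xs (λ x → c * f x)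
*-distribˡ-sumL c [] f = *-zeroʳ c
*-distribˡ-sumL c (x ∷ xs) f = trans (*-distribˡ-+ c (f x) _) (cong (c * f x +_) (*-distribˡ-sumL c xs f))

*-distribʳ-sumL : ∀ c (xs : List Elem) (f : Elem → ℕ) → sumL xs f * c ≡ sumL xs (λ x → f x * c)
*-distribʳ-sumL c xs f = trans (*-comm _ c) (trans (*-distribˡ-sumL c xs f) (sumL-cong xs (λ x → *-comm c (f x))))

sumL-swap : (xs : List Elem) (ys : List Elem′) (f : Elem → Elem′ → ℕ) →
  sumL xs (λ x → sumL ys (f x)) ≡ sumL ys (λ y → sumL xs (λ x → f x y))
sumL-swap [] ys f = sym (trans (sumL-const ys 0) (*-zeroʳ (length ys)))
sumL-swap (x ∷ xs) ys f = trans (cong (sumL ys (f x) +_) (sumL-swap xs ys f)) (sym (sumL-+ ys (f x) _))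

sumL-∑-swap : ∀ {n} (xs : List Elem) (f : Elem → Fin n → ℕ) →
  sumL xs (λ x → ∑ (f x)) ≡ ∑ (λ i → sumL xs (λ x → f x i))
sumL-∑-swap {n = n} [] f = sym (∑-zero {n} (λ _ → refl))
sumL-∑-swap (x ∷ xs) f = trans (cong (∑ (f x) +_) (sumL-∑-swap xs f)) (sym (∑-+ (f x) _))

∏-prodL-swap : ∀ {n} (xs : List Elem) (f : Elem → Fin n → ℕ) →
  prodL xs (λ x → ∏ (f x)) ≡ ∏ (λ i → prodL xs (λ x → f x i))
∏-prodL-swap {n = n} [] f = sym (trans (∏-const n 1) (^-zeroˡ n))
∏-prodL-swap (x ∷ xs) f = trans (cong (∏ (f x) *_) (∏-prodL-swap xs f)) (sym (∏-* (f x) _))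

sumL-++ : (xs ys : List Elem) (f : Elem → ℕ) → sumL (xs ++ ys) f ≡ sumL xs f + sumL ys f
sumL-++ [] ys f = refl
sumL-++ (x ∷ xs) ys f = trans (cong (f x +_) (sumL-++ xs ys f)) (sym (+-assoc (f x) _ _))

sumL-map : (g : Elem → Elem′) (xs : List Elem) (f : Elem′ → ℕ) → sumL (map g xs) f ≡ sumL xs (f ∘ g)
sumL-map g [] f = refl
sumL-map g (x ∷ xs) f = cong (f (g x) +_) (sumL-map g xs f)

prodL-map : (g : Elem → Elem′) (xs : List Elem) (f : Elem′ → ℕ) → prodL (map g xs) f ≡ prodL xs (f ∘ g)
prodL-map g [] f = refl
prodL-map g (x ∷ xs) f = cong (f (g x) *_) (prodL-map g xs f)

sumL-concatMap : (g : Elem → List Elem′) (xs : List Elem) (f : Elem′ → ℕ) → sumL (concatMap g xs) f ≡ sumL xs (λ x → sumL (g x) f)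
sumL-concatMap g [] f = refl
sumL-concatMap g (x ∷ xs) f = trans (sumL-++ (g x) _ f) (cong (sumL (g x) f +_) (sumL-concatMap g xs f))

length-filter : {P : Elem → Set} (P? : Decidable P) (xs : List Elem) → length (filter P? xs) ≡ sumL xs (λ x → ⟦ P? x ⟧)
length-filter P? [] = refl
length-filter P? (x ∷ xs) with P? x
... | yes _ = cong suc (length-filter P? xs)
... | no _ = length-filter P? xs

length-sumL : (xs : List Elem) → length xs ≡ sumL xs (λ _ → 1)
length-sumL xs = sym (trans (sumL-const xs 1) (*-identityʳ _))

sumL-filter : {P : Elem → Set} (P? : Decidable P) (xs : List Elem) (f : Elem → ℕ) →
  sumL (filter P? xs) f ≡ sumL xs (λ x → ⟦ P? x ⟧ * f x)
sumL-filter P? [] f = refl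
sumL-filter P? (x ∷ xs) f with P? x
... | yes _ = cong₂ _+_ (sym (*-identityˡ (f x))) (sumL-filter P? xs f)
... | no _ = sumL-filter P? xs f

-- Brègman's bound

-- Gibbs' inequality for the distribution (t, Q)/(t + Q) against (1, c)/(c + 1). It is AM-GM for t
-- copies of Q and Q copies of c t; the degenerate cases rely on 0^0 = 1.
gibbs₂ : ∀ t Q c → (t + Q) ^ (t + Q) * c ^ Q ≤ suc c ^ (t + Q) * (t ^ t * Q ^ Q)
gibbs₂ zero Q c = begin
  Q ^ Q * c ^ Q ≤⟨ *-monoʳ-≤ (Q ^ Q) (^-monoˡ-≤ Q (n≤1+n c)) ⟩
  Q ^ Q * suc c ^ Q ≡⟨ e (Q ^ Q) (suc c ^ Q) ⟩
  suc c ^ Q * (1 * Q ^ Q) ∎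
  where
  e : ∀ a b → a * b ≡ b * (1 * a)
  e = solve-∀
gibbs₂ t@(suc _) zero c = subst (λ z → z ^ z * 1 ≤ suc c ^ z * (t ^ t * 1)) (sym (+-identityʳ t)) (begin
  t ^ t * 1 ≡⟨ e (t ^ t) ⟩
  1 * (t ^ t * 1) ≤⟨ *-monoˡ-≤ (t ^ t * 1) (m^n>0 (suc c) t) ⟩
  suc c ^ t * (t ^ t * 1) ∎)
  where
  e : ∀ a → a * 1 ≡ 1 * (a * 1)
  e = solve-∀
gibbs₂ t@(suc _) Q@(suc _) c = cancelˡ-≤ {Q ^ t * t ^ Q} (*-mono-≤ (m^n>0 Q t) (m^n>0 t Q)) (begin
  Q ^ t * t ^ Q * ((t + Q) ^ (t + Q) * c ^ Q)
    ≡⟨ e1 (Q ^ t) (t ^ Q) ((t + Q) ^ (t + Q)) (c ^ Q) ⟩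
  Q ^ t * (c ^ Q * t ^ Q) * (t + Q) ^ (t + Q)
    ≡⟨ cong (λ z → Q ^ t * z * (t + Q) ^ (t + Q)) (^-distribʳ-* c t Q) ⟨
  Q ^ t * (c * t) ^ Q * (t + Q) ^ (t + Q)
    ≤⟨ amgm t Q Q (c * t) ⟩
  (t * Q + Q * (c * t)) ^ (t + Q)
    ≡⟨ cong (_^ (t + Q)) (e2 t Q c) ⟩
  (suc c * (t * Q)) ^ (t + Q)
    ≡⟨ trans (^-distribʳ-* (suc c) (t * Q) (t + Q)) (cong (suc c ^ (t + Q) *_) (trans (^-distribʳ-* t Q (t + Q)) (cong₂ _*_ (^-distribˡ-+-* t t Q) (^-distribˡ-+-* Q t Q)))) ⟩
  suc c ^ (t + Q) * ((t ^ t * t ^ Q) * (Q ^ t * Q ^ Q))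
    ≡⟨ e3 (suc c ^ (t + Q)) (t ^ t) (t ^ Q) (Q ^ t) (Q ^ Q) ⟩
  Q ^ t * t ^ Q * (suc c ^ (t + Q) * (t ^ t * Q ^ Q)) ∎)
  where
  e1 : ∀ a b c d → a * b * (c * d) ≡ a * (d * b) * c
  e1 = solve-∀
  e2 : ∀ t Q c → t * Q + Q * (c * t) ≡ suc c * (t * Q)
  e2 = solve-∀
  e3 : ∀ s a b c d → s * ((a * b) * (c * d)) ≡ c * b * (s * (a * d))
  e3 = solve-∀

-- Entropy is at most the logarithm of the size of the support, exponentiated. One point of the
-- support is split off at a time by `gibbs₂`.
gibbs : ∀ {N} (b : Fin N → Bool) (t : Fin N → ℕ) → (∀ k → b k ≡ false → t k ≡ 0) →
  ∑ t ^ ∑ t ≤ card b ^ ∑ t * ∏ (λ k → t k ^ t k)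
gibbs {zero} b t h = ≤-refl
gibbs {suc N} b t h with b zero in eq | gibbs (b ∘ suc) (t ∘ suc) (h ∘ suc)
... | false | ih rewrite h zero eq = ≤-trans ih (≤-reflexive (cong (card (b ∘ suc) ^ Q *_) (sym (*-identityˡ _))))
  where Q = ∑ (t ∘ suc)
... | true | ih = cancelˡ-≤ c^Q>0 (begin
  c ^ Q * (t₀ + Q) ^ (t₀ + Q) ≡⟨ *-comm (c ^ Q) _ ⟩
  (t₀ + Q) ^ (t₀ + Q) * c ^ Q ≤⟨ gibbs₂ t₀ Q c ⟩
  suc c ^ (t₀ + Q) * (t₀ ^ t₀ * Q ^ Q) ≤⟨ *-monoʳ-≤ (suc c ^ (t₀ + Q)) (*-monoʳ-≤ (t₀ ^ t₀) ih) ⟩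
  suc c ^ (t₀ + Q) * (t₀ ^ t₀ * (c ^ Q * Π)) ≡⟨ e (suc c ^ (t₀ + Q)) (t₀ ^ t₀) (c ^ Q) Π ⟩
  c ^ Q * (suc c ^ (t₀ + Q) * (t₀ ^ t₀ * Π)) ∎)
  where
  t₀ = t zero
  Q = ∑ (t ∘ suc)
  c = card (b ∘ suc)
  Π = ∏ (λ k → t (suc k) ^ t (suc k))
  e : ∀ s a b c → s * (a * (b * c)) ≡ b * (s * (a * c))
  e = solve-∀
  -- The factor c^Q to be cancelled is positive also for empty remaining support, since then Q = 0.
  pos : ∀ {N} (b : Fin N → Bool) (t : Fin N → ℕ) → (∀ k → b k ≡ false → t k ≡ 0) → 0 < card b ⊎ ∑ t ≡ 0
  pos {zero} b t h = inj₂ refl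
  pos {suc N} b t h with b zero in eq
  ... | true = inj₁ (s≤s z≤n)
  ... | false with pos (b ∘ suc) (t ∘ suc) (h ∘ suc)
  ... | inj₁ p = inj₁ p
  ... | inj₂ p = inj₂ (cong₂ _+_ (h zero eq) p)
  c^Q>0 : 0 < c ^ Q
  c^Q>0 with pos (b ∘ suc) (t ∘ suc) (h ∘ suc)
  ... | inj₁ p = m^n>0 c {{>-nonZero p}} Q
  ... | inj₂ p rewrite p = s≤s z≤n

count : ∀ {N} → Fin N → List (Fin N) → ℕ
count k xs = sumL xs (λ x → δ x k)

∑-count : ∀ {N} (xs : List (Fin N)) → ∑ (λ k → count k xs) ≡ length xs
∑-count xs = trans (sym (sumL-∑-swap xs δ)) (trans (sumL-cong xs (λ x → trans (∑-cong (λ k → sym (*-identityʳ (δ x k)))) (∑-δ x (λ _ → 1)))) (sym (length-sumL xs)))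

prodL-count : ∀ {N} (xs : List (Fin N)) (h : Fin N → ℕ) → prodL xs h ≡ ∏ (λ k → h k ^ count k xs)
prodL-count {N} [] h = sym (trans (∏-const N 1) (^-zeroˡ N))
prodL-count (x ∷ xs) h = sym (begin-equality
  ∏ (λ k → h k ^ (δ x k + count k xs)) ≡⟨ ∏-cong (λ k → ^-distribˡ-+-* (h k) (δ x k) _) ⟩
  ∏ (λ k → h k ^ δ x k * h k ^ count k xs) ≡⟨ ∏-* (λ k → h k ^ δ x k) _ ⟩
  ∏ (λ k → h k ^ δ x k) * ∏ (λ k → h k ^ count k xs) ≡⟨ cong₂ _*_ (∏-δ x h) (sym (prodL-count xs h)) ⟩
  h x * prodL xs h ∎)

count-absent : ∀ {N} (b : Fin N → Bool) {xs} → All (λ x → b x ≡ true) xs → ∀ k → b k ≡ false → count k xs ≡ 0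
count-absent b [] k eq = refl
count-absent b {x ∷ xs} (px ∷ pxs) k eq = cong₂ _+_ (⟦⟧-no (x ≟ k) (λ where refl → case trans (sym px) eq of λ ())) (count-absent b pxs k eq)

-- With `xs` the values at one row of a list of matchings, `count x xs` is the number of matchings
-- through a given cell. This is the convexity step of Schrijver's proof of Brègman's theorem.
entropy : ∀ {N} (b : Fin N → Bool) (xs : List (Fin N)) → All (λ x → b x ≡ true) xs →
  length xs ^ length xs ≤ prodL xs (λ x → card b * count x xs)
entropy b xs ok = begin
  length xs ^ length xs
    ≡⟨ cong (λ z → z ^ z) (∑-count xs) ⟨
  ∑ t ^ ∑ t
    ≤⟨ gibbs b t (count-absent b ok) ⟩
  card b ^ ∑ t * ∏ (λ k → t k ^ t k)
    ≡⟨ cong₂ _*_ (cong (card b ^_) (∑-count xs)) (sym (prodL-count xs t)) ⟩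
  card b ^ length xs * prodL xs t
    ≡⟨ cong (_* prodL xs t) (prodL-const xs (card b)) ⟨
  prodL xs (λ _ → card b) * prodL xs t
    ≡⟨ prodL-* xs (λ _ → card b) t ⟨
  prodL xs (λ x → card b * t x) ∎
  where
  t : Fin _ → ℕ
  t k = count k xs

_∖_ : ∀ {N} → (Fin N → Bool) → Fin N → Fin N → Bool
(b ∖ k) j = b j ∧ not (does (j ≟ k))

card-∖ : ∀ {N} (b : Fin N → Bool) k → card b ≡ bit (b k) + card (b ∖ k)
card-∖ {suc N} b k = begin-equality
  card b ≡⟨ ∑-remove (bit ∘ b) ⟩
  bit (b k) + ∑ (F.removeAt (bit ∘ b) k) ≡⟨ cong (bit (b k) +_) (∑-cong same) ⟩
  bit (b k) + (0 + ∑ (F.removeAt (bit ∘ (b ∖ k)) k)) ≡⟨ cong (λ z → bit (b k) + (z + ∑ (F.removeAt (bit ∘ (b ∖ k)) k))) at-k ⟨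
  bit (b k) + (bit ((b ∖ k) k) + ∑ (F.removeAt (bit ∘ (b ∖ k)) k)) ≡⟨ cong (bit (b k) +_) (∑-remove (bit ∘ (b ∖ k))) ⟨
  bit (b k) + card (b ∖ k) ∎
  where
  at-k : bit ((b ∖ k) k) ≡ 0
  at-k with b k | k ≟ k
  ... | true | yes _ = refl
  ... | true | no ¬p = ⊥-elim (¬p refl)
  ... | false | _ = refl
  same : ∀ j → bit (b (punchIn k j)) ≡ bit ((b ∖ k) (punchIn k j))
  same j with b (punchIn k j) | punchIn k j ≟ k
  ... | true | yes p = ⊥-elim (Fin.punchInᵢ≢i k j p)
  ... | true | no _ = refl
  ... | false | _ = refl

∖-true : ∀ {N} (b : Fin N → Bool) k j → b j ≡ true → j ≢ k → (b ∖ k) j ≡ true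
∖-true b k j p q rewrite p with j ≟ k
... | yes e = ⊥-elim (q e)
... | no _ = refl

∖-true⁻ : ∀ {N} (b : Fin N → Bool) k j → (b ∖ k) j ≡ true → b j ≡ true × j ≢ k
∖-true⁻ b k j p with b j | j ≟ k
... | true | no q = refl , q
... | true | yes _ = case p of λ ()
... | false | _ = case p of λ ()

AllPairs-All : {R : Elem → Elem → Set} {P : Elem → Set} {xs : List Elem} → AllPairs R xs → All P xs →
  AllPairs (λ x y → R x y × P x × P y) xs
AllPairs-All [] [] = []
AllPairs-All (rs ∷ rss) (p ∷ ps) = All.zipWith (λ (r , q) → r , p , q) (rs , ps) ∷ AllPairs-All rss ps

∑-δ-injective : ∀ {m N} (σ : Fin m → Fin N) → (∀ i j → σ i ≡ σ j → i ≡ j) → ∀ i → ∑ (λ j → δ (σ j) (σ i)) ≡ 1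
∑-δ-injective σ inj i = trans (∑-single _ i (λ j j≢i → ⟦⟧-no (σ j ≟ σ i) (j≢i ∘ inj j i))) (δ-refl (σ i))

card-∘ : ∀ {m N} (σ : Fin m → Fin N) (b : Fin N → Bool) → (∀ i j → σ i ≡ σ j → i ≡ j) →
  (∀ k → b k ≡ true → ∃ λ j → σ j ≡ k) → card (b ∘ σ) ≡ card b
card-∘ σ b inj cover = begin-equality
  ∑ (λ i → bit (b (σ i))) ≡⟨ ∑-cong (λ i → sym (∑-δ (σ i) (bit ∘ b))) ⟩
  ∑ (λ i → ∑ (λ k → δ (σ i) k * bit (b k))) ≡⟨ ∑-swap (λ i k → δ (σ i) k * bit (b k)) ⟩
  ∑ (λ k → ∑ (λ i → δ (σ i) k * bit (b k))) ≡⟨ ∑-cong (λ k → *-distribʳ-∑ (bit (b k)) (λ i → δ (σ i) k)) ⟨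
  ∑ (λ k → ∑ (λ i → δ (σ i) k) * bit (b k)) ≡⟨ ∑-cong once ⟩
  ∑ (λ k → bit (b k)) ∎
  where
  once : ∀ k → ∑ (λ i → δ (σ i) k) * bit (b k) ≡ bit (b k)
  once k with b k in eq
  ... | false = *-zeroʳ (∑ (λ i → δ (σ i) k))
  ... | true with cover k eq
  ... | j , refl rewrite ∑-δ-injective σ inj j = refl

-- The last clause replaces squareness: it survives the deletion of a row together with its image.
Matches : ∀ {m N} → (Fin m → Fin N → Bool) → (Fin m → Fin N) → Set
Matches A σ = (∀ i → A i (σ i) ≡ true) × (∀ i j → σ i ≡ σ j → i ≡ j) × (∀ i k → A i k ≡ true → ∃ λ j → σ j ≡ k)

Differ : ∀ {m N} → (Fin m → Fin N) → (Fin m → Fin N) → Set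
Differ σ τ = ¬ (∀ i → σ i ≡ τ i)

module Bregman (α β s : ℕ) (α>0 : 0 < α) (s>0 : 0 < s)
  (step : ∀ d → β * suc d * (d + s) ^ d ≤ α * (suc d + s) ^ suc d) where

  weight : ℕ → ℕ
  weight d = α * (d + s)

  weight>0 : ∀ d → 0 < weight d
  weight>0 d = *-mono-≤ α>0 (≤-trans s>0 (m≤n+m s d))

  weight-step′ : ∀ e → suc e * β * weight e ^ e ≤ weight (suc e) ^ suc e
  weight-step′ e = begin
    suc e * β * (α * (e + s)) ^ e ≡⟨ cong (suc e * β *_) (^-distribʳ-* α (e + s) e) ⟩
    suc e * β * (α ^ e * (e + s) ^ e) ≡⟨ e1 (suc e) β (α ^ e) _ ⟩
    α ^ e * (β * suc e * (e + s) ^ e) ≤⟨ *-monoʳ-≤ (α ^ e) (step e) ⟩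
    α ^ e * (α * (suc e + s) ^ suc e) ≡⟨ e2 (α ^ e) α _ ⟩
    α ^ suc e * (suc e + s) ^ suc e ≡⟨ ^-distribʳ-* α (suc e + s) (suc e) ⟨
    (α * (suc e + s)) ^ suc e ∎
    where
    e1 : ∀ a b c d → a * b * (c * d) ≡ c * (b * a * d)
    e1 = solve-∀
    e2 : ∀ a b c → a * (b * c) ≡ b * a * c
    e2 = solve-∀

  module _ {m N} (A : Fin m → Fin N → Bool) (σ : Fin m → Fin N) (ok : Matches A σ) where
    h : Fin m → Fin m → ℕ
    h i i′ = weight (card (A i′ ∖ σ i))

    -- Removing σ i shortens row i′ for exactly d values of i, where d is its length, and i = i′ is
    -- one of them. The factor `h i′ i′` on the right discounts that one, leaving g(d-1)^(d-1)
    -- g(d)^(m-d) up to normalisation, to which `weight-step′` applies.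
    column-bound : ∀ i′ → card (A i′) * β * ∏ (λ i → h i i′) ≤ h i′ i′ * weight (card (A i′)) ^ m
    column-bound i′ = cancelˡ-≤ {y ^ suc e} (m^n>0 y {{>-nonZero (weight>0 d)}} (suc e)) (begin
      y ^ suc e * (d * β * ∏ (λ i → h i i′)) ≡⟨ e1 (y ^ suc e) d β _ ⟩
      d * β * (∏ (λ i → h i i′) * y ^ suc e) ≡⟨ cong (d * β *_) prod ⟩
      d * β * (x ^ suc e * y ^ m) ≡⟨ e2 d β x (x ^ e) (y ^ m) ⟩
      x * y ^ m * (d * β * x ^ e) ≤⟨ *-monoʳ-≤ (x * y ^ m) last ⟩
      x * y ^ m * y ^ suc e ≡⟨ *-comm (x * y ^ m) _ ⟩
      y ^ suc e * (x * y ^ m) ∎)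
      where
      a = A i′
      d = card a
      e = card (a ∖ σ i′)
      d≡ : d ≡ suc e
      d≡ = trans (card-∖ a (σ i′)) (cong (λ z → bit z + e) (proj₁ ok i′))
      x = weight e
      y = weight d
      e1 : ∀ a b c d → a * (b * c * d) ≡ b * c * (d * a)
      e1 = solve-∀
      e2 : ∀ d b x X Y → d * b * (x * X * Y) ≡ x * Y * (d * b * X)
      e2 = solve-∀
      same : ∀ i → h i i′ ≡ (if a (σ i) then x else y)
      same i with a (σ i) | card-∖ a (σ i)
      ... | true | eq = cong weight (suc-injective (trans (sym eq) d≡))
      ... | false | eq = cong weight (sym eq)
      prod : ∏ (λ i → h i i′) * y ^ suc e ≡ x ^ suc e * y ^ m
      prod = trans (cong₂ _*_ (∏-cong same) (cong (y ^_) (sym c≡))) (trans (∏-if (a ∘ σ) x y) (cong (λ z → x ^ z * y ^ m) c≡))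
        where c≡ : card (a ∘ σ) ≡ suc e
              c≡ = trans (card-∘ σ a (proj₁ (proj₂ ok)) (proj₂ (proj₂ ok) i′)) d≡
      last : d * β * x ^ e ≤ y ^ suc e
      last = subst (λ z → z * β * x ^ e ≤ weight z ^ suc e) (sym d≡) (weight-step′ e)

  cnt : ∀ {m N} → List (Fin m → Fin N) → Fin m → Fin N → ℕ
  cnt S i k = count k (map (λ σ → σ i) S)

  -- Schrijver's argument: `entropy` is used in every row, the matchings through a cell are counted
  -- by induction, and for each σ the resulting double product is regrouped by the row that is being
  -- shortened. The power m P keeps all exponents integral.
  bregman : ∀ m {N} (A : Fin m → Fin N → Bool) (S : List (Fin m → Fin N)) →
    AllPairs Differ S → All (Matches A) S → length S * β ^ m ≤ ∏ (λ i → weight (card (A i)))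
  bregman m A [] _ _ = z≤n
  bregman zero A (σ ∷ []) _ _ = ≤-refl
  bregman zero A (σ ∷ τ ∷ S) ((σ≠τ ∷ _) ∷ _) _ = ⊥-elim (σ≠τ λ ())
  bregman m@(suc m′) {N} A S@(_ ∷ _) distinct ok = ^-cancel-≤ (m * P) (s≤s z≤n) (begin
    (P * β ^ m) ^ (m * P)
      ≡⟨ ^-distribʳ-* P (β ^ m) (m * P) ⟩
    P ^ (m * P) * (β ^ m) ^ (m * P)
      ≡⟨ cong₂ _*_ (trans (cong (P ^_) (*-comm m P)) (sym (^-*-assoc P P m))) (sym (^-*-assoc (β ^ m) m P)) ⟩
    (P ^ P) ^ m * ((β ^ m) ^ m) ^ P
      ≡⟨ cong₂ _*_ (sym (∏-const m (P ^ P))) (sym (prodL-const S ((β ^ m) ^ m))) ⟩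
    ∏ {m} (λ i → P ^ P) * prodL S (λ _ → (β ^ m) ^ m)
      ≤⟨ *-monoˡ-≤ _ (∏-mono ent) ⟩
    ∏ {m} (λ i → prodL S (λ σ → card (A i) * cnt S i (σ i))) * prodL S (λ _ → (β ^ m) ^ m)
      ≡⟨ cong (_* prodL S (λ _ → (β ^ m) ^ m)) (sym (∏-prodL-swap S (λ σ i → card (A i) * cnt S i (σ i)))) ⟩
    prodL S (λ σ → ∏ (λ i → card (A i) * cnt S i (σ i))) * prodL S (λ _ → (β ^ m) ^ m)
      ≡⟨ sym (prodL-* S (λ σ → ∏ (λ i → card (A i) * cnt S i (σ i))) (λ _ → (β ^ m) ^ m)) ⟩
    prodL S (λ σ → ∏ (λ i → card (A i) * cnt S i (σ i)) * (β ^ m) ^ m)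
      ≤⟨ prodL-mono-All (All.map main ok) ⟩
    prodL S (λ _ → X ^ m)
      ≡⟨ trans (prodL-const S (X ^ m)) (^-*-assoc X m P) ⟩
    X ^ (m * P) ∎)
    where
    P = length S
    X = ∏ (λ i → weight (card (A i)))
    ent : ∀ i → P ^ P ≤ prodL S (λ σ → card (A i) * cnt S i (σ i))
    ent i = subst₂ (λ a b → a ^ a ≤ b) (length-map (λ σ → σ i) S) (prodL-map (λ σ → σ i) S (λ x → card (A i) * count x (map (λ σ → σ i) S)))
      (entropy (A i) (map (λ σ → σ i) S) (All.map⁺ (All.map (λ ok → proj₁ ok i) ok)))
    -- Row i is deleted, while column k is only emptied, so the type of columns does not change in
    -- the induction.
    minor : (i : Fin m) (k : Fin N) → cnt S i k * β ^ m′ ≤ ∏ (λ i′ → weight (card (A (punchIn i i′) ∖ k)))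
    minor i k = subst (λ z → z * β ^ m′ ≤ _) len
      (bregman m′ (λ i′ → A (punchIn i i′) ∖ k) (map (λ σ → σ ∘ punchIn i) Sₖ) dist matches)
      where
      Sₖ = filter (λ σ → σ i ≟ k) S
      len : length (map (λ σ → σ ∘ punchIn i) Sₖ) ≡ cnt S i k
      len = trans (length-map _ Sₖ) (trans (length-filter (λ σ → σ i ≟ k) S) (sym (sumL-map (λ σ → σ i) S _)))
      dist : AllPairs Differ (map (λ σ → σ ∘ punchIn i) Sₖ)
      dist = AllPairs.map⁺ (AllPairs.map
        (λ {σ} {τ} (σ≠τ , p , q) eq → σ≠τ λ j → case i ≟ j of λ where
           (yes refl) → trans p (sym q)
           (no i≢j) → subst (λ z → σ z ≡ τ z) (Fin.punchIn-punchOut i≢j) (eq (punchOut i≢j)))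
        (AllPairs-All (AllPairs.filter⁺ (λ σ → σ i ≟ k) distinct) (All.all-filter (λ σ → σ i ≟ k) S)))
      matches : All (Matches (λ i′ → A (punchIn i i′) ∖ k)) (map (λ σ → σ ∘ punchIn i) Sₖ)
      matches = All.map⁺ (All.zipWith
        (λ {σ} ((a , inj , cover) , p) →
          (λ i′ → ∖-true (A (punchIn i i′)) k _ (a (punchIn i i′))
            (λ q → Fin.punchInᵢ≢i i i′ (inj _ _ (trans q (sym p))))) ,
          (λ j j′ q → Fin.punchIn-injective i j j′ (inj _ _ q)) ,
          (λ i′ k′ q → let (t , k′≢k) = ∖-true⁻ (A (punchIn i i′)) k k′ q
                           (j , σj) = cover (punchIn i i′) k′ t
                           i≢j = λ (i≡j : i ≡ j) → k′≢k (trans (sym σj) (trans (cong σ (sym i≡j)) p))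
                       in punchOut i≢j , trans (cong σ (Fin.punchIn-punchOut i≢j)) σj))
        (All.filter⁺ (λ σ → σ i ≟ k) ok , All.all-filter (λ σ → σ i ≟ k) S))
    main : ∀ {σ} → Matches A σ → ∏ (λ i → card (A i) * cnt S i (σ i)) * (β ^ m) ^ m ≤ X ^ m
    -- The diagonal factors `H i i` complete the products over i′ ≠ i to full ones, which can then
    -- be interchanged.
    main {σ} okσ = cancelˡ-≤ {∏ (λ i → H i i)} (∏>0 {f = λ i → H i i} (λ i → weight>0 _)) (begin
      ∏ (λ i → H i i) * (∏ (λ i → card (A i) * cnt S i (σ i)) * (β ^ m) ^ m)
        ≡⟨ e1 (∏ (λ i → H i i)) (∏ (λ i → card (A i) * cnt S i (σ i))) ((β ^ m) ^ m) ⟩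
      ∏ (λ i → card (A i) * cnt S i (σ i)) * ((β ^ m) ^ m * ∏ (λ i → H i i))
        ≡⟨ cong (∏ (λ i → card (A i) * cnt S i (σ i)) *_) (trans (cong (_* ∏ (λ i → H i i)) (sym (∏-const m (β ^ m)))) (sym (∏-* {m} (λ _ → β ^ m) (λ i → H i i)))) ⟩
      ∏ (λ i → card (A i) * cnt S i (σ i)) * ∏ (λ i → β ^ m * H i i)
        ≡⟨ sym (∏-* (λ i → card (A i) * cnt S i (σ i)) (λ i → β ^ m * H i i)) ⟩
      ∏ (λ i → card (A i) * cnt S i (σ i) * (β ^ m * H i i))
        ≤⟨ ∏-mono row ⟩
      ∏ (λ i → card (A i) * β * ∏ (H i))
        ≡⟨ ∏-* (λ i → card (A i) * β) (λ i → ∏ (H i)) ⟩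
      ∏ (λ i → card (A i) * β) * ∏ (λ i → ∏ (H i))
        ≡⟨ cong (∏ (λ i → card (A i) * β) *_) (∏-swap H) ⟩
      ∏ (λ i → card (A i) * β) * ∏ (λ i′ → ∏ (λ i → H i i′))
        ≡⟨ sym (∏-* (λ i → card (A i) * β) (λ i′ → ∏ (λ i → H i i′))) ⟩
      ∏ (λ i′ → card (A i′) * β * ∏ (λ i → H i i′))
        ≤⟨ ∏-mono (column-bound A σ okσ) ⟩
      ∏ (λ i → H i i * weight (card (A i)) ^ m)
        ≡⟨ ∏-* (λ i → H i i) (λ i → weight (card (A i)) ^ m) ⟩
      ∏ (λ i → H i i) * ∏ (λ i → weight (card (A i)) ^ m)
        ≡⟨ cong (∏ (λ i → H i i) *_) (∏-^ (λ i → weight (card (A i))) m) ⟩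
      ∏ (λ i → H i i) * X ^ m ∎)
      where
      H = h A σ okσ
      e1 : ∀ a b c → a * (b * c) ≡ b * (c * a)
      e1 = solve-∀
      e2 : ∀ d c b B h → d * c * ((b * B) * h) ≡ d * b * (h * (c * B))
      e2 = solve-∀
      row : ∀ i → card (A i) * cnt S i (σ i) * (β ^ m * H i i) ≤ card (A i) * β * ∏ (H i)
      row i = begin
        card (A i) * cnt S i (σ i) * (β ^ m * H i i) ≡⟨ e2 (card (A i)) (cnt S i (σ i)) β (β ^ m′) (H i i) ⟩
        card (A i) * β * (H i i * (cnt S i (σ i) * β ^ m′)) ≤⟨ *-monoʳ-≤ (card (A i) * β) (*-monoʳ-≤ (H i i) (minor i (σ i))) ⟩
        card (A i) * β * (H i i * ∏ (λ i′ → H i (punchIn i i′))) ≡⟨ cong (card (A i) * β *_) (sym (∏-remove {i = i} (H i))) ⟩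
        card (A i) * β * ∏ (H i) ∎

∏-change : ∀ {n} (f g : Fin n → ℕ) i c → (∀ j → j ≢ i → f j ≡ g j) → f i ≡ c * g i → ∏ f ≡ c * ∏ g
∏-change {suc n} f g i c off at = begin-equality
  ∏ f ≡⟨ ∏-remove {i = i} f ⟩
  f i * ∏ (F.removeAt f i) ≡⟨ cong₂ _*_ at (∏-cong (λ j → off (punchIn i j) (Fin.punchInᵢ≢i i j))) ⟩
  c * g i * ∏ (F.removeAt g i) ≡⟨ *-assoc c (g i) _ ⟩
  c * (g i * ∏ (F.removeAt g i)) ≡⟨ cong (c *_) (∏-remove {i = i} g) ⟨
  c * ∏ g ∎

∑-change : ∀ {n} (f g : Fin n → ℕ) i c → (∀ j → j ≢ i → f j ≡ g j) → f i ≡ c + g i → ∑ f ≡ c + ∑ g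
∑-change {suc n} f g i c off at = begin-equality
  ∑ f ≡⟨ ∑-remove {i = i} f ⟩
  f i + ∑ (F.removeAt f i) ≡⟨ cong₂ _+_ at (∑-cong (λ j → off (punchIn i j) (Fin.punchInᵢ≢i i j))) ⟩
  c + g i + ∑ (F.removeAt g i) ≡⟨ +-assoc c (g i) _ ⟩
  c + (g i + ∑ (F.removeAt g i)) ≡⟨ cong (c +_) (∑-remove {i = i} g) ⟨
  c + ∑ g ∎

*-⟦⟧-cong : {P : Set} (P? : Dec P) {x y : ℕ} → (P → x ≡ y) → x * ⟦ P? ⟧ ≡ y * ⟦ P? ⟧
*-⟦⟧-cong (yes p) h = cong (_* 1) (h p)
*-⟦⟧-cong (no _) {x} {y} _ = trans (*-zeroʳ x) (sym (*-zeroʳ y))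

-- Eulerian orientations and permanents

module Eulerian (n : ℕ) where
  V = Fin n
  Edges = Vec (V × V)

  deg : ∀ {N} → V → Edges N → ℕ
  deg w [] = 0
  deg w ((x , y) ∷ es) = δ x w + δ y w + deg w es

  _≗?_ : (a b : V → ℕ) → Dec (∀ w → a w ≡ b w)
  a ≗? b = Fin.all? (λ w → a w ℕ.≟ b w)

  _⊕_ : (V → ℕ) → V → V → ℕ
  (a ⊕ x) w = δ x w + a w

  -- The number of orientations in which a plus the out-degree equals b plus the in-degree everywhere.
  ε : ∀ {N} → Edges N → (V → ℕ) → (V → ℕ) → ℕ
  ε [] a b = ⟦ a ≗? b ⟧
  ε ((x , y) ∷ es) a b = ε es (a ⊕ x) (b ⊕ y) + ε es (a ⊕ y) (b ⊕ x)

  ε-cong : ∀ {N} (es : Edges N) {a b a′ b′} → (∀ w → a w + b′ w ≡ a′ w + b w) → ε es a b ≡ ε es a′ b′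
  ε-cong [] {a} {b} {a′} {b′} h = ⟦⟧-cong (a ≗? b) (a′ ≗? b′)
    (λ p w → sym (+-cancelˡ-≡ (b w) (b′ w) (a′ w) (trans (cong (_+ b′ w) (sym (p w))) (trans (h w) (+-comm (a′ w) (b w))))))
    (λ p w → +-cancelʳ-≡ (b′ w) (a w) (b w) (trans (h w) (trans (cong (_+ b w) (p w)) (+-comm (b′ w) (b w)))))
  ε-cong ((x , y) ∷ es) {a} {b} {a′} {b′} h = cong₂ _+_
    (ε-cong es (λ w → l (δ x w) (δ y w) (h w)))
    (ε-cong es (λ w → l (δ y w) (δ x w) (h w)))
    where
    e : ∀ c d x y → c + x + (d + y) ≡ c + d + (x + y)
    e = solve-∀
    l : ∀ c d {x y z t} → x + y ≡ z + t → c + x + (d + y) ≡ c + z + (d + t)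
    l c d {x} {y} {z} {t} p = trans (e c d x y) (trans (cong (c + d +_) p) (sym (e c d z t)))

  -- One graph for each edge end at v (a loop has two), with that end reattached to u. After
  -- deletion of an edge uv this replaces a path u, v, y by a single edge between u and y.
  moves : V → V → ∀ {N} → Edges N → List (Edges N)
  moves v u [] = []
  moves v u ((x , y) ∷ es) =
    (if does (x ≟ v) then (((u , y) ∷ es) ∷ []) else []) ++
    (if does (y ≟ v) then (((x , u) ∷ es) ∷ []) else []) ++
    map ((x , y) ∷_) (moves v u es)

  sumL-if : {P : Set} (P? : Dec P) (z : Elem) (f : Elem → ℕ) → sumL (if does P? then (z ∷ []) else []) f ≡ ⟦ P? ⟧ * f z
  sumL-if (yes _) z f = refl
  sumL-if (no _) z f = refl

  sumL-moves : ∀ v u {N} x y (es : Edges N) (f : Edges (suc N) → ℕ) → sumL (moves v u ((x , y) ∷ es)) f ≡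
    δ x v * f ((u , y) ∷ es) + (δ y v * f ((x , u) ∷ es) + sumL (moves v u es) (λ es′ → f ((x , y) ∷ es′)))
  sumL-moves v u x y es f = trans (sumL-++ (if does (x ≟ v) then _ else []) _ f) (cong₂ _+_ (sumL-if (x ≟ v) _ f)
    (trans (sumL-++ (if does (y ≟ v) then _ else []) _ f) (cong₂ _+_ (sumL-if (y ≟ v) _ f) (sumL-map ((x , y) ∷_) (moves v u es) f))))

  length-moves : ∀ v u {N} (es : Edges N) → length (moves v u es) ≡ deg v es
  length-moves v u [] = refl
  length-moves v u ((x , y) ∷ es) = begin-equality
    length (moves v u ((x , y) ∷ es)) ≡⟨ length-sumL (moves v u ((x , y) ∷ es)) ⟩
    sumL (moves v u ((x , y) ∷ es)) (λ _ → 1) ≡⟨ sumL-moves v u x y es (λ _ → 1) ⟩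
    δ x v * 1 + (δ y v * 1 + sumL (moves v u es) (λ _ → 1)) ≡⟨ cong (λ z → δ x v * 1 + (δ y v * 1 + z)) (trans (sym (length-sumL (moves v u es))) (length-moves v u es)) ⟩
    δ x v * 1 + (δ y v * 1 + deg v es) ≡⟨ e (δ x v) (δ y v) (deg v es) ⟩
    δ x v + δ y v + deg v es ∎
    where
    e : ∀ a b c → a * 1 + (b * 1 + c) ≡ a + b + c
    e = solve-∀

  All-if : {P : Set} {Q : Elem → Set} (P? : Dec P) (z : Elem) → (P → Q z) → All Q (if does P? then (z ∷ []) else [])
  All-if (yes p) z h = h p ∷ []
  All-if (no _) z h = []

  deg-moves : ∀ v u {N} (es : Edges N) → All (λ es′ → ∀ w → deg w es′ + δ v w ≡ deg w es + δ u w) (moves v u es)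
  deg-moves v u [] = []
  deg-moves v u ((x , y) ∷ es) = All.++⁺
    (All-if (x ≟ v) _ (λ where refl w → e1 (δ u w) (δ y w) (deg w es) (δ v w)))
    (All.++⁺ (All-if (y ≟ v) _ (λ where refl w → e2 (δ x w) (δ u w) (deg w es) (δ v w)))
      (All.map⁺ (All.map (λ {es′} h w → trans (+-assoc (δ x w + δ y w) (deg w es′) (δ v w)) (trans (cong (δ x w + δ y w +_) (h w)) (sym (+-assoc (δ x w + δ y w) _ _)))) (deg-moves v u es))))
    where
    e1 : ∀ u y d v → u + y + d + v ≡ v + y + d + u
    e1 = solve-∀
    e2 : ∀ x u d v → x + u + d + v ≡ x + v + d + u
    e2 = solve-∀

  -- In an orientation counted by the first (second) ε on the right, the out-degree (in-degree) of v
  -- is half of its factor minus the corresponding summand on the left.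
  moves-identity : ∀ v u → u ≢ v → ∀ {N} (es : Edges N) a b →
    2 * sumL (moves v u es) (λ es′ → ε es′ a b) + (a v * ε es (a ⊕ u) (b ⊕ v) + b v * ε es (a ⊕ v) (b ⊕ u)) ≡
    (deg v es + b v + 1) * ε es (a ⊕ u) (b ⊕ v) + (deg v es + a v + 1) * ε es (a ⊕ v) (b ⊕ u)
  moves-identity v u u≢v [] a b = cong₂ _+_ first second
    where
    first : a v * ε [] (a ⊕ u) (b ⊕ v) ≡ (b v + 1) * ε [] (a ⊕ u) (b ⊕ v)
    first = *-⟦⟧-cong ((a ⊕ u) ≗? (b ⊕ v)) λ p →
      trans (sym (cong (_+ a v) (⟦⟧-no (u ≟ v) u≢v))) (trans (p v) (trans (cong (_+ b v) (δ-refl v)) (+-comm 1 (b v))))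
    second : b v * ε [] (a ⊕ v) (b ⊕ u) ≡ (a v + 1) * ε [] (a ⊕ v) (b ⊕ u)
    second = *-⟦⟧-cong ((a ⊕ v) ≗? (b ⊕ u)) λ p →
      trans (sym (cong (_+ b v) (⟦⟧-no (u ≟ v) u≢v))) (trans (sym (p v)) (trans (cong (_+ a v) (δ-refl v)) (+-comm 1 (a v))))
  -- The induction hypotheses have a v and b v raised by the orientation of the first edge; the
  -- terms added on both sides supply exactly this increase.
  moves-identity v u u≢v ((x , y) ∷ es) a b = +-cancelʳ-≡ (X * P₁ + Y * P₂ + (Y * Q₁ + X * Q₂)) _ _ (begin-equality
    2 * sumL (moves v u ((x , y) ∷ es)) (λ es′ → ε es′ a b) + (a v * ε₁ + b v * ε₂) + (X * P₁ + Y * P₂ + (Y * Q₁ + X * Q₂))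
      ≡⟨ cong₂ (λ s t → 2 * s + t + (X * P₁ + Y * P₂ + (Y * Q₁ + X * Q₂))) sums (cong₂ (λ s t → a v * s + b v * t) ε₁≡ ε₂≡) ⟩
    2 * (X * (P₁ + Q₂) + (Y * (P₂ + Q₁) + (X₁ + X₂))) + (a v * (P₁ + Q₁) + b v * (P₂ + Q₂)) + (X * P₁ + Y * P₂ + (Y * Q₁ + X * Q₂))
      ≡⟨ e1 X Y P₁ P₂ Q₁ Q₂ X₁ X₂ (a v) (b v) ⟩
    (2 * X₁ + ((X + a v) * P₁ + (Y + b v) * P₂)) + (2 * X₂ + ((Y + a v) * Q₁ + (X + b v) * Q₂)) + 2 * (X * (P₁ + Q₂) + Y * (P₂ + Q₁))
      ≡⟨ cong₂ (λ s t → s + t + 2 * (X * (P₁ + Q₂) + Y * (P₂ + Q₁))) (moves-identity v u u≢v es (a ⊕ x) (b ⊕ y)) (moves-identity v u u≢v es (a ⊕ y) (b ⊕ x)) ⟩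
    ((D + (Y + b v) + 1) * P₁ + (D + (X + a v) + 1) * P₂) + ((D + (X + b v) + 1) * Q₁ + (D + (Y + a v) + 1) * Q₂) + 2 * (X * (P₁ + Q₂) + Y * (P₂ + Q₁))
      ≡⟨ e2 X Y P₁ P₂ Q₁ Q₂ D (a v) (b v) ⟩
    (X + Y + D + b v + 1) * (P₁ + Q₁) + (X + Y + D + a v + 1) * (P₂ + Q₂) + (X * P₁ + Y * P₂ + (Y * Q₁ + X * Q₂))
      ≡⟨ cong₂ (λ s t → (X + Y + D + b v + 1) * s + (X + Y + D + a v + 1) * t + (X * P₁ + Y * P₂ + (Y * Q₁ + X * Q₂))) ε₁≡ ε₂≡ ⟨
    (X + Y + D + b v + 1) * ε₁ + (X + Y + D + a v + 1) * ε₂ + (X * P₁ + Y * P₂ + (Y * Q₁ + X * Q₂)) ∎)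
    where
    X = δ x v
    Y = δ y v
    D = deg v es
    P₁ = ε es ((a ⊕ x) ⊕ u) ((b ⊕ y) ⊕ v)
    P₂ = ε es ((a ⊕ x) ⊕ v) ((b ⊕ y) ⊕ u)
    Q₁ = ε es ((a ⊕ y) ⊕ u) ((b ⊕ x) ⊕ v)
    Q₂ = ε es ((a ⊕ y) ⊕ v) ((b ⊕ x) ⊕ u)
    X₁ = sumL (moves v u es) (λ es′ → ε es′ (a ⊕ x) (b ⊕ y))
    X₂ = sumL (moves v u es) (λ es′ → ε es′ (a ⊕ y) (b ⊕ x))
    ε₁ = ε ((x , y) ∷ es) (a ⊕ u) (b ⊕ v)
    ε₂ = ε ((x , y) ∷ es) (a ⊕ v) (b ⊕ u)
    sw : ∀ x y u v a b → x + (u + a) + (v + (y + b)) ≡ u + (x + a) + (y + (v + b))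
    sw = solve-∀
    ε₁≡ : ε₁ ≡ P₁ + Q₁
    ε₁≡ = cong₂ _+_ (ε-cong es (λ w → sw (δ x w) (δ y w) (δ u w) (δ v w) (a w) (b w)))
                    (ε-cong es (λ w → sw (δ y w) (δ x w) (δ u w) (δ v w) (a w) (b w)))
    ε₂≡ : ε₂ ≡ P₂ + Q₂
    ε₂≡ = cong₂ _+_ (ε-cong es (λ w → sw (δ x w) (δ y w) (δ v w) (δ u w) (a w) (b w)))
                    (ε-cong es (λ w → sw (δ y w) (δ x w) (δ v w) (δ u w) (a w) (b w)))
    left : δ x v * ε ((u , y) ∷ es) a b ≡ X * (P₁ + Q₂)
    left with x ≟ v
    ... | no _ = refl
    ... | yes refl = cong (1 *_) (cong₂ _+_
        (ε-cong es (λ w → d1 (δ u w) (a w) (δ y w) (δ v w) (b w)))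
        (ε-cong es (λ w → d2 (δ u w) (a w) (δ y w) (δ v w) (b w))))
      where
      d1 : ∀ u a y v b → u + a + (v + (y + b)) ≡ u + (v + a) + (y + b)
      d1 = solve-∀
      d2 : ∀ u a y v b → y + a + (u + (v + b)) ≡ v + (y + a) + (u + b)
      d2 = solve-∀
    right : δ y v * ε ((x , u) ∷ es) a b ≡ Y * (P₂ + Q₁)
    right with y ≟ v
    ... | no _ = refl
    ... | yes refl = cong (1 *_) (cong₂ _+_
        (ε-cong es (λ w → d1 (δ u w) (a w) (δ x w) (δ v w) (b w)))
        (ε-cong es (λ w → d2 (δ u w) (a w) (δ x w) (δ v w) (b w))))
      where
      d1 : ∀ u a x v b → x + a + (u + (v + b)) ≡ v + (x + a) + (u + b)
      d1 = solve-∀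
      d2 : ∀ u a x v b → u + a + (v + (x + b)) ≡ u + (v + a) + (x + b)
      d2 = solve-∀
    sums : sumL (moves v u ((x , y) ∷ es)) (λ es′ → ε es′ a b) ≡ X * (P₁ + Q₂) + (Y * (P₂ + Q₁) + (X₁ + X₂))
    sums = trans (sumL-moves v u x y es (λ es′ → ε es′ a b)) (cong₂ _+_ left (cong₂ _+_ right (sumL-+ (moves v u es) _ _)))
    e1 : ∀ X Y P₁ P₂ Q₁ Q₂ X₁ X₂ a b →
      2 * (X * (P₁ + Q₂) + (Y * (P₂ + Q₁) + (X₁ + X₂))) + (a * (P₁ + Q₁) + b * (P₂ + Q₂)) + (X * P₁ + Y * P₂ + (Y * Q₁ + X * Q₂)) ≡
      (2 * X₁ + ((X + a) * P₁ + (Y + b) * P₂)) + (2 * X₂ + ((Y + a) * Q₁ + (X + b) * Q₂)) + 2 * (X * (P₁ + Q₂) + Y * (P₂ + Q₁))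
    e1 = solve-∀
    e2 : ∀ X Y P₁ P₂ Q₁ Q₂ D a b →
      ((D + (Y + b) + 1) * P₁ + (D + (X + a) + 1) * P₂) + ((D + (X + b) + 1) * Q₁ + (D + (Y + a) + 1) * Q₂) + 2 * (X * (P₁ + Q₂) + Y * (P₂ + Q₁)) ≡
      (X + Y + D + b + 1) * (P₁ + Q₁) + (X + Y + D + a + 1) * (P₂ + Q₂) + (X * P₁ + Y * P₂ + (Y * Q₁ + X * Q₂))
    e2 = solve-∀

⟦⟧-*-≤ : {P : Set} (P? : Dec P) {x y : ℕ} → (P → y ≤ x) → ⟦ P? ⟧ * y ≤ x
⟦⟧-*-≤ (yes p) h = ≤-trans (≤-reflexive (*-identityˡ _)) (h p)
⟦⟧-*-≤ (no _) h = z≤n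

odd! : ℕ → ℕ
odd! zero = 1
odd! (suc k) = suc (2 * k) * odd! k

odd!-! : ∀ k → odd! k * (2 ^ k * k !) ≡ (2 * k) !
odd!-! zero = refl
odd!-! (suc k) = begin-equality
  suc (2 * k) * odd! k * (2 * 2 ^ k * (suc k * k !)) ≡⟨ e k (odd! k) (2 ^ k) (k !) ⟩
  suc (suc (2 * k)) * (suc (2 * k) * (odd! k * (2 ^ k * k !))) ≡⟨ cong (λ z → suc (suc (2 * k)) * (suc (2 * k) * z)) (odd!-! k) ⟩
  suc (suc (2 * k)) * (suc (2 * k) * (2 * k) !) ≡⟨ cong _! (sym (*-suc 2 k)) ⟩
  (2 * suc k) ! ∎
  where
  e : ∀ k o p f → suc (2 * k) * o * (2 * p * (suc k * f)) ≡ suc (suc (2 * k)) * (suc (2 * k) * (o * (p * f)))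
  e = solve-∀

module Permanent (n : ℕ) where
  open Eulerian n public

  O : V → ℕ
  O _ = 0

  -- Splitting off: an edge uv is merged with each of the 2j + 1 other edge ends at v, where k v = j
  -- + 1. An Eulerian orientation traverses the merged path consistently for j + 1 of these ends, so
  -- v gains the factor (2j + 1)/(j + 1) by which `odd!` over factorial grows.
  eulerian-orientations : ∀ {N} (es : Edges N) (k : V → ℕ) → (∀ w → deg w es ≡ 2 * k w) →
    ∏ (odd! ∘ k) ≤ ε es O O * ∏ (_! ∘ k)
  eulerian-orientations [] k even = ≤-reflexive (begin-equality
    ∏ (odd! ∘ k) ≡⟨ ∏-cong (λ w → trans (cong odd! (k≡0 w)) (cong _! (sym (k≡0 w)))) ⟩
    ∏ (_! ∘ k) ≡⟨ *-identityˡ _ ⟨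
    1 * ∏ (_! ∘ k) ≡⟨ cong (_* ∏ (_! ∘ k)) (⟦⟧-yes (O ≗? O) (λ _ → refl)) ⟨
    ε [] O O * ∏ (_! ∘ k) ∎)
    where
    k≡0 : ∀ w → k w ≡ 0
    k≡0 w = *-cancelˡ-≡ (k w) 0 2 (sym (even w))
  eulerian-orientations {suc N} ((u , v) ∷ es) k even = go (k v) refl
    where
    k′ : V → ℕ
    k′ w = k w ∸ δ v w
    off : (g : ℕ → ℕ) → ∀ w → w ≢ v → g (k w) ≡ g (k′ w)
    off g w w≢v = cong (λ z → g (k w ∸ z)) (sym (⟦⟧-no (v ≟ w) (w≢v ∘ sym)))
    even′ : ∀ w → δ u w + δ v w + deg w es ≡ 2 * k w
    even′ = even
    go : ∀ m → k v ≡ m → ∏ (odd! ∘ k) ≤ ε ((u , v) ∷ es) O O * ∏ (_! ∘ k)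
    go zero kv = case trans (even′ v) (cong (2 *_) kv) of λ p →
      case trans (sym (δ-refl v)) (m+n≡0⇒n≡0 (δ u v) (m+n≡0⇒m≡0 (δ u v + δ v v) p)) of λ ()
    go (suc j) kv = begin
      ∏ (odd! ∘ k) ≡⟨ ∏-change (odd! ∘ k) (odd! ∘ k′) v (suc (2 * j)) (off odd!) (trans (cong odd! kv) (cong (λ z → suc (2 * j) * odd! z) (sym k′v))) ⟩
      suc (2 * j) * ∏ (odd! ∘ k′) ≤⟨ main (u ≟ v) ⟩
      suc j * ε ((u , v) ∷ es) O O * ∏ (_! ∘ k′) ≡⟨ e (suc j) (ε ((u , v) ∷ es) O O) _ ⟩
      ε ((u , v) ∷ es) O O * (suc j * ∏ (_! ∘ k′)) ≡⟨ cong (ε ((u , v) ∷ es) O O *_) (∏-change (_! ∘ k) (_! ∘ k′) v (suc j) (off _!) (trans (cong _! kv) (cong (λ z → suc j * z !) (sym k′v)))) ⟨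
      ε ((u , v) ∷ es) O O * ∏ (_! ∘ k) ∎
      where
      e : ∀ a b c → a * b * c ≡ b * (a * c)
      e = solve-∀
      k′v : k′ v ≡ j
      k′v = cong₂ _∸_ kv (δ-refl v)
      k≡ : ∀ w → k w ≡ k′ w + δ v w
      k≡ w with v ≟ w
      ... | yes refl = trans kv (sym (trans (cong (λ z → z ∸ 1 + 1) kv) (+-comm j 1)))
      ... | no _ = sym (+-identityʳ (k w))
      e3 : ∀ k d → 2 * (k + d) ≡ 2 * k + 2 * d
      e3 = solve-∀
      total : ∀ w → δ u w + δ v w + deg w es ≡ 2 * k′ w + 2 * δ v w
      total w = trans (even′ w) (trans (cong (2 *_) (k≡ w)) (e3 (k′ w) (δ v w)))
      main : Dec (u ≡ v) → suc (2 * j) * ∏ (odd! ∘ k′) ≤ suc j * ε ((u , v) ∷ es) O O * ∏ (_! ∘ k′)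
      -- A loop can be oriented in two ways, and 2 ≥ (2j + 1)/(j + 1).
      main (yes refl) = begin
        suc (2 * j) * ∏ (odd! ∘ k′) ≤⟨ *-mono-≤ (n≤1+n (suc (2 * j))) (eulerian-orientations es k′ (λ w → +-cancelˡ-≡ (2 * δ v w) _ _ (trans (cong (_+ deg w es) (e4 (δ v w))) (trans (total w) (+-comm (2 * k′ w) _))))) ⟩
        suc (suc (2 * j)) * (ε es O O * ∏ (_! ∘ k′)) ≡⟨ e5 j (ε es O O) _ ⟩
        suc j * (ε es O O + ε es O O) * ∏ (_! ∘ k′) ≡⟨ cong (λ z → suc j * (z + z) * ∏ (_! ∘ k′)) (ε-cong es (λ w → sym (+-identityʳ (δ v w + 0)))) ⟩
        suc j * ε ((v , v) ∷ es) O O * ∏ (_! ∘ k′) ∎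
        where
        e4 : ∀ d → 2 * d ≡ d + d
        e4 = solve-∀
        e5 : ∀ j a b → suc (suc (2 * j)) * (a * b) ≡ suc j * (a + a) * b
        e5 = solve-∀
      main (no u≢v) = begin
        suc (2 * j) * ∏ (odd! ∘ k′) ≡⟨ cong (_* ∏ (odd! ∘ k′)) (trans (length-moves v u es) D≡) ⟨
        length (moves v u es) * ∏ (odd! ∘ k′) ≡⟨ sumL-const (moves v u es) _ ⟨
        sumL (moves v u es) (λ _ → ∏ (odd! ∘ k′)) ≤⟨ sumL-mono-All (All.map (λ {es′} h → eulerian-orientations es′ k′ (λ w → e6 {deg w es′} {deg w es} {δ u w} {δ v w} {k′ w} (h w) (total w))) (deg-moves v u es)) ⟩
        sumL (moves v u es) (λ es′ → ε es′ O O * ∏ (_! ∘ k′)) ≡⟨ *-distribʳ-sumL (∏ (_! ∘ k′)) (moves v u es) (λ es′ → ε es′ O O) ⟨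
        sumL (moves v u es) (λ es′ → ε es′ O O) * ∏ (_! ∘ k′) ≡⟨ cong (_* ∏ (_! ∘ k′)) X≡ ⟩
        suc j * ε ((u , v) ∷ es) O O * ∏ (_! ∘ k′) ∎
        where
        D≡ : deg v es ≡ suc (2 * j)
        D≡ = suc-injective (trans (cong₂ (λ a b → a + b + deg v es) (sym (⟦⟧-no (u ≟ v) u≢v)) (sym (δ-refl v))) (trans (even′ v) (trans (cong (2 *_) kv) (*-suc 2 j))))
        e6 : ∀ {d′ d u v k} → d′ + v ≡ d + u → u + v + d ≡ 2 * k + 2 * v → d′ ≡ 2 * k
        e6 {d′} {d} {u} {v} {k} p q = +-cancelʳ-≡ (2 * v) d′ (2 * k) (trans (l1 d′ v) (trans (cong (_+ v) p) (trans (l2 d u v) q)))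
          where l1 : ∀ d v → d + 2 * v ≡ d + v + v
                l1 = solve-∀
                l2 : ∀ d u v → d + u + v ≡ u + v + d
                l2 = solve-∀
        X≡ : sumL (moves v u es) (λ es′ → ε es′ O O) ≡ suc j * ε ((u , v) ∷ es) O O
        X≡ = *-cancelˡ-≡ _ _ 2 (trans (sym (+-identityʳ _)) (trans (moves-identity v u u≢v es O O) (trans (cong (λ z → (z + 0 + 1) * a + (z + 0 + 1) * b) D≡) (l j a b))))
          where
          a = ε es (O ⊕ u) (O ⊕ v)
          b = ε es (O ⊕ v) (O ⊕ u)
          l : ∀ j a b → (suc (2 * j) + 0 + 1) * a + (suc (2 * j) + 0 + 1) * b ≡ 2 * (suc j * (a + b))
          l = solve-∀

  module _ (A : Fin n → V → ℕ) where

    -- The weighted number of x with a w + #{p : x p = w} = b w for all w, where x p has weight A (ρ p) (x p).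
    -- For ρ listing every row once, a = 0 and b = 1 this is the permanent of A.
    C : ∀ {N} → Vec (Fin n) N → (V → ℕ) → (V → ℕ) → ℕ
    C [] a b = ⟦ a ≗? b ⟧
    C (r ∷ ρ) a b = ∑ λ c → A r c * C ρ (a ⊕ c) b

    sumE : ∀ {N} → Vec (Fin n) N → (Edges N → ℕ) → ℕ
    sumE [] f = f []
    sumE (r ∷ ρ) f = ∑ λ c → A r c * ∑ λ d → A r d * sumE ρ (λ es → f ((c , d) ∷ es))

    sumE-mono : ∀ {N} (ρ : Vec (Fin n) N) {f g : Edges N → ℕ} → (∀ es → f es ≤ g es) → sumE ρ f ≤ sumE ρ g
    sumE-mono [] h = h []
    sumE-mono (r ∷ ρ) h = ∑-mono λ c → *-monoʳ-≤ (A r c) (∑-mono λ d → *-monoʳ-≤ (A r d) (sumE-mono ρ (λ es → h _)))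

    sumE-cong : ∀ {N} (ρ : Vec (Fin n) N) {f g : Edges N → ℕ} → (∀ es → f es ≡ g es) → sumE ρ f ≡ sumE ρ g
    sumE-cong [] h = h []
    sumE-cong (r ∷ ρ) h = ∑-cong λ c → cong (A r c *_) (∑-cong λ d → cong (A r d *_) (sumE-cong ρ (λ es → h _)))

    sumE-* : ∀ {N} (ρ : Vec (Fin n) N) (f : Edges N → ℕ) m → sumE ρ f * m ≡ sumE ρ (λ es → f es * m)
    sumE-* [] f m = refl
    sumE-* (r ∷ ρ) f m = trans (*-distribʳ-∑ m (λ c → A r c * ∑ λ d → A r d * sumE ρ (λ es → f ((c , d) ∷ es)))) (∑-cong λ c → trans (*-assoc (A r c) _ m) (cong (A r c *_)
      (trans (*-distribʳ-∑ m (λ d → A r d * sumE ρ (λ es → f ((c , d) ∷ es)))) (∑-cong λ d → trans (*-assoc (A r d) _ m) (cong (A r d *_) (sumE-* ρ (λ es → f ((c , d) ∷ es)) m))))))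

    sumE-+ : ∀ {N} (ρ : Vec (Fin n) N) (f g : Edges N → ℕ) → sumE ρ (λ es → f es + g es) ≡ sumE ρ f + sumE ρ g
    sumE-+ [] f g = refl
    sumE-+ (r ∷ ρ) f g = trans (∑-cong λ c → trans (cong (A r c *_) (trans (∑-cong λ d → trans (cong (A r d *_) (sumE-+ ρ _ _)) (*-distribˡ-+ (A r d) _ _)) (∑-+ (λ d → A r d * sumE ρ (λ es → f ((c , d) ∷ es))) _))) (*-distribˡ-+ (A r c) _ _))
      (∑-+ (λ c → A r c * ∑ λ d → A r d * sumE ρ (λ es → f ((c , d) ∷ es))) _)

    double : ∀ {N} → Vec (Fin n) N → Vec (Fin n) (N ℕ.* 2)
    double [] = []
    double (r ∷ ρ) = r ∷ r ∷ double ρ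

    -- The two values at the copies of a slot become the ends of an edge, so column counts become
    -- degrees. `κ` agrees with `a` only pointwise, which lets the recursion change the order of
    -- summands.
    C-double : ∀ {N} (ρ : Vec (Fin n) N) {a b : V → ℕ} {κ : V → ℕ} → (∀ w → κ w ≡ a w) →
      C (double ρ) a b ≡ sumE ρ (λ es → ⟦ (λ w → κ w + deg w es) ≗? b ⟧)
    C-double [] {a} {b} {κ} h = ⟦⟧-cong (a ≗? b) ((λ w → κ w + 0) ≗? b) (λ p w → trans (+-identityʳ (κ w)) (trans (h w) (p w))) (λ p w → trans (sym (trans (+-identityʳ (κ w)) (h w))) (p w))
    C-double (r ∷ ρ) {a} {b} {κ} h = ∑-cong λ c → cong (A r c *_) (∑-cong λ d → cong (A r d *_)
      (trans (C-double ρ {(a ⊕ c) ⊕ d} {b} {λ w → κ w + (δ c w + δ d w)} (λ w → trans (cong (_+ (δ c w + δ d w)) (h w)) (l (a w) (δ c w) (δ d w))))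
        (sumE-cong ρ (λ es → ⟦⟧-cong (_ ≗? b) (_ ≗? b) (λ p w → trans (sym (+-assoc (κ w) _ _)) (p w)) (λ p w → trans (+-assoc (κ w) _ _) (p w))))))
      where l : ∀ a c d → a + (c + d) ≡ d + (c + a)
            l = solve-∀

    -- Here tails and heads are required to reach κ separately. When all degrees are 2κ this follows
    -- from balance, and separate conditions make the weighted sum over edges factor into two copies
    -- of `C`, with a factor 2 per slot for its direction.
    ε₂ : ∀ {N} → (V → ℕ) → Edges N → (V → ℕ) → (V → ℕ) → ℕ
    ε₂ κ [] a b = ⟦ a ≗? κ ⟧ * ⟦ b ≗? κ ⟧
    ε₂ κ ((x , y) ∷ es) a b = ε₂ κ es (a ⊕ x) (b ⊕ y) + ε₂ κ es (a ⊕ y) (b ⊕ x)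

    ε≤ε₂ : ∀ {N} κ (es : Edges N) a b → (∀ w → a w + b w + deg w es ≡ 2 * κ w) → ε es a b ≤ ε₂ κ es a b
    ε≤ε₂ κ [] a b h = subst (_≤ ⟦ a ≗? κ ⟧ * ⟦ b ≗? κ ⟧) (*-identityʳ ⟦ a ≗? b ⟧) (⟦⟧-*-≤ (a ≗? b) λ p →
      ≤-reflexive (sym (cong₂ _*_ (⟦⟧-yes (a ≗? κ) (a≡κ p)) (⟦⟧-yes (b ≗? κ) (λ w → trans (sym (p w)) (a≡κ p w))))))
      where
      l : ∀ a → 2 * a ≡ a + a + 0
      l = solve-∀
      a≡κ : (∀ w → a w ≡ b w) → ∀ w → a w ≡ κ w
      a≡κ p w = *-cancelˡ-≡ (a w) (κ w) 2 (trans (l (a w)) (trans (cong (λ z → a w + z + 0) (p w)) (h w)))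
    ε≤ε₂ κ ((x , y) ∷ es) a b h = +-mono-≤
      (ε≤ε₂ κ es _ _ (λ w → trans (l1 (δ x w) (δ y w) (a w) (b w) (deg w es)) (h w)))
      (ε≤ε₂ κ es _ _ (λ w → trans (l2 (δ x w) (δ y w) (a w) (b w) (deg w es)) (h w)))
      where
      l1 : ∀ x y a b d → x + a + (y + b) + d ≡ a + b + (x + y + d)
      l1 = solve-∀
      l2 : ∀ x y a b d → y + a + (x + b) + d ≡ a + b + (x + y + d)
      l2 = solve-∀

    ∑∑-product : (f g : V → ℕ) (h : V → V → ℕ) (m : ℕ) → (∀ c d → h c d ≡ m * (f c * g d)) → ∀ r →
      ∑ (λ c → A r c * ∑ (λ d → A r d * h c d)) ≡ m * (∑ (λ c → A r c * f c) * ∑ (λ d → A r d * g d))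
    ∑∑-product f g h m eq r = begin-equality
      ∑ (λ c → A r c * ∑ (λ d → A r d * h c d))
        ≡⟨ ∑-cong (λ c → trans (cong (A r c *_) (trans (∑-cong (λ d → trans (cong (A r d *_) (eq c d)) (e (A r d) m (f c) (g d)))) (sym (*-distribˡ-∑ (m * f c) (λ d → A r d * g d))))) (e′ (A r c) m (f c) _)) ⟩
      ∑ (λ c → m * (A r c * f c * ∑ (λ d → A r d * g d)))
        ≡⟨ *-distribˡ-∑ m (λ c → A r c * f c * ∑ (λ d → A r d * g d)) ⟨
      m * ∑ (λ c → A r c * f c * ∑ (λ d → A r d * g d))
        ≡⟨ cong (m *_) (*-distribʳ-∑ (∑ (λ d → A r d * g d)) (λ c → A r c * f c)) ⟨
      m * (∑ (λ c → A r c * f c) * ∑ (λ d → A r d * g d)) ∎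
      where
      e : ∀ a m f g → a * (m * (f * g)) ≡ m * f * (a * g)
      e = solve-∀
      e′ : ∀ a m f s → a * (m * f * s) ≡ m * (a * f * s)
      e′ = solve-∀

    sumE-ε₂ : ∀ {N} κ (ρ : Vec (Fin n) N) a b → sumE ρ (λ es → ε₂ κ es a b) ≡ 2 ^ N * (C ρ a κ * C ρ b κ)
    sumE-ε₂ κ [] a b = sym (*-identityˡ _)
    sumE-ε₂ {suc N} κ (r ∷ ρ) a b = begin-equality
      ∑ (λ c → A r c * ∑ (λ d → A r d * sumE ρ (λ es → ε₂ κ es (a ⊕ c) (b ⊕ d) + ε₂ κ es (a ⊕ d) (b ⊕ c))))
        ≡⟨ sumE-+ (r ∷ ρ) (λ { ((c , d) ∷ es) → ε₂ κ es (a ⊕ c) (b ⊕ d) }) (λ { ((c , d) ∷ es) → ε₂ κ es (a ⊕ d) (b ⊕ c) }) ⟩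
      ∑ (λ c → A r c * ∑ (λ d → A r d * sumE ρ (λ es → ε₂ κ es (a ⊕ c) (b ⊕ d)))) +
      ∑ (λ c → A r c * ∑ (λ d → A r d * sumE ρ (λ es → ε₂ κ es (a ⊕ d) (b ⊕ c))))
        ≡⟨ cong₂ _+_
             (∑∑-product (λ c → C ρ (a ⊕ c) κ) (λ d → C ρ (b ⊕ d) κ) _ (2 ^ N) (λ c d → sumE-ε₂ κ ρ (a ⊕ c) (b ⊕ d)) r)
             (∑∑-product (λ c → C ρ (b ⊕ c) κ) (λ d → C ρ (a ⊕ d) κ) _ (2 ^ N) (λ c d → trans (sumE-ε₂ κ ρ (a ⊕ d) (b ⊕ c)) (cong (2 ^ N *_) (*-comm (C ρ (a ⊕ d) κ) _))) r) ⟩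
      2 ^ N * (C (r ∷ ρ) a κ * C (r ∷ ρ) b κ) + 2 ^ N * (C (r ∷ ρ) b κ * C (r ∷ ρ) a κ)
        ≡⟨ e (2 ^ N) (C (r ∷ ρ) a κ) (C (r ∷ ρ) b κ) ⟩
      2 ^ suc N * (C (r ∷ ρ) a κ * C (r ∷ ρ) b κ) ∎
      where
      e : ∀ m x y → m * (x * y) + m * (y * x) ≡ 2 * m * (x * y)
      e = solve-∀

    -- Read x ∈ C (double ρ) as a graph whose edges join the two values at a slot of ρ: an Eulerian
    -- orientation of it splits x into two members of C ρ.
    halving : ∀ {N} (ρ : Vec (Fin n) N) k →
      C (double ρ) O (λ _ → 2 * k) * odd! k ^ n ≤ 2 ^ N * (C ρ O (λ _ → k) * C ρ O (λ _ → k)) * (k !) ^ n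
    halving {N} ρ k = begin
      C (double ρ) O (λ _ → 2 * k) * odd! k ^ n
        ≡⟨ cong (_* odd! k ^ n) (C-double ρ (λ _ → refl)) ⟩
      sumE ρ (λ es → ⟦ (λ w → deg w es) ≗? (λ _ → 2 * k) ⟧) * odd! k ^ n
        ≡⟨ sumE-* ρ _ (odd! k ^ n) ⟩
      sumE ρ (λ es → ⟦ (λ w → deg w es) ≗? (λ _ → 2 * k) ⟧ * odd! k ^ n)
        ≤⟨ sumE-mono ρ pointwise ⟩
      sumE ρ (λ es → ε₂ (λ _ → k) es O O * (k !) ^ n)
        ≡⟨ sumE-* ρ _ ((k !) ^ n) ⟨
      sumE ρ (λ es → ε₂ (λ _ → k) es O O) * (k !) ^ n
        ≡⟨ cong (_* (k !) ^ n) (sumE-ε₂ (λ _ → k) ρ O O) ⟩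
      2 ^ N * (C ρ O (λ _ → k) * C ρ O (λ _ → k)) * (k !) ^ n ∎
      where
      pointwise : ∀ es → ⟦ (λ w → deg w es) ≗? (λ _ → 2 * k) ⟧ * odd! k ^ n ≤ ε₂ (λ _ → k) es O O * (k !) ^ n
      pointwise es = ⟦⟧-*-≤ ((λ w → deg w es) ≗? (λ _ → 2 * k)) λ h → begin
        odd! k ^ n ≡⟨ ∏-const n (odd! k) ⟨
        ∏ {n} (λ _ → odd! k) ≤⟨ eulerian-orientations es (λ _ → k) h ⟩
        ε es O O * ∏ {n} (λ _ → k !) ≤⟨ *-mono-≤ (ε≤ε₂ (λ _ → k) es O O h) (≤-reflexive (∏-const n (k !))) ⟩
        ε₂ (λ _ → k) es O O * (k !) ^ n ∎

-- Lower bound for permanents of regular bipartite graphs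

∏∏-change : ∀ {n} (f g : Fin n → Fin n → ℕ) r c m → (∀ r′ c′ → ¬ (r′ ≡ r × c′ ≡ c) → f r′ c′ ≡ g r′ c′) →
  f r c ≡ m * g r c → ∏ (λ r → ∏ (f r)) ≡ m * ∏ (λ r → ∏ (g r))
∏∏-change f g r c m off at = ∏-change (λ r → ∏ (f r)) (λ r → ∏ (g r)) r m
  (λ r′ r′≢r → ∏-cong (λ c′ → off r′ c′ (r′≢r ∘ proj₁)))
  (∏-change (f r) (g r) c m (λ c′ c′≢c → off r c′ (c′≢c ∘ proj₂)) at)

∏∏-mono : ∀ {m n} {f g : Fin m → Fin n → ℕ} → (∀ r c → f r c ≤ g r c) → ∏ (λ r → ∏ (f r)) ≤ ∏ (λ r → ∏ (g r))
∏∏-mono h = ∏-mono (λ r → ∏-mono (h r))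

∏∏-* : ∀ {m n} (f g : Fin m → Fin n → ℕ) → ∏ (λ r → ∏ (λ c → f r c * g r c)) ≡ ∏ (λ r → ∏ (f r)) * ∏ (λ r → ∏ (g r))
∏∏-* f g = trans (∏-cong (λ r → ∏-* (f r) (g r))) (∏-* (λ r → ∏ (f r)) (λ r → ∏ (g r)))

∏∏-const : ∀ m n c → ∏ {m} (λ _ → ∏ {n} (λ _ → c)) ≡ c ^ (n * m)
∏∏-const m n c = trans (∏-cong {m} (λ _ → ∏-const n c)) (trans (∏-const m (c ^ n)) (^-*-assoc c n m))

module PermanentBound (n : ℕ) where
  open Permanent n public

  occ : ∀ {N} → Fin n → Vec (Fin n) N → ℕ
  occ r [] = 0
  occ r (s ∷ ρ) = δ s r + occ r ρ

  len : ℕ → ℕ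
  len zero = n
  len (suc h) = len h * 2

  len≡ : ∀ h → len h ≡ 2 ^ h * n
  len≡ zero = sym (*-identityˡ n)
  len≡ (suc h) = trans (cong (_* 2) (len≡ h)) (l (2 ^ h) n)
    where l : ∀ a b → a * b * 2 ≡ 2 * a * b
          l = solve-∀

  module _ (A : Fin n → V → ℕ) where

    slots : ∀ h → Vec (Fin n) (len h)
    slots zero = Vec.allFin n
    slots (suc h) = double A (slots h)

    count-C : ℕ → ℕ
    count-C h = C A (slots h) O (λ _ → 2 ^ h)

    per : ℕ
    per = count-C 0

    -- In view of `odd!-!`, `halving` says that doubling k squares C_k k!^n up to the factor
    -- (2^k)^(2n); (k^k)^n obeys this recursion with equality.
    iterated-halving : ∀ h → let K = 2 ^ h in count-C h * (K !) ^ n ≤ (K ^ K) ^ n * per ^ K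
    iterated-halving zero = ≤-reflexive (l per (^-zeroˡ n))
      where l : ∀ p {x} → x ≡ 1 → p * x ≡ x * (p * 1)
            l p refl = trans (*-comm p 1) (cong (1 *_) (sym (*-identityʳ p)))
    iterated-halving (suc h) = begin
      D′ * ((2 * k) !) ^ n
        ≡⟨ cong (λ z → D′ * z ^ n) (odd!-! k) ⟨
      D′ * (odd! k * (2 ^ k * k !)) ^ n
        ≡⟨ cong (D′ *_) (trans (^-distribʳ-* (odd! k) (2 ^ k * k !) n) (cong (odd! k ^ n *_) (^-distribʳ-* (2 ^ k) (k !) n))) ⟩
      D′ * (odd! k ^ n * ((2 ^ k) ^ n * (k !) ^ n))
        ≡⟨ *-assoc D′ (odd! k ^ n) _ ⟨
      D′ * odd! k ^ n * ((2 ^ k) ^ n * (k !) ^ n)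
        ≤⟨ *-monoˡ-≤ _ (halving A (slots h) k) ⟩
      2 ^ len h * (D * D) * (k !) ^ n * ((2 ^ k) ^ n * (k !) ^ n)
        ≡⟨ cong (λ z → z * (D * D) * (k !) ^ n * ((2 ^ k) ^ n * (k !) ^ n)) (trans (cong (2 ^_) (len≡ h)) (sym (^-*-assoc 2 k n))) ⟩
      (2 ^ k) ^ n * (D * D) * (k !) ^ n * ((2 ^ k) ^ n * (k !) ^ n)
        ≡⟨ e1 ((2 ^ k) ^ n) D ((k !) ^ n) ⟩
      (2 ^ k) ^ n * (2 ^ k) ^ n * ((D * (k !) ^ n) * (D * (k !) ^ n))
        ≤⟨ *-monoʳ-≤ ((2 ^ k) ^ n * (2 ^ k) ^ n) (*-mono-≤ (iterated-halving h) (iterated-halving h)) ⟩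
      (2 ^ k) ^ n * (2 ^ k) ^ n * (((k ^ k) ^ n * per ^ k) * ((k ^ k) ^ n * per ^ k))
        ≡⟨ e2 ((2 ^ k) ^ n) ((k ^ k) ^ n) (per ^ k) ⟩
      ((2 ^ k) ^ n * (k ^ k) ^ n) * ((2 ^ k) ^ n * (k ^ k) ^ n) * (per ^ k * per ^ k)
        ≡⟨ cong₂ _*_ powers (trans (sym (^-distribˡ-+-* per k k)) (cong (λ z → per ^ (k + z)) (sym (+-identityʳ k)))) ⟩
      ((2 * k) ^ (2 * k)) ^ n * per ^ (2 * k) ∎
      where
      k = 2 ^ h
      D = count-C h
      D′ = count-C (suc h)
      e1 : ∀ t D f → t * (D * D) * f * (t * f) ≡ t * t * ((D * f) * (D * f))
      e1 = solve-∀
      e2 : ∀ t g p → t * t * ((g * p) * (g * p)) ≡ (t * g) * (t * g) * (p * p)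
      e2 = solve-∀
      powers : ((2 ^ k) ^ n * (k ^ k) ^ n) * ((2 ^ k) ^ n * (k ^ k) ^ n) ≡ ((2 * k) ^ (2 * k)) ^ n
      powers = trans (cong (λ z → z * z) (trans (sym (^-distribʳ-* (2 ^ k) (k ^ k) n)) (cong (_^ n) (sym (^-distribʳ-* 2 k k)))))
        (trans (sym (^-distribʳ-* ((2 * k) ^ k) ((2 * k) ^ k) n)) (cong (_^ n) (trans (sym (^-distribˡ-+-* (2 * k) k k)) (cong (λ z → (2 * k) ^ (k + z)) (sym (+-identityʳ k))))))

    -- Only the maps that send row r to column c exactly `w r c` times are kept. Their number is the
    -- quotient of the factorials and all have the same weight; the induction is the multinomial
    -- recursion on the column of the first slot.
    C-lower : ∀ {N} (ρ : Vec (Fin n) N) (w : Fin n → V → ℕ) (a b : V → ℕ) →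
      (∀ c → a c + ∑ (λ r → w r c) ≡ b c) → (∀ r → ∑ (w r) ≡ occ r ρ) →
      ∏ (λ r → occ r ρ !) * ∏ (λ r → ∏ (λ c → A r c ^ w r c)) ≤ C A ρ a b * ∏ (λ r → ∏ (λ c → w r c !))
    C-lower [] w a b cols rows = ≤-reflexive (cong₂ _*_
        (trans (trans (∏-const n 1) (^-zeroˡ n)) (sym (⟦⟧-yes (a ≗? b) (λ c → trans (sym (+-identityʳ (a c))) (trans (cong (a c +_) (sym (∑-zero (λ r → w≡0 r c)))) (cols c))))))
        (∏-cong (λ r → ∏-cong (λ c → trans (cong (A r c ^_) (w≡0 r c)) (cong _! (sym (w≡0 r c)))))))
      where
      w≡0 : ∀ r c → w r c ≡ 0
      w≡0 r c = n≤0⇒n≡0 (≤-trans (∑-term (w r) c) (≤-reflexive (rows r)))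
    C-lower (r ∷ ρ) w a b cols rows = begin
      ∏ (λ r′ → (δ r r′ + occ r′ ρ) !) * Π^ w
        ≡⟨ cong (_* Π^ w) (∏-change (λ r′ → (δ r r′ + occ r′ ρ) !) (λ r′ → occ r′ ρ !) r (suc (occ r ρ))
             (λ r′ r′≢r → cong (λ z → (z + occ r′ ρ) !) (⟦⟧-no (r ≟ r′) (r′≢r ∘ sym)))
             (cong (λ z → (z + occ r ρ) !) (δ-refl r))) ⟩
      suc (occ r ρ) * occs * Π^ w
        ≡⟨ *-assoc (suc (occ r ρ)) occs (Π^ w) ⟩
      suc (occ r ρ) * (occs * Π^ w)
        ≡⟨ cong (_* (occs * Π^ w)) (trans (rows r) (cong (_+ occ r ρ) (δ-refl r))) ⟨
      ∑ (w r) * (occs * Π^ w)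
        ≡⟨ *-distribʳ-∑ (occs * Π^ w) (w r) ⟩
      ∑ (λ c → w r c * (occs * Π^ w))
        ≤⟨ ∑-mono (λ c → term c (w r c) refl) ⟩
      ∑ (λ c → A r c * C A ρ (a ⊕ c) b * Π! w)
        ≡⟨ *-distribʳ-∑ (Π! w) (λ c → A r c * C A ρ (a ⊕ c) b) ⟨
      ∑ (λ c → A r c * C A ρ (a ⊕ c) b) * Π! w ∎
      where
      occs = ∏ (λ r → occ r ρ !)
      Π^ Π! : (Fin n → V → ℕ) → ℕ
      Π^ w = ∏ (λ r → ∏ (λ c → A r c ^ w r c))
      Π! w = ∏ (λ r → ∏ (λ c → w r c !))
      term : ∀ c m → w r c ≡ m → m * (occs * Π^ w) ≤ A r c * C A ρ (a ⊕ c) b * Π! w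
      term c zero eq = z≤n
      term c (suc j) eq = begin
        suc j * (occs * Π^ w) ≡⟨ cong (λ z → suc j * (occs * z)) (change (λ r c m → A r c ^ m) (A r c) refl) ⟩
        suc j * (occs * (A r c * Π^ w′)) ≡⟨ e1 (suc j) occs (A r c) (Π^ w′) ⟩
        suc j * A r c * (occs * Π^ w′) ≤⟨ *-monoʳ-≤ (suc j * A r c) (C-lower ρ w′ (a ⊕ c) b cols′ rows′) ⟩
        suc j * A r c * (C A ρ (a ⊕ c) b * Π! w′) ≡⟨ e2 (suc j) (A r c) (C A ρ (a ⊕ c) b) (Π! w′) ⟩
        A r c * C A ρ (a ⊕ c) b * (suc j * Π! w′) ≡⟨ cong (A r c * C A ρ (a ⊕ c) b *_) (change (λ _ _ m → m !) (suc j) refl) ⟨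
        A r c * C A ρ (a ⊕ c) b * Π! w ∎
        where
        e1 : ∀ a b c d → a * (b * (c * d)) ≡ a * c * (b * d)
        e1 = solve-∀
        e2 : ∀ a b c d → a * b * (c * d) ≡ b * c * (a * d)
        e2 = solve-∀
        -- The truncated subtraction is exact, since `w r c` is `suc j` in this case.
        w′ : Fin n → V → ℕ
        w′ r′ c′ = w r′ c′ ∸ δ r r′ * δ c c′
        δδ : ∀ r′ c′ → ¬ (r′ ≡ r × c′ ≡ c) → δ r r′ * δ c c′ ≡ 0
        δδ r′ c′ h with r ≟ r′ | c ≟ c′
        ... | yes p | yes q = ⊥-elim (h (sym p , sym q))
        ... | yes p | no q = refl
        ... | no p | _ = refl
        w′rc : w′ r c ≡ j
        w′rc = cong₂ _∸_ eq (cong₂ _*_ (δ-refl r) (δ-refl c))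
        change : (g : Fin n → V → ℕ → ℕ) → ∀ m → g r c (suc j) ≡ m * g r c j →
          ∏ (λ r → ∏ (λ c → g r c (w r c))) ≡ m * ∏ (λ r → ∏ (λ c → g r c (w′ r c)))
        change g m h = ∏∏-change (λ r c → g r c (w r c)) (λ r c → g r c (w′ r c)) r c m
          (λ r′ c′ off → cong (λ z → g r′ c′ (w r′ c′ ∸ z)) (sym (δδ r′ c′ off)))
          (trans (cong (g r c) eq) (trans h (cong (λ z → m * g r c z) (sym w′rc))))
        w≡ : ∀ r′ c′ → w r′ c′ ≡ δ r r′ * δ c c′ + w′ r′ c′
        w≡ r′ c′ with r ≟ r′ | c ≟ c′
        ... | yes refl | yes refl = trans eq (sym (cong (λ z → suc (z ∸ 1)) eq))
        ... | yes refl | no _ = refl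
        ... | no _ | _ = refl
        cols′ : ∀ c′ → (a ⊕ c) c′ + ∑ (λ r′ → w′ r′ c′) ≡ b c′
        cols′ c′ = trans (trans (l (δ c c′) (a c′) _) (cong (a c′ +_) (sym (trans (∑-cong (λ r′ → w≡ r′ c′)) (trans (∑-+ (λ r′ → δ r r′ * δ c c′) _) (cong (_+ ∑ (λ r′ → w′ r′ c′)) (∑-δ r (λ _ → δ c c′)))))))) (cols c′)
          where l : ∀ d a s → d + a + s ≡ a + (d + s)
                l = solve-∀
        rows′ : ∀ r′ → ∑ (w′ r′) ≡ occ r′ ρ
        rows′ r′ = +-cancelˡ-≡ (δ r r′) _ _ (trans (sym (trans (∑-cong (w≡ r′)) (trans (∑-+ (λ c′ → δ r r′ * δ c c′) _)
          (cong (_+ ∑ (w′ r′)) (trans (∑-cong (λ c′ → *-comm (δ r r′) (δ c c′))) (∑-δ c (λ _ → δ r r′))))))) (rows r′))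

    occ-double : ∀ {N} r (ρ : Vec (Fin n) N) → occ r (double A ρ) ≡ 2 * occ r ρ
    occ-double r [] = refl
    occ-double r (s ∷ ρ) = trans (cong (λ z → δ s r + (δ s r + z)) (occ-double r ρ)) (l (δ s r) (occ r ρ))
      where l : ∀ d o → d + (d + 2 * o) ≡ 2 * (d + o)
            l = solve-∀

    occ-tabulate : ∀ {N} r (f : Fin N → Fin n) → occ r (Vec.tabulate f) ≡ ∑ (λ i → δ (f i) r)
    occ-tabulate {zero} r f = refl
    occ-tabulate {suc N} r f = cong (δ (f zero) r +_) (occ-tabulate r (f ∘ suc))

    occ-slots : ∀ h r → occ r (slots h) ≡ 2 ^ h
    occ-slots zero r = trans (occ-tabulate r id) (trans (∑-single (λ i → δ i r) r (λ j → ⟦⟧-no (j ≟ r))) (δ-refl r))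
    occ-slots (suc h) r = trans (occ-double r (slots h)) (cong (2 *_) (occ-slots h r))

    -- The choice w = A is admissible because all line sums of A are 2^h.
    C-lower-regular : ∀ h → (∀ r → ∑ (A r) ≡ 2 ^ h) → (∀ c → ∑ (λ r → A r c) ≡ 2 ^ h) →
      ((2 ^ h) !) ^ n * ∏ (λ r → ∏ (λ c → A r c ^ A r c)) ≤ count-C h * ∏ (λ r → ∏ (λ c → A r c !))
    C-lower-regular h rows cols = ≤-trans
      (≤-reflexive (cong (_* ∏ (λ r → ∏ (λ c → A r c ^ A r c))) (sym (trans (∏-cong (λ r → cong _! (occ-slots h r))) (∏-const n ((2 ^ h) !))))))
      (C-lower (slots h) A O (λ _ → 2 ^ h) cols (λ r → trans (rows r) (sym (occ-slots h r))))

-- One loss 3K for every a ≤ K, zero included, makes the total loss (3K)^(n²) independent of the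
-- individual weights.
!eLo-uniform : ∀ n {a K} → 1 ≤ K → a ≤ K → a ! * eLo-num n ^ a ≤ a ^ a * eLo-den n ^ a * (3 * K)
!eLo-uniform n {zero} {K} 1≤K _ = ≤-trans 1≤K (≤-trans (m≤n*m K 3) (≤-reflexive (sym (*-identityˡ (3 * K)))))
!eLo-uniform n {suc a} {K} _ a≤K = ≤-trans (!eLo≤self^self n a)
  (≤-trans (*-monoˡ-≤ (suc a ^ suc a * eLo-den n ^ suc a) (*-monoʳ-≤ 3 a≤K)) (≤-reflexive (*-comm (3 * K) _)))

[h+2]h≤2^h : ∀ t → (6 + t + 2) * (6 + t) ≤ 2 ^ (6 + t)
[h+2]h≤2^h zero = ≤ᵇ⇒≤ 48 64 _
[h+2]h≤2^h (suc t) = begin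
  (7 + t + 2) * (7 + t) ≤⟨ m≤m+n _ (t * t + 12 * t + 33) ⟩
  (7 + t + 2) * (7 + t) + (t * t + 12 * t + 33) ≡⟨ e t ⟩
  2 * ((6 + t + 2) * (6 + t)) ≤⟨ *-monoʳ-≤ 2 ([h+2]h≤2^h t) ⟩
  2 * 2 ^ (6 + t) ∎
  where
  e : ∀ t → (7 + t + 2) * (7 + t) + (t * t + 12 * t + 33) ≡ 2 * ((6 + t + 2) * (6 + t))
  e = solve-∀

n≤2^n : ∀ n → n ≤ 2 ^ n
n≤2^n zero = z≤n
n≤2^n (suc n) = ≤-trans (+-mono-≤ (m^n>0 2 n) (n≤2^n n)) (≤-reflexive (cong (2 ^ n +_) (sym (+-identityʳ _))))

module RegularPermanent (n : ℕ) (n>0 : 0 < n) where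
  open PermanentBound n public

  p q u v : ℕ
  p = eHi-num n
  q = eHi-den n
  u = eLo-num n
  v = eLo-den n

  u>0 : 0 < u
  u>0 = m^n>0 (suc n) n
  v>0 : 0 < v
  v>0 = self^self>0 n

  module _ (A : Fin n → V → ℕ) (h : ℕ) (rows : ∀ r → ∑ (A r) ≡ 2 ^ h) (cols : ∀ c → ∑ (λ r → A r c) ≡ 2 ^ h)
    -- This makes the K-th root of the loss (3K)^(n²) at most 2.
    (big : (3 * 2 ^ h) ^ (n * n) ≤ 2 ^ (2 ^ h)) where

    private
      K = 2 ^ h
      W = ∏ (λ r → ∏ (λ c → A r c !))
      M = ∏ (λ r → ∏ (λ c → A r c ^ A r c))
      D = count-C A h
      f = (K !) ^ n
      G = (K ^ K) ^ n
      R = per A ^ K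
      P = (p ^ K) ^ n
      Q = (q ^ K) ^ n

    ∏∏-^rows : ∀ x → ∏ (λ r → ∏ (λ c → x ^ A r c)) ≡ x ^ (K * n)
    ∏∏-^rows x = trans (∏-cong (λ r → trans (∏-^∑ x (A r)) (cong (x ^_) (rows r)))) (trans (∏-const n (x ^ K)) (^-*-assoc x K n))

    factorial-weights : W * u ^ (K * n) ≤ M * v ^ (K * n) * (3 * K) ^ (n * n)
    factorial-weights = begin
      W * u ^ (K * n) ≡⟨ cong (W *_) (∏∏-^rows u) ⟨
      W * ∏ (λ r → ∏ (λ c → u ^ A r c)) ≡⟨ ∏∏-* (λ r c → A r c !) (λ r c → u ^ A r c) ⟨
      ∏ (λ r → ∏ (λ c → A r c ! * u ^ A r c)) ≤⟨ ∏∏-mono (λ r c → !eLo-uniform n (m^n>0 2 h) (≤-trans (∑-term (A r) c) (≤-reflexive (rows r)))) ⟩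
      ∏ (λ r → ∏ (λ c → A r c ^ A r c * v ^ A r c * (3 * K))) ≡⟨ ∏∏-* (λ r c → A r c ^ A r c * v ^ A r c) (λ _ _ → 3 * K) ⟩
      ∏ (λ r → ∏ (λ c → A r c ^ A r c * v ^ A r c)) * ∏ {n} (λ r → ∏ {n} (λ c → 3 * K)) ≡⟨ cong₂ _*_ (∏∏-* (λ r c → A r c ^ A r c) (λ r c → v ^ A r c)) (∏∏-const n n (3 * K)) ⟩
      M * ∏ (λ r → ∏ (λ c → v ^ A r c)) * (3 * K) ^ (n * n) ≡⟨ cong (λ z → M * z * (3 * K) ^ (n * n)) (∏∏-^rows v) ⟩
      M * v ^ (K * n) * (3 * K) ^ (n * n) ∎

    self-bound : G * Q ≤ f * P
    self-bound = begin
      (K ^ K) ^ n * (q ^ K) ^ n ≡⟨ ^-distribʳ-* (K ^ K) (q ^ K) n ⟨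
      (K ^ K * q ^ K) ^ n ≤⟨ ^-monoˡ-≤ n (self^self≤!eHi n K) ⟩
      (K ! * p ^ K) ^ n ≡⟨ ^-distribʳ-* (K !) (p ^ K) n ⟩
      (K !) ^ n * (p ^ K) ^ n ∎

    combined : G * (Q * Q) * u ^ (K * n) ≤ R * (P * P) * v ^ (K * n) * (3 * K) ^ (n * n)
    combined = cancelˡ-≤ {G * M} (*-mono-≤ (m^n>0 (K ^ K) {{>-nonZero (self^self>0 K)}} n) (∏>0 (λ r → ∏>0 (λ c → self^self>0 (A r c))))) (begin
      G * M * (G * (Q * Q) * U) ≡⟨ e1 G M Q U ⟩
      (G * Q) * (G * Q) * M * U ≤⟨ *-monoˡ-≤ U (*-monoˡ-≤ M (*-mono-≤ self-bound self-bound)) ⟩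
      (f * P) * (f * P) * M * U ≡⟨ e2 f P M U ⟩
      f * (P * P) * U * (f * M) ≤⟨ *-monoʳ-≤ (f * (P * P) * U) (C-lower-regular A h rows cols) ⟩
      f * (P * P) * U * (D * W) ≡⟨ e3 f P U D W ⟩
      (D * f) * (P * P) * (W * U) ≤⟨ *-mono-≤ (*-monoˡ-≤ (P * P) (iterated-halving A h)) factorial-weights ⟩
      (G * R) * (P * P) * (M * v ^ (K * n) * X) ≡⟨ e4 G R P M (v ^ (K * n)) X ⟩
      G * M * (R * (P * P) * v ^ (K * n) * X) ∎)
      where
      U = u ^ (K * n)
      X = (3 * K) ^ (n * n)
      e1 : ∀ G M Q U → G * M * (G * (Q * Q) * U) ≡ (G * Q) * (G * Q) * M * U
      e1 = solve-∀
      e2 : ∀ f P M U → (f * P) * (f * P) * M * U ≡ f * (P * P) * U * (f * M)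
      e2 = solve-∀
      e3 : ∀ f P U D W → f * (P * P) * U * (D * W) ≡ (D * f) * (P * P) * (W * U)
      e3 = solve-∀
      e4 : ∀ G R P M v X → (G * R) * (P * P) * (M * v * X) ≡ G * M * (R * (P * P) * v * X)
      e4 = solve-∀

    rooted : (K * (q * q * u)) ^ n ≤ 2 * ((p * p * v) ^ n * per A)
    rooted = ^-cancel-≤ K (m^n>0 2 h) (begin
      ((K * (q * q * u)) ^ n) ^ K ≡⟨ left ⟩
      G * (Q * Q) * u ^ (K * n) ≤⟨ combined ⟩
      R * (P * P) * v ^ (K * n) * (3 * K) ^ (n * n) ≤⟨ *-monoʳ-≤ (R * (P * P) * v ^ (K * n)) big ⟩
      R * (P * P) * v ^ (K * n) * 2 ^ K ≡⟨ right ⟨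
      (2 * ((p * p * v) ^ n * per A)) ^ K ∎)
      where
      pull : ∀ a b c → ((a * b * c) ^ n) ^ K ≡ (a ^ K) ^ n * (b ^ K) ^ n * c ^ (K * n)
      pull a b c = trans ([mn]^k (a * b * c) n K) (trans (cong (_^ n) (trans (^-distribʳ-* (a * b) c K) (cong (_* c ^ K) (^-distribʳ-* a b K))))
        (trans (^-distribʳ-* (a ^ K * b ^ K) (c ^ K) n) (cong₂ _*_ (^-distribʳ-* (a ^ K) (b ^ K) n) (^-*-assoc c K n))))
      left : ((K * (q * q * u)) ^ n) ^ K ≡ G * (Q * Q) * u ^ (K * n)
      left = trans (cong (_^ K) (^-distribʳ-* K (q * q * u) n)) (trans (^-distribʳ-* (K ^ n) ((q * q * u) ^ n) K)
        (trans (cong₂ _*_ ([mn]^k K n K) (pull q q u)) (sym (*-assoc G (Q * Q) _))))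
      right : (2 * ((p * p * v) ^ n * per A)) ^ K ≡ R * (P * P) * v ^ (K * n) * 2 ^ K
      right = trans (^-distribʳ-* 2 ((p * p * v) ^ n * per A) K) (trans (cong (2 ^ K *_) (trans (^-distribʳ-* ((p * p * v) ^ n) (per A) K) (cong (_* R) (pull p p v))))
        (e (2 ^ K) (P * P) (v ^ (K * n)) R))
        where e : ∀ a b c d → a * (b * c * d) ≡ d * b * c * a
              e = solve-∀

    -- In `rooted` e enters as eHi²/eLo. Because eHi = (1 + 1/n) eLo, replacing it by eHi costs (1 +
    -- 1/n)^n ≤ 3 in the n-th power, and 6 = 2 · 3. This is why the approximations to e have index
    -- n.
    regular-permanent : (K * q) ^ n ≤ 6 * (p ^ n * per A)
    regular-permanent = cancelˡ-≤ {(u * v) ^ n * n ^ n} (*-mono-≤ (m^n>0 (u * v) {{>-nonZero (*-mono-≤ u>0 v>0)}} n) (self^self>0 n)) (begin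
      (u * v) ^ n * n ^ n * (K * q) ^ n ≡⟨ cong (_* (K * q) ^ n) (^-distribʳ-* (u * v) n n) ⟨
      (u * v * n) ^ n * (K * q) ^ n ≡⟨ ^-distribʳ-* (u * v * n) (K * q) n ⟨
      (u * v * n * (K * q)) ^ n ≡⟨ cong (_^ n) (e1 u v n K q) ⟩
      (K * (q * (n * v) * u)) ^ n ≤⟨ rooted ⟩
      2 * ((p * (suc n * u) * v) ^ n * per A) ≡⟨ cong (λ z → 2 * (z * per A)) (trans (cong (_^ n) (e2 p (suc n) u v)) (trans (^-distribʳ-* (u * v * p) (suc n) n) (cong (_* u) (^-distribʳ-* (u * v) p n)))) ⟩
      2 * ((u * v) ^ n * p ^ n * u * per A) ≤⟨ *-monoʳ-≤ 2 (*-monoˡ-≤ (per A) (*-monoʳ-≤ ((u * v) ^ n * p ^ n) (eLo≤3 n))) ⟩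
      2 * ((u * v) ^ n * p ^ n * (3 * v) * per A) ≡⟨ e3 ((u * v) ^ n) (p ^ n) v (per A) ⟩
      (u * v) ^ n * n ^ n * (6 * (p ^ n * per A)) ∎)
      where
      e1 : ∀ u v n K q → u * v * n * (K * q) ≡ K * (q * (n * v) * u)
      e1 = solve-∀
      e2 : ∀ p s u v → p * (s * u) * v ≡ u * v * p * s
      e2 = solve-∀
      e3 : ∀ x y v r → 2 * (x * y * (3 * v) * r) ≡ x * v * (6 * (y * r))
      e3 = solve-∀

  module _ (B : Fin n → V → Bool) (d : ℕ) (d>0 : 0 < d) (d≤n : d ≤ n)
    (rows : ∀ r → card (B r) ≡ d) (cols : ∀ c → card (λ r → B r c) ≡ d) where

    B# : Fin n → V → ℕ
    B# r c = bit (B r c)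

    module Padding (L ρ : ℕ) where
      M = L + ρ

      A : Fin n → V → ℕ
      A r c = L * B# r c + ρ * δ r c

      A≤M : ∀ r c → A r c ≤ M
      A≤M r c = ≤-trans (+-mono-≤ (*-monoʳ-≤ L (bit≤1 (B r c))) (*-monoʳ-≤ ρ (⟦⟧≤1 (r ≟ c)))) (≤-reflexive (cong₂ _+_ (*-identityʳ L) (*-identityʳ ρ)))
        where bit≤1 : ∀ b → bit b ≤ 1
              bit≤1 true = ≤-refl
              bit≤1 false = z≤n

      C-crude : ∀ {N} (ρ : Vec (Fin n) N) a b → C A ρ a b ≤ M ^ N * n ^ N
      C-crude [] a b = ⟦⟧≤1 (a ≗? b)
      C-crude {suc N} (r ∷ ρ) a b = ≤-trans (∑-mono (λ c → *-mono-≤ (A≤M r c) (C-crude ρ (a ⊕ c) b)))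
        (≤-reflexive (trans (∑-const n (M * (M ^ N * n ^ N))) (e n M (M ^ N) (n ^ N))))
        where e : ∀ n M X Y → n * (M * (X * Y)) ≡ M * X * (n * Y)
              e = solve-∀

      -- A map that leaves the support of B at some slot has weight at most ρ there instead of M,
      -- and there are at most n^N maps. The factor M on the left stands in for dividing by M at
      -- that slot.
      C-padding : ∀ {N} (σ : Vec (Fin n) N) a b → M * C A σ a b ≤ M ^ suc N * C B# σ a b + ρ * (M ^ N * n ^ N)
      C-padding [] a b = ≤-trans (≤-reflexive (cong (_* ⟦ a ≗? b ⟧) (sym (*-identityʳ M)))) (m≤m+n _ _)
      C-padding {suc N} (r ∷ σ) a b = begin
        M * ∑ (λ c → A r c * C A σ (a ⊕ c) b)
          ≡⟨ *-distribˡ-∑ M (λ c → A r c * C A σ (a ⊕ c) b) ⟩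
        ∑ (λ c → M * (A r c * C A σ (a ⊕ c) b))
          ≤⟨ ∑-mono term ⟩
        ∑ (λ c → M ^ suc (suc N) * (B# r c * C B# σ (a ⊕ c) b) + ρ * (M ^ suc N * n ^ N))
          ≡⟨ ∑-+ (λ c → M ^ suc (suc N) * (B# r c * C B# σ (a ⊕ c) b)) (λ _ → ρ * (M ^ suc N * n ^ N)) ⟩
        ∑ (λ c → M ^ suc (suc N) * (B# r c * C B# σ (a ⊕ c) b)) + ∑ {n} (λ _ → ρ * (M ^ suc N * n ^ N))
          ≡⟨ cong₂ _+_ (sym (*-distribˡ-∑ (M ^ suc (suc N)) (λ c → B# r c * C B# σ (a ⊕ c) b))) (trans (∑-const n _) (e n ρ (M ^ suc N) (n ^ N))) ⟩
        M ^ suc (suc N) * C B# (r ∷ σ) a b + ρ * (M ^ suc N * n ^ suc N) ∎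
        where
        e : ∀ n r x y → n * (r * (x * y)) ≡ r * (x * (n * y))
        e = solve-∀
        term : ∀ c → M * (A r c * C A σ (a ⊕ c) b) ≤ M ^ suc (suc N) * (B# r c * C B# σ (a ⊕ c) b) + ρ * (M ^ suc N * n ^ N)
        term c with B r c
        ... | false = begin
          M * ((L * 0 + ρ * δ r c) * CA) ≤⟨ *-monoʳ-≤ M (*-mono-≤ (≤-trans (≤-reflexive (cong (_+ ρ * δ r c) (*-zeroʳ L))) (≤-trans (*-monoʳ-≤ ρ (⟦⟧≤1 (r ≟ c))) (≤-reflexive (*-identityʳ ρ)))) (C-crude σ (a ⊕ c) b)) ⟩
          M * (ρ * (M ^ N * n ^ N)) ≡⟨ e1 M ρ (M ^ N) (n ^ N) ⟩
          ρ * (M ^ suc N * n ^ N) ≤⟨ m≤n+m _ _ ⟩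
          M ^ suc (suc N) * (0 * CB) + ρ * (M ^ suc N * n ^ N) ∎
          where
          CA = C A σ (a ⊕ c) b
          CB = C B# σ (a ⊕ c) b
          e1 : ∀ M r x y → M * (r * (x * y)) ≡ r * (M * x * y)
          e1 = solve-∀
        ... | true = begin
          M * ((L * 1 + ρ * δ r c) * CA) ≤⟨ *-monoʳ-≤ M (*-monoˡ-≤ CA (+-mono-≤ (≤-reflexive (*-identityʳ L)) (≤-trans (*-monoʳ-≤ ρ (⟦⟧≤1 (r ≟ c))) (≤-reflexive (*-identityʳ ρ))))) ⟩
          M * (M * CA) ≤⟨ *-monoʳ-≤ M (C-padding σ (a ⊕ c) b) ⟩
          M * (M ^ suc N * CB + ρ * (M ^ N * n ^ N)) ≡⟨ e1 M (M ^ suc N) CB ρ (M ^ N) (n ^ N) ⟩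
          M ^ suc (suc N) * (1 * CB) + ρ * (M ^ suc N * n ^ N) ∎
          where
          CA = C A σ (a ⊕ c) b
          CB = C B# σ (a ⊕ c) b
          e1 : ∀ M x c r y z → M * (x * c + r * (y * z)) ≡ M * x * (1 * c) + r * (M * y * z)
          e1 = solve-∀

    private
      L₀ h K L ρ : ℕ
      -- Large enough for L ≥ L₀ to absorb the error of `C-padding`, whose ρ is at most n.
      L₀ = 36 * (p ^ n * (n * n ^ n))
      -- The summand n L₀ forces L ≥ L₀, the summand n² serves `big`, and from 6 on (h + 2) h ≤ 2^h.
      h = 6 + (n * n + n * L₀)
      K = 2 ^ h
      instance d≢0 = >-nonZero d>0
      L = K ℕ./ d
      ρ = K ℕ.% d

    K≡ : K ≡ ρ + L * d
    K≡ = ℕ.m≡m%n+[m/n]*n K d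

    ρ≤n : ρ ≤ n
    ρ≤n = ≤-trans (<⇒≤ (ℕ.m%n<n K d)) d≤n

    L₀≤L : L₀ ≤ L
    L₀≤L = ≮⇒≥ λ L<L₀ → <⇒≱ (begin-strict
      K ≡⟨ K≡ ⟩
      ρ + L * d <⟨ +-monoˡ-< (L * d) (ℕ.m%n<n K d) ⟩
      suc L * d ≤⟨ *-mono-≤ L<L₀ d≤n ⟩
      L₀ * n ≡⟨ *-comm L₀ n ⟩
      n * L₀ ≤⟨ ≤-trans (m≤n+m (n * L₀) (n * n)) (m≤n+m _ 6) ⟩
      h ≤⟨ n≤2^n h ⟩
      K ∎) ≤-refl

    big : (3 * K) ^ (n * n) ≤ 2 ^ K
    big = begin
      (3 * K) ^ (n * n) ≤⟨ ^-monoˡ-≤ (n * n) (*-monoˡ-≤ K (≤ᵇ⇒≤ 3 4 _)) ⟩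
      (4 * K) ^ (n * n) ≡⟨ cong (_^ (n * n)) (sym (trans (cong (2 ^_) (+-comm h 2)) (^-distribˡ-+-* 2 2 h))) ⟩
      (2 ^ (h + 2)) ^ (n * n) ≡⟨ ^-*-assoc 2 (h + 2) (n * n) ⟩
      2 ^ ((h + 2) * (n * n)) ≤⟨ ^-monoʳ-≤ 2 (≤-trans (*-monoʳ-≤ (h + 2) (≤-trans (m≤m+n (n * n) (n * L₀)) (m≤n+m _ 6))) ([h+2]h≤2^h (n * n + n * L₀))) ⟩
      2 ^ K ∎

    open Padding L ρ

    -- 36 = 2 · 6 · 3: the 6 is from `regular-permanent`, the 3 from M^n ≤ 3 L^n, and doubling
    -- leaves one copy of the left side to absorb the padding error.
    permanent-bound : (d * q) ^ n ≤ 36 * (p ^ n * per B#)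
    permanent-bound = cancelˡ-≤ {M * L ^ n} (*-mono-≤ M>0 (m^n>0 L {{>-nonZero L>0}} n)) (+-cancelʳ-≤ (M * L ^ n * (d * q) ^ n) _ _ (begin
      M * L ^ n * (d * q) ^ n + M * L ^ n * (d * q) ^ n
        ≡⟨ e0 M (L ^ n) ((d * q) ^ n) ⟩
      2 * (M * (L ^ n * (d * q) ^ n))
        ≡⟨ cong (λ z → 2 * (M * z)) (trans (sym (^-distribʳ-* L (d * q) n)) (cong (_^ n) (sym (*-assoc L d q)))) ⟩
      2 * (M * (L * d * q) ^ n)
        ≤⟨ *-monoʳ-≤ 2 (*-monoʳ-≤ M (^-monoˡ-≤ n (*-monoˡ-≤ q (≤-trans (m≤n+m (L * d) ρ) (≤-reflexive (sym K≡)))))) ⟩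
      2 * (M * (K * q) ^ n)
        ≤⟨ *-monoʳ-≤ 2 (*-monoʳ-≤ M (regular-permanent A h rowsA colsA big)) ⟩
      2 * (M * (6 * (p ^ n * per A)))
        ≡⟨ e1 M (p ^ n) (per A) ⟩
      12 * p ^ n * (M * per A)
        ≤⟨ *-monoʳ-≤ (12 * p ^ n) (C-padding (slots A 0) O (λ _ → 1)) ⟩
      12 * p ^ n * (M * M ^ n * per B# + ρ * (M ^ n * n ^ n))
        ≡⟨ e2 (p ^ n) M (M ^ n) (per B#) ρ (n ^ n) ⟩
      M ^ n * (12 * p ^ n * (M * per B# + ρ * n ^ n))
        ≤⟨ *-monoˡ-≤ _ M^n≤ ⟩
      3 * L ^ n * (12 * p ^ n * (M * per B# + ρ * n ^ n))
        ≡⟨ e3 (L ^ n) (p ^ n) M (per B#) ρ (n ^ n) ⟩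
      M * L ^ n * (36 * (p ^ n * per B#)) + L ^ n * (36 * (p ^ n * (ρ * n ^ n)))
        ≤⟨ +-monoʳ-≤ (M * L ^ n * (36 * (p ^ n * per B#))) small ⟩
      M * L ^ n * (36 * (p ^ n * per B#)) + M * L ^ n * (d * q) ^ n ∎))
      where
      e0 : ∀ M x y → M * x * y + M * x * y ≡ 2 * (M * (x * y))
      e0 = solve-∀
      e1 : ∀ M p r → 2 * (M * (6 * (p * r))) ≡ 12 * p * (M * r)
      e1 = solve-∀
      e2 : ∀ p M X r s y → 12 * p * (M * X * r + s * (X * y)) ≡ X * (12 * p * (M * r + s * y))
      e2 = solve-∀
      e3 : ∀ L p M r s y → 3 * L * (12 * p * (M * r + s * y)) ≡ M * L * (36 * (p * r)) + L * (36 * (p * (s * y)))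
      e3 = solve-∀
      p>0 : 0 < p
      p>0 = m^n>0 (suc n) (suc n)
      q>0 : 0 < q
      q>0 = m^n>0 n {{>-nonZero n>0}} (suc n)
      nn≤L : n * n ≤ L
      nn≤L = ≤-trans (≤-trans (≤-trans (*-monoʳ-≤ n n≤n^n) (≤-reflexive (sym (*-identityˡ _)))) (*-mono-≤ {1} {36} (s≤s z≤n) (≤-trans (≤-reflexive (sym (*-identityˡ _))) (*-monoˡ-≤ (n * n ^ n) (m^n>0 p {{>-nonZero p>0}} n))))) L₀≤L
        where
        n≤n^n : n ≤ n ^ n
        n≤n^n = subst (λ z → z ≤ n ^ n) (*-identityʳ n) (^-monoʳ-≤ n {{>-nonZero n>0}} n>0)
      L>0 : 0 < L
      L>0 = ≤-trans (*-mono-≤ n>0 n>0) nn≤L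
      M>0 : 0 < M
      M>0 = ≤-trans L>0 (m≤m+n L ρ)
      M^n≤ : M ^ n ≤ 3 * L ^ n
      M^n≤ = cancelˡ-≤ v>0 (begin
        n ^ n * M ^ n ≡⟨ ^-distribʳ-* n M n ⟨
        (n * M) ^ n ≤⟨ ^-monoˡ-≤ n nM≤ ⟩
        (suc n * L) ^ n ≡⟨ ^-distribʳ-* (suc n) L n ⟩
        u * L ^ n ≤⟨ *-monoˡ-≤ (L ^ n) (eLo≤3 n) ⟩
        3 * v * L ^ n ≡⟨ e4 v (L ^ n) ⟩
        n ^ n * (3 * L ^ n) ∎)
        where
        e4 : ∀ v x → 3 * v * x ≡ v * (3 * x)
        e4 = solve-∀
        nM≤ : n * M ≤ suc n * L
        nM≤ = begin
          n * (L + ρ) ≡⟨ *-distribˡ-+ n L ρ ⟩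
          n * L + n * ρ ≤⟨ +-monoʳ-≤ (n * L) (≤-trans (*-monoʳ-≤ n ρ≤n) nn≤L) ⟩
          n * L + L ≡⟨ +-comm (n * L) L ⟩
          suc n * L ∎
      small : L ^ n * (36 * (p ^ n * (ρ * n ^ n))) ≤ M * L ^ n * (d * q) ^ n
      small = begin
        L ^ n * (36 * (p ^ n * (ρ * n ^ n))) ≤⟨ *-monoʳ-≤ (L ^ n) (*-monoʳ-≤ 36 (*-monoʳ-≤ (p ^ n) (*-monoˡ-≤ (n ^ n) ρ≤n))) ⟩
        L ^ n * L₀ ≤⟨ *-monoʳ-≤ (L ^ n) (≤-trans L₀≤L (m≤m+n L ρ)) ⟩
        L ^ n * M ≡⟨ trans (*-comm (L ^ n) M) (sym (*-identityʳ _)) ⟩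
        M * L ^ n * 1 ≤⟨ *-monoʳ-≤ (M * L ^ n) (m^n>0 (d * q) {{>-nonZero (*-mono-≤ d>0 q>0)}} n) ⟩
        M * L ^ n * (d * q) ^ n ∎
      sum≡ : ∀ {x y} → x ≡ d → y ≡ 1 → L * x + ρ * y ≡ K
      sum≡ refl refl = trans (+-comm (L * d) (ρ * 1)) (trans (cong (_+ L * d) (*-identityʳ ρ)) (sym K≡))
      rowsA : ∀ r → ∑ (A r) ≡ K
      rowsA r = trans (∑-+ (λ c → L * B# r c) (λ c → ρ * δ r c)) (trans (cong₂ _+_ (sym (*-distribˡ-∑ L (B# r))) (sym (*-distribˡ-∑ ρ (δ r))))
        (sum≡ (rows r) (trans (∑-single (δ r) r (λ c c≢r → ⟦⟧-no (r ≟ c) (c≢r ∘ sym))) (δ-refl r))))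
      colsA : ∀ c → ∑ (λ r → A r c) ≡ K
      colsA c = trans (∑-+ (λ r → L * B# r c) (λ r → ρ * δ r c)) (trans (cong₂ _+_ (sym (*-distribˡ-∑ L (λ r → B# r c))) (sym (*-distribˡ-∑ ρ (λ r → δ r c))))
        (sum≡ (cols c) (trans (∑-single (λ r → δ r c) c (λ r → ⟦⟧-no (r ≟ c))) (δ-refl c))))

-- Latin squares

sumL-tabulate : ∀ {n} (g : Fin n → Elem) (f : Elem → ℕ) → sumL (List.tabulate g) f ≡ ∑ (f ∘ g)
sumL-tabulate {n = zero} g f = refl
sumL-tabulate {n = suc n} g f = cong (f (g zero) +_) (sumL-tabulate (g ∘ suc) f)

consAll : ∀ {N} → List Elem → (Elem → List (Vec Elem N)) → List (Vec Elem (suc N))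
consAll xs ys = concatMap (λ a → map (a ∷_) (ys a)) xs

sumL-consAll : ∀ {N} (xs : List Elem) (ys : Elem → List (Vec Elem N)) (f : Vec Elem (suc N) → ℕ) →
  sumL (consAll xs ys) f ≡ sumL xs (λ a → sumL (ys a) (λ v → f (a ∷ v)))
sumL-consAll xs ys f = trans (sumL-concatMap _ xs f) (sumL-cong xs (λ a → sumL-map (a ∷_) (ys a) f))

unique-consAll : ∀ {N} {xs : List Elem} {ys : Elem → List (Vec Elem N)} → Unique xs → (∀ a → Unique (ys a)) → Unique (consAll xs ys)
unique-consAll [] _ = []
unique-consAll {N = N} {xs = x ∷ xs} {ys} (x∉ ∷ u) uys = AllPairs.++⁺
  (AllPairs.map⁺ (AllPairs.map (λ v≢w eq → v≢w (Vec.∷-injectiveʳ eq)) (uys x)))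
  (unique-consAll u uys)
  (All.map⁺ (All.universal (λ v → All.map (λ h eq → h (cong Vec.head eq)) (heads x∉)) (ys x)))
  where
  heads : ∀ {xs} → All (x ≢_) xs → All (λ (w : Vec _ (suc N)) → x ≢ Vec.head w) (consAll xs ys)
  heads [] = []
  heads (h ∷ hs) = All.++⁺ (All.map⁺ (All.universal (λ _ → h) _)) (heads hs)

allVecs : List Elem → ∀ N → List (Vec Elem N)
allVecs xs zero = [] ∷ []
allVecs xs (suc N) = consAll xs (λ _ → allVecs xs N)

unique-allVecs : {xs : List Elem} → Unique xs → ∀ N → Unique (allVecs xs N)
unique-allVecs u zero = [] ∷ []
unique-allVecs u (suc N) = unique-consAll u (λ _ → unique-allVecs u N)

vec-ext : ∀ {N} (x y : Vec Elem N) → (∀ i → lookup x i ≡ lookup y i) → x ≡ y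
vec-ext x y h = trans (sym (Vec.tabulate∘lookup x)) (trans (Vec.tabulate-cong h) (Vec.tabulate∘lookup y))

injective⇒surjective : ∀ {m} (f : Fin m → Fin m) → (∀ i j → f i ≡ f j → i ≡ j) → ∀ k → ∃ λ i → f i ≡ k
injective⇒surjective {suc m} f inj k with Fin.any? (λ i → f i ≟ k)
... | yes p = p
... | no ¬p = ⊥-elim (1+n≰n (Fin.injective⇒≤ {f = λ i → punchOut {i = k} {j = f i} (λ eq → ¬p (i , sym eq))}
    (λ {i} {j} eq → inj i j (Fin.punchOut-injective (λ eq → ¬p (i , sym eq)) (λ eq → ¬p (j , sym eq)) eq))))

module LatinList (n : ℕ) (n>0 : 0 < n) where
  open RegularPermanent n n>0 public

  Row : Set
  Row = Vec (Fin n) n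

  occ-lookup : ∀ {N} w (x : Vec (Fin n) N) → occ w x ≡ ∑ (λ j → δ (lookup x j) w)
  occ-lookup w [] = refl
  occ-lookup w (y ∷ x) = cong (δ y w +_) (occ-lookup w x)

  IsPerm : Row → Set
  IsPerm x = ∀ w → occ w x ≡ 1

  perm-injective : ∀ x → IsPerm x → ∀ i j → lookup x i ≡ lookup x j → i ≡ j
  perm-injective x perm i j eq with i ≟ j
  ... | yes p = p
  ... | no i≢j = ⊥-elim (1+n≰n (begin
    1 + 1 ≡⟨ cong (1 +_) at-j ⟨
    1 + g j ≤⟨ +-monoʳ-≤ 1 (∑-term g j) ⟩
    1 + ∑ g ≡⟨ ∑-change (λ l → δ (lookup x l) (lookup x i)) g i 1 off at-i ⟨
    ∑ (λ l → δ (lookup x l) (lookup x i)) ≡⟨ trans (sym (occ-lookup (lookup x i) x)) (perm (lookup x i)) ⟩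
    1 ∎))
    where
    g : Fin n → ℕ
    g l = δ (lookup x l) (lookup x i) ∸ δ i l
    at-j : g j ≡ 1
    at-j = cong₂ _∸_ (trans (cong (λ z → δ z (lookup x i)) (sym eq)) (δ-refl (lookup x i))) (⟦⟧-no (i ≟ j) i≢j)
    off : ∀ l → l ≢ i → δ (lookup x l) (lookup x i) ≡ g l
    off l l≢i = cong (δ (lookup x l) (lookup x i) ∸_) (sym (⟦⟧-no (i ≟ l) (l≢i ∘ sym)))
    at-i : δ (lookup x i) (lookup x i) ≡ 1 + g i
    at-i = trans (δ-refl (lookup x i)) (sym (cong (1 +_) (cong₂ _∸_ (δ-refl (lookup x i)) (δ-refl i))))

  -- The first index is a column, the second a symbol: true means that the symbol is still available
  -- in that column.
  Table : Set
  Table = Fin n → Fin n → Bool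

  Fits : Table → Row → Set
  Fits B x = ∀ j → B j (lookup x j) ≡ true

  good? : ∀ B x → Dec (IsPerm x × Fits B x)
  good? B x = Fin.all? (λ w → occ w x ℕ.≟ 1) ×-dec Fin.all? (λ j → B j (lookup x j) Bool.≟ true)

  allRows : List Row
  allRows = allVecs (allFin n) n

  rows : Table → List Row
  rows B = filter (good? B) allRows

  weight-of : ∀ {N} → Table → Vec (Fin n) N → Vec (Fin n) N → ℕ
  weight-of B [] [] = 1
  weight-of B (r ∷ σ) (y ∷ x) = bit (B r y) * weight-of B σ x

  weight-of≤1 : ∀ {N} B (σ x : Vec (Fin n) N) → weight-of B σ x ≤ 1
  weight-of≤1 B [] [] = ≤-refl
  weight-of≤1 B (r ∷ σ) (y ∷ x) with B r y
  ... | true = ≤-trans (≤-reflexive (*-identityˡ _)) (weight-of≤1 B σ x)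
  ... | false = z≤n

  weight-of-fits : ∀ {N} B (σ x : Vec (Fin n) N) → weight-of B σ x ≡ 0 ⊎ (∀ j → B (lookup σ j) (lookup x j) ≡ true)
  weight-of-fits B [] [] = inj₂ λ ()
  weight-of-fits B (r ∷ σ) (y ∷ x) with B r y in eq
  ... | false = inj₁ refl
  ... | true with weight-of-fits B σ x
  ... | inj₁ p = inj₁ (trans (*-identityˡ _) p)
  ... | inj₂ p = inj₂ λ where
    zero → eq
    (suc j) → p j

  C-as-sum : ∀ {N} B (σ : Vec (Fin n) N) (a b : V → ℕ) →
    C (λ r c → bit (B r c)) σ a b ≡ sumL (allVecs (allFin n) N) (λ x → weight-of B σ x * ⟦ (λ w → a w + occ w x) ≗? b ⟧)
  C-as-sum B [] a b = trans (⟦⟧-cong (a ≗? b) ((λ w → a w + 0) ≗? b) (λ p w → trans (+-identityʳ (a w)) (p w)) (λ p w → trans (sym (+-identityʳ (a w))) (p w)))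
    (sym (trans (+-identityʳ _) (*-identityˡ _)))
  C-as-sum {suc N} B (r ∷ σ) a b = sym (begin-equality
    sumL (allVecs (allFin n) (suc N)) (λ x → weight-of B (r ∷ σ) x * ⟦ (λ w → a w + occ w x) ≗? b ⟧)
      ≡⟨ sumL-consAll (allFin n) (λ _ → allVecs (allFin n) N) _ ⟩
    sumL (allFin n) (λ c → sumL (allVecs (allFin n) N) (λ x → bit (B r c) * weight-of B σ x * ⟦ (λ w → a w + (δ c w + occ w x)) ≗? b ⟧))
      ≡⟨ sumL-tabulate {n = n} id (λ c → sumL (allVecs (allFin n) N) (λ x → bit (B r c) * weight-of B σ x * ⟦ (λ w → a w + (δ c w + occ w x)) ≗? b ⟧)) ⟩
    ∑ (λ c → sumL (allVecs (allFin n) N) (λ x → bit (B r c) * weight-of B σ x * ⟦ (λ w → a w + (δ c w + occ w x)) ≗? b ⟧))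
      ≡⟨ ∑-cong (λ c → trans (sumL-cong (allVecs (allFin n) N) (λ x → trans (*-assoc (bit (B r c)) _ _) (cong (λ z → bit (B r c) * (weight-of B σ x * z))
           (⟦⟧-cong ((λ w → a w + (δ c w + occ w x)) ≗? b) ((λ w → (a ⊕ c) w + occ w x) ≗? b) (λ p w → trans (l (δ c w) (a w) (occ w x)) (p w)) (λ p w → trans (sym (l (δ c w) (a w) (occ w x))) (p w))))))
           (trans (sym (*-distribˡ-sumL (bit (B r c)) (allVecs (allFin n) N) _)) (cong (bit (B r c) *_) (sym (C-as-sum B σ (a ⊕ c) b))))) ⟩
    ∑ (λ c → bit (B r c) * C (λ r c → bit (B r c)) σ (a ⊕ c) b) ∎)
    where
    l : ∀ d a o → d + a + o ≡ a + (d + o)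
    l = solve-∀

  per≤rows : ∀ B → per (λ r c → bit (B r c)) ≤ length (rows B)
  per≤rows B = begin
    per (λ r c → bit (B r c)) ≡⟨ C-as-sum B (Vec.allFin n) O (λ _ → 1) ⟩
    sumL allRows (λ x → weight-of B (Vec.allFin n) x * ⟦ (λ w → occ w x) ≗? (λ _ → 1) ⟧) ≤⟨ sumL-mono allRows pointwise ⟩
    sumL allRows (λ x → ⟦ good? B x ⟧) ≡⟨ length-filter (good? B) allRows ⟨
    length (rows B) ∎
    where
    pointwise : ∀ x → weight-of B (Vec.allFin n) x * ⟦ (λ w → occ w x) ≗? (λ _ → 1) ⟧ ≤ ⟦ good? B x ⟧
    pointwise x = ≤-trans (≤-reflexive (*-comm (weight-of B (Vec.allFin n) x) _)) (⟦⟧-*-≤ ((λ w → occ w x) ≗? (λ _ → 1)) λ perm →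
      case weight-of-fits B (Vec.allFin n) x of λ where
        (inj₁ p) → ≤-trans (≤-reflexive p) z≤n
        (inj₂ fits) → ≤-trans (weight-of≤1 B (Vec.allFin n) x) (≤-reflexive (sym (⟦⟧-yes (good? B x)
          (perm , λ j → subst (λ z → B z (lookup x j) ≡ true) (Vec.lookup-allFin j) (fits j))))))

  remove : Table → Row → Table
  remove B x j = B j ∖ lookup x j

  Regular : ℕ → Table → Set
  Regular d B = (∀ j → card (B j) ≡ d) × (∀ s → card (λ j → B j s) ≡ d)

  remove-bit : ∀ B x → Fits B x → ∀ j s → bit (B j s) ≡ δ (lookup x j) s + bit (remove B x j s)
  remove-bit B x fits j s with s ≟ lookup x j | lookup x j ≟ s
  ... | yes p | yes q rewrite p | fits j = refl
  ... | yes p | no q = ⊥-elim (q (sym p))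
  ... | no p | yes q = ⊥-elim (p (sym q))
  ... | no p | no q with B j s
  ... | true = refl
  ... | false = refl

  remove-regular : ∀ {d} B x → IsPerm x → Fits B x → Regular (suc d) B → Regular d (remove B x)
  remove-regular B x perm fits (r , c) =
    (λ j → suc-injective (trans (sym (trans (card-∖ (B j) (lookup x j)) (cong (λ b → bit b + card (remove B x j)) (fits j)))) (r j))) ,
    (λ s → suc-injective (trans (sym (trans (∑-cong (λ j → remove-bit B x fits j s)) (trans (∑-+ (λ j → δ (lookup x j) s) (λ j → bit (remove B x j s)))
        (cong (_+ card (λ j → remove B x j s)) (trans (sym (occ-lookup s x)) (perm s)))))) (c s)))

  latin : ∀ t → Table → List (Vec Row t)
  latin zero B = [] ∷ []
  latin (suc t) B = consAll (rows B) (λ x → latin t (remove B x))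

  Latin : ∀ {t} → Table → Vec Row t → Set
  Latin B [] = ⊤
  Latin B (x ∷ L) = IsPerm x × Fits B x × Latin (remove B x) L

  all-latin : ∀ t B → All (Latin B) (latin t B)
  all-latin zero B = tt ∷ []
  all-latin (suc t) B = All.concat⁺ (All.map⁺ (All.map (λ {x} (perm , fits) → All.map⁺ (All.map (λ h → perm , fits , h) (all-latin t (remove B x)))) (All.all-filter (good? B) allRows)))

  unique-latin : ∀ t B → Unique (latin t B)
  unique-latin zero B = [] ∷ []
  unique-latin (suc t) B = unique-consAll (Unique.filter⁺ (good? B) (unique-allVecs (Unique.allFin⁺ n) n)) (λ x → unique-latin t (remove B x))

  -- With t rows to go the table of available symbols is t-regular, so every choice of a row leads
  -- to the same bound and the product of the d^n is (t!)^n. Each row loses a factor 36 only.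
  length-latin : ∀ t B → t ≤ n → Regular t B → ((t !) * q ^ t) ^ n ≤ length (latin t B) * (36 * p ^ n) ^ t
  length-latin zero B _ _ = ≤-reflexive (^-zeroˡ n)
  length-latin (suc t) B t<n reg@(r , c) = begin
    ((suc t * t !) * (q * q ^ t)) ^ n
      ≡⟨ trans (cong (_^ n) (e1 (suc t) (t !) q (q ^ t))) (^-distribʳ-* (suc t * q) (t ! * q ^ t) n) ⟩
    (suc t * q) ^ n * F
      ≤⟨ *-monoˡ-≤ F (permanent-bound B (suc t) (s≤s z≤n) t<n r c) ⟩
    36 * (p ^ n * per (λ r c → bit (B r c))) * F
      ≤⟨ *-monoˡ-≤ F (*-monoʳ-≤ 36 (*-monoʳ-≤ (p ^ n) (per≤rows B))) ⟩
    36 * (p ^ n * length (rows B)) * F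
      ≡⟨ e2 (p ^ n) (length (rows B)) F ⟩
    36 * p ^ n * (length (rows B) * F)
      ≡⟨ cong (36 * p ^ n *_) (sym (sumL-const (rows B) F)) ⟩
    36 * p ^ n * sumL (rows B) (λ _ → F)
      ≤⟨ *-monoʳ-≤ (36 * p ^ n) (sumL-mono-All (All.map (λ {x} (perm , fits) → length-latin t (remove B x) (<⇒≤ t<n) (remove-regular B x perm fits reg)) (All.all-filter (good? B) allRows))) ⟩
    36 * p ^ n * sumL (rows B) (λ x → length (latin t (remove B x)) * (36 * p ^ n) ^ t)
      ≡⟨ cong (36 * p ^ n *_) (sym (*-distribʳ-sumL ((36 * p ^ n) ^ t) (rows B) (λ x → length (latin t (remove B x))))) ⟩
    36 * p ^ n * (sumL (rows B) (λ x → length (latin t (remove B x))) * (36 * p ^ n) ^ t)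
      ≡⟨ cong (λ z → 36 * p ^ n * (z * (36 * p ^ n) ^ t)) (sym length≡) ⟩
    36 * p ^ n * (length (latin (suc t) B) * (36 * p ^ n) ^ t)
      ≡⟨ x∙yz≈y∙xz (36 * p ^ n) (length (latin (suc t) B)) _ ⟩
    length (latin (suc t) B) * (36 * p ^ n * (36 * p ^ n) ^ t) ∎
    where
    F = (t ! * q ^ t) ^ n
    e1 : ∀ a b c d → (a * b) * (c * d) ≡ a * c * (b * d)
    e1 = solve-∀
    e2 : ∀ a b c → 36 * (a * b) * c ≡ 36 * a * (b * c)
    e2 = solve-∀
    length≡ : length (latin (suc t) B) ≡ sumL (rows B) (λ x → length (latin t (remove B x)))
    length≡ = trans (length-sumL (latin (suc t) B)) (trans (sumL-consAll (rows B) (λ x → latin t (remove B x)) (λ _ → 1)) (sumL-cong (rows B) (λ x → sym (length-sumL (latin t (remove B x))))))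

  full : Table
  full _ _ = true

  latin-entry : ∀ {t} B (L : Vec Row t) → Latin B L → ∀ i j → B j (lookup (lookup L i) j) ≡ true
  latin-entry B (x ∷ L) (_ , fits , _) zero j = fits j
  latin-entry B (x ∷ L) (_ , _ , ok) (suc i) j = proj₁ (∖-true⁻ (B j) _ _ (latin-entry (remove B x) L ok i j))

  latin-column : ∀ {t} B (L : Vec Row t) → Latin B L → ∀ j i i′ → lookup (lookup L i) j ≡ lookup (lookup L i′) j → i ≡ i′
  latin-column B (x ∷ L) ok j zero zero eq = refl
  latin-column B (x ∷ L) (_ , _ , ok) j zero (suc i′) eq = ⊥-elim (proj₂ (∖-true⁻ (B j) _ _ (latin-entry (remove B x) L ok i′ j)) (sym eq))
  latin-column B (x ∷ L) (_ , _ , ok) j (suc i) zero eq = ⊥-elim (proj₂ (∖-true⁻ (B j) _ _ (latin-entry (remove B x) L ok i j)) eq)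
  latin-column B (x ∷ L) (_ , _ , ok) j (suc i) (suc i′) eq = cong suc (latin-column (remove B x) L ok j i i′ eq)

  latin-perm : ∀ {t} B (L : Vec Row t) → Latin B L → ∀ i → IsPerm (lookup L i)
  latin-perm B (x ∷ L) (perm , _) zero = perm
  latin-perm B (x ∷ L) (_ , _ , ok) (suc i) = latin-perm (remove B x) L ok i

  toLatinSquare : {L : Vec Row n} → Latin full L → LatinSquare n
  toLatinSquare {L} ok = record
    { entry = λ i j → lookup (lookup L i) j
    ; rowExists = λ i → injective⇒surjective (lookup (lookup L i)) (perm-injective (lookup L i) (latin-perm full L ok i))
    ; rowUnique = λ i → perm-injective (lookup L i) (latin-perm full L ok i)
    ; colExists = λ j → injective⇒surjective (λ i → lookup (lookup L i) j) (latin-column full L ok j)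
    ; colUnique = latin-column full L ok
    }

  toLatinSquare-injective : {L L′ : Vec Row n} (ok : Latin full L) (ok′ : Latin full L′) →
    SameConcept (toLatinSquare ok) (toLatinSquare ok′) → L ≡ L′
  toLatinSquare-injective {L} {L′} ok ok′ same = vec-ext L L′ (λ i → vec-ext _ _ (λ j →
    sym (Equivalence.to (same (i , j , lookup (lookup L i) j)) refl)))

  squares : {Ls : List (Vec Row n)} → All (Latin full) Ls → List (LatinSquare n)
  squares = All.reduce toLatinSquare

  length-squares : ∀ {Ls} (oks : All (Latin full) Ls) → length (squares oks) ≡ length Ls
  length-squares [] = refl
  length-squares (ok ∷ oks) = cong suc (length-squares oks)

  distinct-squares : ∀ {Ls} (oks : All (Latin full) Ls) → Unique Ls → AllPairs (λ c c′ → ¬ SameConcept c c′) (squares oks)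
  distinct-squares [] [] = []
  distinct-squares (ok ∷ oks) (L≢ ∷ u) = one oks L≢ ∷ distinct-squares oks u
    where
    one : ∀ {Ls} (oks : All (Latin full) Ls) → All (_ ≢_) Ls → All (λ c′ → ¬ SameConcept (toLatinSquare ok) c′) (squares oks)
    one [] [] = []
    one (ok′ ∷ oks) (h ∷ hs) = (λ same → h (toLatinSquare-injective ok ok′ same)) ∷ one oks hs

  allSquares : List (LatinSquare n)
  allSquares = squares (all-latin n full)

  length-allSquares : ((n !) * q ^ n) ^ n ≤ length allSquares * (36 * p ^ n) ^ n
  length-allSquares = subst (λ z → ((n !) * q ^ n) ^ n ≤ z * (36 * p ^ n) ^ n) (sym (length-squares (all-latin n full)))
    (length-latin n full ≤-refl ((λ _ → card-true n) , (λ _ → card-true n)))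

  distinct-allSquares : AllPairs (λ c c′ → ¬ SameConcept c c′) allSquares
  distinct-allSquares = distinct-squares (all-latin n full) (unique-latin n full)

-- Latin squares agreeing outside a mask

sumL-term : {P : Elem → Set} (P? : Decidable P) {xs : List Elem} → AllPairs (λ x y → ¬ (P x × P y)) xs → sumL xs (λ x → ⟦ P? x ⟧) ≤ 1
sumL-term P? [] = z≤n
sumL-term {Elem = X} {P = P} P? {x ∷ xs} (h ∷ hs) with P? x
... | no _ = sumL-term P? hs
... | yes px = ≤-reflexive (cong suc (none h))
  where
  none : {xs : List X} → All (λ y → ¬ (P x × P y)) xs → sumL xs (λ y → ⟦ P? y ⟧) ≡ 0
  none [] = refl
  none {y ∷ ys} (h ∷ hs) = cong₂ _+_ (⟦⟧-no (P? y) (λ py → h (px , py))) (none hs)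

length≡0 : {xs : List Elem} → All (λ _ → ⊥) xs → length xs ≡ 0
length≡0 [] = refl

module Traces (n : ℕ) (n>0 : 0 < n) (α β s : ℕ) (α>0 : 0 < α) (s>0 : 0 < s)
  (step : ∀ d → β * suc d * (d + s) ^ d ≤ α * (suc d + s) ^ suc d) where
  open LatinList n n>0 public
  open Bregman α β s α>0 s>0 step public using (weight; bregman)

  rows-bound : ∀ B → length (rows B) * β ^ n ≤ ∏ (λ j → weight (card (B j)))
  rows-bound B = subst (λ z → z * β ^ n ≤ ∏ (λ j → weight (card (B j)))) (length-map lookup (rows B))
    (bregman n B (map lookup (rows B))
      (AllPairs.map⁺ (AllPairs.map (λ x≢y same → x≢y (vec-ext _ _ same)) (Unique.filter⁺ (good? B) (unique-allVecs (Unique.allFin⁺ n) n))))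
      (All.map⁺ (All.map (λ {x} (perm , fits) → fits , perm-injective x perm , λ _ k _ → injective⇒surjective (lookup x) (perm-injective x perm) k)
        (All.all-filter (good? B) allRows))))

  -- true marks a hole, a cell that is not revealed.
  MaskRow : Set
  MaskRow = Vec Bool n

  relax : MaskRow → Table → Table
  relax T D j k = lookup T j ∨ D j k

  removeOff : MaskRow → Table → Row → Table
  removeOff T D x j = if lookup T j then D j else D j ∖ lookup x j

  -- The rows are permutations but the column condition concerns revealed cells only, so that the entries
  -- in the holes of a row may be permuted freely.
  arrays : ∀ {t} → Vec MaskRow t → Table → List (Vec Row t)
  arrays [] D = [] ∷ []
  arrays (T ∷ Ts) D = consAll (rows (relax T D)) (λ x → arrays Ts (removeOff T D x))

  sumL-arrays : ∀ {t} T (Ts : Vec MaskRow t) D f → sumL (arrays (T ∷ Ts) D) f ≡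
    sumL (rows (relax T D)) (λ x → sumL (arrays Ts (removeOff T D x)) (λ y → f (x ∷ y)))
  sumL-arrays T Ts D f = sumL-consAll (rows (relax T D)) (λ x → arrays Ts (removeOff T D x)) f

  holes : ∀ {N} → Vec Bool N → ℕ
  holes [] = 0
  holes (b ∷ T) = bit b + holes T

  total : ∀ {t} → Vec MaskRow t → ℕ
  total [] = 0
  total (T ∷ Ts) = holes T + total Ts

  holes-∑ : ∀ {N} (T : Vec Bool N) → holes T ≡ ∑ (λ j → bit (lookup T j))
  holes-∑ [] = refl
  holes-∑ (b ∷ T) = cong (bit b +_) (holes-∑ T)

  -- Up to a power of β, the product of g(1), ..., g(d), where g(i) replaces (i!)^(1/i). A column
  -- whose supply of symbols falls from d to d′ contributes `gfact d / gfact d′`.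
  gfact : ℕ → ℕ
  gfact zero = 1
  gfact (suc d) = weight (suc d) * gfact d

  next : MaskRow → (Fin n → ℕ) → Fin n → ℕ
  next T d j = if lookup T j then d j else d j ∸ 1

  left : ∀ {t} → Vec MaskRow t → (Fin n → ℕ) → Fin n → ℕ
  left [] d = d
  left (T ∷ Ts) d = left Ts (next T d)

  left-cong : ∀ {t} (Ts : Vec MaskRow t) {d d′} → (∀ j → d j ≡ d′ j) → ∀ j → left Ts d j ≡ left Ts d′ j
  left-cong [] h = h
  left-cong (T ∷ Ts) h = left-cong Ts (λ j → cong (λ z → if lookup T j then z else z ∸ 1) (h j))

  card-removeOff : ∀ T D x → Fits (relax T D) x → ∀ j → card (removeOff T D x j) ≡ next T (λ j → card (D j)) j
  card-removeOff T D x fits j with lookup T j | fits j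
  ... | true | _ = refl
  ... | false | fit = sym (cong (_∸ 1) (trans (card-∖ (D j) (lookup x j)) (cong (λ b → bit b + card (D j ∖ lookup x j)) fit)))

  card-relax : ∀ T D j → card (relax T D j) ≡ (if lookup T j then n else card (D j))
  card-relax T D j with lookup T j
  ... | true = card-true n
  ... | false = refl

  card>0 : ∀ {N} (b : Fin N → Bool) k → b k ≡ true → 0 < card b
  card>0 b k eq = ≤-trans (≤-reflexive (sym (cong bit eq))) (∑-term (bit ∘ b) k)

  -- In Brègman's product a revealed cell contributes the top factor of `gfact` of its column, and a
  -- hole, where all n symbols are allowed, contributes `weight n`. Hence the product over rows
  -- telescopes.
  row-step : ∀ T D → length (rows (relax T D)) * β ^ n * ∏ (λ j → gfact (next T (λ j → card (D j)) j)) ≤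
    ∏ (λ j → gfact (card (D j))) * weight n ^ holes T
  row-step T D with Fin.all? (λ j → (lookup T j Bool.≟ true) ⊎-dec (1 ≤? card (D j)))
  -- A revealed cell whose column has no symbol left: `next` would truncate, but there is no row to
  -- count.
  ... | no ¬h = ≤-trans (≤-reflexive (cong (λ z → z * β ^ n * ∏ (λ j → gfact (next T (λ j → card (D j)) j)))
        (length≡0 (All.map (λ {x} (perm , fits) → ¬h (λ j → nonempty x fits j)) (All.all-filter (good? (relax T D)) allRows))))) z≤n
    where
    nonempty : ∀ x → Fits (relax T D) x → ∀ j → lookup T j ≡ true ⊎ 1 ≤ card (D j)
    nonempty x fits j with lookup T j | fits j
    ... | true | _ = inj₁ refl
    ... | false | fit = inj₂ (card>0 (D j) _ fit)
  ... | yes h = begin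
    length (rows (relax T D)) * β ^ n * ∏ (λ j → gfact (next T d j))
      ≤⟨ *-monoˡ-≤ _ (rows-bound (relax T D)) ⟩
    ∏ (λ j → weight (card (relax T D j))) * ∏ (λ j → gfact (next T d j))
      ≡⟨ ∏-* (λ j → weight (card (relax T D j))) (λ j → gfact (next T d j)) ⟨
    ∏ (λ j → weight (card (relax T D j)) * gfact (next T d j))
      ≡⟨ ∏-cong (λ j → trans (cong (λ z → weight z * gfact (next T d j)) (card-relax T D j)) (cell j (h j))) ⟩
    ∏ (λ j → gfact (d j) * weight n ^ bit (lookup T j))
      ≡⟨ ∏-* (λ j → gfact (d j)) (λ j → weight n ^ bit (lookup T j)) ⟩
    ∏ (λ j → gfact (d j)) * ∏ (λ j → weight n ^ bit (lookup T j))
      ≡⟨ cong (∏ (λ j → gfact (d j)) *_) (trans (∏-^∑ (weight n) (λ j → bit (lookup T j))) (cong (weight n ^_) (sym (holes-∑ T)))) ⟩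
    ∏ (λ j → gfact (d j)) * weight n ^ holes T ∎
    where
    d = λ j → card (D j)
    cell : ∀ j → lookup T j ≡ true ⊎ 1 ≤ d j → weight (if lookup T j then n else d j) * gfact (next T d j) ≡ gfact (d j) * weight n ^ bit (lookup T j)
    cell j hj with lookup T j
    ... | true = trans (*-comm (weight n) _) (cong (gfact (d j) *_) (sym (*-identityʳ (weight n))))
    ... | false with d j | hj
    ... | zero | inj₁ ()
    ... | zero | inj₂ ()
    ... | suc e | _ = sym (*-identityʳ _)

  arrays-bound : ∀ {t} (Ts : Vec MaskRow t) D →
    length (arrays Ts D) * (β ^ n) ^ t * ∏ (λ j → gfact (left Ts (λ j → card (D j)) j)) ≤ ∏ (λ j → gfact (card (D j))) * weight n ^ total Ts
  arrays-bound [] D = ≤-reflexive (trans (+-identityʳ _) (sym (*-identityʳ _)))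
  arrays-bound {suc t} (T ∷ Ts) D = begin
    length (arrays (T ∷ Ts) D) * (β ^ n * (β ^ n) ^ t) * Π
      ≡⟨ cong (λ z → z * (β ^ n * (β ^ n) ^ t) * Π) (trans (length-sumL (arrays (T ∷ Ts) D)) (trans (sumL-arrays T Ts D (λ _ → 1)) (sumL-cong (rows (relax T D)) (λ x → sym (length-sumL (arrays Ts (removeOff T D x))))))) ⟩
    S * (β ^ n * (β ^ n) ^ t) * Π
      ≡⟨ e1 S (β ^ n) ((β ^ n) ^ t) Π ⟩
    S * ((β ^ n) ^ t * Π) * β ^ n
      ≡⟨ cong (_* β ^ n) (*-distribʳ-sumL ((β ^ n) ^ t * Π) (rows (relax T D)) (λ x → length (arrays Ts (removeOff T D x)))) ⟩
    sumL (rows (relax T D)) (λ x → length (arrays Ts (removeOff T D x)) * ((β ^ n) ^ t * Π)) * β ^ n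
      ≤⟨ *-monoˡ-≤ (β ^ n) (sumL-mono-All (All.map (λ {x} (_ , fits) → below x fits) (All.all-filter (good? (relax T D)) allRows))) ⟩
    sumL (rows (relax T D)) (λ x → ∏ (λ j → gfact (next T d j)) * weight n ^ total Ts) * β ^ n
      ≡⟨ cong (_* β ^ n) (sumL-const (rows (relax T D)) _) ⟩
    length (rows (relax T D)) * (∏ (λ j → gfact (next T d j)) * weight n ^ total Ts) * β ^ n
      ≡⟨ e2 (length (rows (relax T D))) _ (weight n ^ total Ts) (β ^ n) ⟩
    length (rows (relax T D)) * β ^ n * ∏ (λ j → gfact (next T d j)) * weight n ^ total Ts
      ≤⟨ *-monoˡ-≤ (weight n ^ total Ts) (row-step T D) ⟩
    ∏ (λ j → gfact (d j)) * weight n ^ holes T * weight n ^ total Ts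
      ≡⟨ trans (*-assoc (∏ (λ j → gfact (d j))) _ _) (cong (∏ (λ j → gfact (d j)) *_) (sym (^-distribˡ-+-* (weight n) (holes T) (total Ts)))) ⟩
    ∏ (λ j → gfact (d j)) * weight n ^ (holes T + total Ts) ∎
    where
    d = λ j → card (D j)
    Π = ∏ (λ j → gfact (left Ts (next T d) j))
    S = sumL (rows (relax T D)) (λ x → length (arrays Ts (removeOff T D x)))
    e1 : ∀ a b c e → a * (b * c) * e ≡ a * (c * e) * b
    e1 = solve-∀
    e2 : ∀ a b c e → a * (b * c) * e ≡ a * e * b * c
    e2 = solve-∀
    below : ∀ x → Fits (relax T D) x → length (arrays Ts (removeOff T D x)) * ((β ^ n) ^ t * Π) ≤ ∏ (λ j → gfact (next T d j)) * weight n ^ total Ts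
    below x fits = begin
      length (arrays Ts D′) * ((β ^ n) ^ t * Π) ≡⟨ *-assoc (length (arrays Ts D′)) ((β ^ n) ^ t) Π ⟨
      length (arrays Ts D′) * (β ^ n) ^ t * Π ≡⟨ cong (length (arrays Ts D′) * (β ^ n) ^ t *_) (∏-cong (λ j → cong gfact (left-cong Ts (card-removeOff T D x fits) j))) ⟨
      length (arrays Ts D′) * (β ^ n) ^ t * ∏ (λ j → gfact (left Ts (λ j → card (D′ j)) j)) ≤⟨ arrays-bound Ts D′ ⟩
      ∏ (λ j → gfact (card (D′ j))) * weight n ^ total Ts ≡⟨ cong (_* weight n ^ total Ts) (∏-cong (λ j → cong gfact (card-removeOff T D x fits j))) ⟩
      ∏ (λ j → gfact (next T d j)) * weight n ^ total Ts ∎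
      where D′ = removeOff T D x

  filled : ∀ {N} → Vec Bool N → Vec (Fin n) N → V → ℕ
  filled [] [] w = 0
  filled (true ∷ T) (y ∷ x) w = filled T x w
  filled (false ∷ T) (y ∷ x) w = δ y w + filled T x w

  RowAgree : ∀ {N} → Vec Bool N → Vec (Fin n) N → Vec (Fin n) N → Set
  RowAgree T f x = ∀ j → lookup T j ≡ false → lookup f j ≡ lookup x j

  rowAgree? : ∀ {N} (T : Vec Bool N) f x → Dec (RowAgree T f x)
  rowAgree? T f x = Fin.all? (λ j → (lookup T j Bool.≟ false) →-dec (lookup f j ≟ lookup x j))

  completion? : ∀ {N} (T : Vec Bool N) (x : Vec (Fin n) N) (φ : V → ℕ) f → Dec (RowAgree T f x × (∀ w → occ w f ≡ filled T x w + φ w))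
  completion? T x φ f = rowAgree? T f x ×-dec Fin.all? (λ w → occ w f ℕ.≟ filled T x w + φ w)

  -- φ marks the symbols left for the holes. A symbol used in a hole is removed from φ, so the
  -- number of choices drops by one from hole to hole.
  completions : ∀ {N} (T : Vec Bool N) (x : Vec (Fin n) N) (φ : V → ℕ) → (∀ w → φ w ≤ 1) → ∑ φ ≡ holes T →
    holes T ! ≤ sumL (allVecs (allFin n) N) (λ f → ⟦ completion? T x φ f ⟧)
  completions [] [] φ _ ∑φ = ≤-reflexive (sym (trans (+-identityʳ _) (⟦⟧-yes (completion? [] [] φ [])
    ((λ ()) , λ w → sym (n≤0⇒n≡0 (≤-trans (∑-term φ w) (≤-reflexive ∑φ)))))))
  completions {suc N} (b ∷ T) (y ∷ x) φ φ≤1 ∑φ = ≤-trans (main b ∑φ) (≤-reflexive (sym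
    (trans (sumL-consAll (allFin n) (λ _ → allVecs (allFin n) N) _) (sumL-tabulate {n = n} id F))))
    where
    F : Fin n → ℕ
    F z = sumL (allVecs (allFin n) N) (λ f → ⟦ completion? (b ∷ T) (y ∷ x) φ (z ∷ f) ⟧)
    main : ∀ b → ∑ φ ≡ holes (b ∷ T) → holes (b ∷ T) ! ≤ ∑ (λ z → sumL (allVecs (allFin n) N) (λ f → ⟦ completion? (b ∷ T) (y ∷ x) φ (z ∷ f) ⟧))
    main false ∑φ = begin
      holes T !
        ≤⟨ completions T x φ φ≤1 ∑φ ⟩
      sumL (allVecs (allFin n) N) (λ f → ⟦ completion? T x φ f ⟧)
        ≤⟨ sumL-mono (allVecs (allFin n) N) (λ f → ⟦⟧-mono (completion? T x φ f) (completion? (false ∷ T) (y ∷ x) φ (y ∷ f)) (λ (agree , o) →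
             (λ { zero _ → refl ; (suc j) h → agree j h }) , λ w → trans (cong (δ y w +_) (o w)) (sym (+-assoc (δ y w) _ _)))) ⟩
      sumL (allVecs (allFin n) N) (λ f → ⟦ completion? (false ∷ T) (y ∷ x) φ (y ∷ f) ⟧)
        ≤⟨ ∑-term (λ z → sumL (allVecs (allFin n) N) (λ f → ⟦ completion? (false ∷ T) (y ∷ x) φ (z ∷ f) ⟧)) y ⟩
      ∑ (λ z → sumL (allVecs (allFin n) N) (λ f → ⟦ completion? (false ∷ T) (y ∷ x) φ (z ∷ f) ⟧)) ∎
    main true ∑φ = begin
      suc (holes T) * holes T ! ≡⟨ cong (_* holes T !) ∑φ ⟨
      ∑ φ * holes T ! ≡⟨ *-distribʳ-∑ (holes T !) φ ⟩
      ∑ (λ z → φ z * holes T !) ≤⟨ ∑-mono (λ z → term z (φ z) refl) ⟩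
      ∑ (λ z → sumL (allVecs (allFin n) N) (λ f → ⟦ completion? (true ∷ T) (y ∷ x) φ (z ∷ f) ⟧)) ∎
      where
      term : ∀ z m → φ z ≡ m → m * holes T ! ≤ sumL (allVecs (allFin n) N) (λ f → ⟦ completion? (true ∷ T) (y ∷ x) φ (z ∷ f) ⟧)
      term z zero _ = z≤n
      term z (suc (suc m)) eq = ⊥-elim (1+n≰n (≤-trans (s≤s (s≤s z≤n)) (subst (_≤ 1) eq (φ≤1 z))))
      term z 1 eq = begin
        1 * holes T ! ≡⟨ *-identityˡ _ ⟩
        holes T ! ≤⟨ completions T x φ′ (λ w → ≤-trans (m∸n≤m (φ w) (δ z w)) (φ≤1 w)) ∑φ′ ⟩
        sumL (allVecs (allFin n) N) (λ f → ⟦ completion? T x φ′ f ⟧)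
          ≤⟨ sumL-mono (allVecs (allFin n) N) (λ f → ⟦⟧-mono (completion? T x φ′ f) (completion? (true ∷ T) (y ∷ x) φ (z ∷ f)) (λ (agree , o) →
             (λ { zero () ; (suc j) h → agree j h }) , λ w → trans (cong (δ z w +_) (o w)) (trans (l (δ z w) (filled T x w) (φ′ w)) (cong (filled T x w +_) (sym (φ≡ w)))))) ⟩
        sumL (allVecs (allFin n) N) (λ f → ⟦ completion? (true ∷ T) (y ∷ x) φ (z ∷ f) ⟧) ∎
        where
        φ′ : V → ℕ
        φ′ w = φ w ∸ δ z w
        l : ∀ a b c → a + (b + c) ≡ b + (a + c)
        l = solve-∀
        φ≡ : ∀ w → φ w ≡ δ z w + φ′ w
        φ≡ w with z ≟ w
        ... | yes refl rewrite eq = refl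
        ... | no _ = refl
        ∑φ′ : ∑ φ′ ≡ holes T
        ∑φ′ = suc-injective (trans (cong (_+ ∑ φ′) (sym (trans (∑-single (δ z) z (λ w w≢z → ⟦⟧-no (z ≟ w) (w≢z ∘ sym))) (δ-refl z))))
          (trans (sym (∑-+ (δ z) φ′)) (trans (sym (∑-cong φ≡)) ∑φ)))

  filled≤occ : ∀ {N} (T : Vec Bool N) x w → filled T x w ≤ occ w x
  filled≤occ [] [] w = z≤n
  filled≤occ (true ∷ T) (y ∷ x) w = ≤-trans (filled≤occ T x w) (m≤n+m _ (δ y w))
  filled≤occ (false ∷ T) (y ∷ x) w = +-monoʳ-≤ (δ y w) (filled≤occ T x w)

  ∑-filled : ∀ {N} (T : Vec Bool N) x → ∑ (filled T x) + holes T ≡ N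
  ∑-filled [] [] = trans (+-identityʳ _) (∑-zero {n} (λ _ → refl))
  ∑-filled (true ∷ T) (y ∷ x) = trans (+-suc (∑ (filled T x)) (holes T)) (cong suc (∑-filled T x))
  ∑-filled (false ∷ T) (y ∷ x) = trans (cong (_+ holes T) (trans (∑-+ (δ y) (filled T x)) (cong (_+ ∑ (filled T x)) (trans (∑-single (δ y) y (λ w w≢y → ⟦⟧-no (y ≟ w) (w≢y ∘ sym))) (δ-refl y)))))
    (cong suc (∑-filled T x))

  perm-completions : ∀ T x D → IsPerm x → Fits (relax T D) x → holes T ! ≤ sumL (rows (relax T D)) (λ f → ⟦ rowAgree? T f x ⟧)
  perm-completions T x D perm fits = begin
    holes T ! ≤⟨ completions T x φ (λ w → m∸n≤m 1 (filled T x w)) ∑φ ⟩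
    sumL allRows (λ f → ⟦ completion? T x φ f ⟧) ≤⟨ sumL-mono allRows pointwise ⟩
    sumL allRows (λ f → ⟦ good? (relax T D) f ⟧ * ⟦ rowAgree? T f x ⟧) ≡⟨ sumL-filter (good? (relax T D)) allRows _ ⟨
    sumL (rows (relax T D)) (λ f → ⟦ rowAgree? T f x ⟧) ∎
    where
    φ : V → ℕ
    φ w = 1 ∸ filled T x w
    φ≡ : ∀ w → filled T x w + φ w ≡ 1
    φ≡ w = m+[n∸m]≡n (≤-trans (filled≤occ T x w) (≤-reflexive (perm w)))
    ∑φ : ∑ φ ≡ holes T
    ∑φ = +-cancelˡ-≡ (∑ (filled T x)) _ _ (trans (sym (∑-+ (filled T x) φ)) (trans (∑-cong φ≡) (trans (card-true n) (sym (∑-filled T x)))))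
    fits′ : ∀ f → RowAgree T f x → Fits (relax T D) f
    fits′ f agree j with lookup T j | fits j | agree j
    ... | true | _ | _ = refl
    ... | false | fit | same = trans (cong (D j) (same refl)) fit
    pointwise : ∀ f → ⟦ completion? T x φ f ⟧ ≤ ⟦ good? (relax T D) f ⟧ * ⟦ rowAgree? T f x ⟧
    pointwise f = ≤-trans (≤-reflexive (sym (*-identityʳ _))) (⟦⟧-*-≤ (completion? T x φ f) λ (agree , o) →
      ≤-reflexive (sym (cong₂ _*_ (⟦⟧-yes (good? (relax T D) f) ((λ w → trans (o w) (φ≡ w)) , fits′ f agree)) (⟦⟧-yes (rowAgree? T f x) agree))))

module TraceCount (n : ℕ) (n>0 : 0 < n) (α β s : ℕ) (α>0 : 0 < α) (s>0 : 0 < s)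
  (step : ∀ d → β * suc d * (d + s) ^ d ≤ α * (suc d + s) ^ suc d) where
  open Traces n n>0 α β s α>0 s>0 step public

  LatinOff : ∀ {t} → Vec MaskRow t → Table → Vec Row t → Set
  LatinOff [] D [] = ⊤
  LatinOff (T ∷ Ts) D (x ∷ L) = IsPerm x × Fits (relax T D) x × LatinOff Ts (removeOff T D x) L

  LatinOff-cong : ∀ {t} (Ts : Vec MaskRow t) {D D′} L → (∀ j k → D j k ≡ D′ j k) → LatinOff Ts D L → LatinOff Ts D′ L
  LatinOff-cong [] [] h _ = tt
  LatinOff-cong (T ∷ Ts) {D} {D′} (x ∷ L) h (perm , fits , ok) =
    perm , (λ j → trans (cong (lookup T j ∨_) (sym (h j _))) (fits j)) ,
    LatinOff-cong Ts L same ok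
    where
    same : ∀ j k → removeOff T D x j k ≡ removeOff T D′ x j k
    same j k with lookup T j
    ... | true = h j k
    ... | false = cong (_∧ not (does (k ≟ lookup x j))) (h j k)

  Agree : ∀ {t} → Vec MaskRow t → Vec Row t → Vec Row t → Set
  Agree Ts y L = ∀ i → RowAgree (lookup Ts i) (lookup y i) (lookup L i)

  agree? : ∀ {t} (Ts : Vec MaskRow t) y L → Dec (Agree Ts y L)
  agree? Ts y L = Fin.all? (λ i → rowAgree? (lookup Ts i) (lookup y i) (lookup L i))

  rowFactorials : ∀ {t} → Vec MaskRow t → ℕ
  rowFactorials [] = 1
  rowFactorials (T ∷ Ts) = holes T ! * rowFactorials Ts

  -- Permuting the entries in the holes of a row does not affect the tables for later rows, which
  -- record revealed cells only, so the choices in different rows multiply.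
  class-size : ∀ {t} (Ts : Vec MaskRow t) D L → LatinOff Ts D L → rowFactorials Ts ≤ sumL (arrays Ts D) (λ y → ⟦ agree? Ts y L ⟧)
  class-size [] D [] _ = ≤-reflexive (sym (trans (+-identityʳ _) (⟦⟧-yes (agree? [] [] []) (λ ()))))
  class-size (T ∷ Ts) D (x ∷ L) (perm , fits , ok) = begin
    holes T ! * rowFactorials Ts
      ≤⟨ *-monoˡ-≤ (rowFactorials Ts) (perm-completions T x D perm fits) ⟩
    sumL (rows (relax T D)) (λ f → ⟦ rowAgree? T f x ⟧) * rowFactorials Ts
      ≡⟨ *-distribʳ-sumL (rowFactorials Ts) (rows (relax T D)) (λ f → ⟦ rowAgree? T f x ⟧) ⟩
    sumL (rows (relax T D)) (λ f → ⟦ rowAgree? T f x ⟧ * rowFactorials Ts)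
      ≤⟨ sumL-mono (rows (relax T D)) (λ f → ⟦⟧-*-≤ (rowAgree? T f x) (below f)) ⟩
    sumL (rows (relax T D)) (λ f → sumL (arrays Ts (removeOff T D f)) (λ y → ⟦ agree? (T ∷ Ts) (f ∷ y) (x ∷ L) ⟧))
      ≡⟨ sumL-arrays T Ts D (λ y → ⟦ agree? (T ∷ Ts) y (x ∷ L) ⟧) ⟨
    sumL (arrays (T ∷ Ts) D) (λ y → ⟦ agree? (T ∷ Ts) y (x ∷ L) ⟧) ∎
    where
    below : ∀ f → RowAgree T f x → rowFactorials Ts ≤ sumL (arrays Ts (removeOff T D f)) (λ y → ⟦ agree? (T ∷ Ts) (f ∷ y) (x ∷ L) ⟧)
    below f agree = ≤-trans (class-size Ts (removeOff T D f) L (LatinOff-cong Ts L same ok))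
      (sumL-mono (arrays Ts (removeOff T D f)) (λ y → ⟦⟧-mono (agree? Ts y L) (agree? (T ∷ Ts) (f ∷ y) (x ∷ L)) (λ h → λ where
        zero → agree
        (suc i) → h i)))
      where
      same : ∀ j k → removeOff T D x j k ≡ removeOff T D f j k
      same j k with lookup T j | agree j
      ... | true | _ = refl
      ... | false | eq = cong (λ z → (D j ∖ z) k) (sym (eq refl))

  -- No array agrees outside the mask with two members of `Z`, so the classes of `class-size` are
  -- disjoint.
  classes-bound : (Ts : Vec MaskRow n) (Z : List (Vec Row n)) → All (LatinOff Ts full) Z →
    AllPairs (λ L L′ → ¬ Agree Ts L L′) Z → length Z * rowFactorials Ts ≤ length (arrays Ts full)
  classes-bound Ts Z ok distinct = begin
    length Z * rowFactorials Ts
      ≡⟨ sumL-const Z (rowFactorials Ts) ⟨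
    sumL Z (λ _ → rowFactorials Ts)
      ≤⟨ sumL-mono-All (All.map (λ {L} → class-size Ts full L) ok) ⟩
    sumL Z (λ L → sumL (arrays Ts full) (λ y → ⟦ agree? Ts y L ⟧))
      ≡⟨ sumL-swap Z (arrays Ts full) _ ⟩
    sumL (arrays Ts full) (λ y → sumL Z (λ L → ⟦ agree? Ts y L ⟧))
      ≤⟨ sumL-mono (arrays Ts full) (λ y → sumL-term (λ L → agree? Ts y L) (AllPairs.map (λ {L} {L′} L≁L′ (p , p′) → L≁L′ (λ i j h → trans (sym (p i j h)) (p′ i j h))) distinct)) ⟩
    sumL (arrays Ts full) (λ _ → 1)
      ≡⟨ length-sumL (arrays Ts full) ⟨
    length (arrays Ts full) ∎

  columnHoles : ∀ {t} → Vec MaskRow t → Fin n → ℕ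
  columnHoles [] j = 0
  columnHoles (T ∷ Ts) j = bit (lookup T j) + columnHoles Ts j

  ∑-columnHoles : ∀ {t} (Ts : Vec MaskRow t) → ∑ (columnHoles Ts) ≡ total Ts
  ∑-columnHoles [] = ∑-zero {n} (λ _ → refl)
  ∑-columnHoles (T ∷ Ts) = trans (∑-+ (λ j → bit (lookup T j)) (columnHoles Ts)) (cong₂ _+_ (sym (holes-∑ T)) (∑-columnHoles Ts))

  left≡ : ∀ {t} (Ts : Vec MaskRow t) d j e → d j ≡ e + t → left Ts d j ≡ e + columnHoles Ts j
  left≡ [] d j e eq = eq
  left≡ {suc t} (T ∷ Ts) d j e eq with lookup T j in eqT
  ... | true = trans (left≡ Ts (next T d) j (suc e) (trans (cong (λ b → if b then d j else d j ∸ 1) eqT) (trans eq (+-suc e t)))) (sym (+-suc e (columnHoles Ts j)))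
  ... | false = left≡ Ts (next T d) j e (trans (cong (λ b → if b then d j else d j ∸ 1) eqT) (trans (cong (_∸ 1) eq) (cong (_∸ 1) (+-suc e t))))

  gfact-lower : ∀ b → α ^ b * b ! ≤ gfact b
  gfact-lower zero = ≤-refl
  gfact-lower (suc b) = ≤-trans (≤-reflexive (interchange α (α ^ b) (suc b) (b !))) (*-mono-≤ (*-monoʳ-≤ α (m≤m+n (suc b) s)) (gfact-lower b))

  module _ (l : ℕ) where

    rowFactorials-lower : ∀ {t} (Ts : Vec MaskRow t) → l ^ total Ts * (q ^ l) ^ t ≤ rowFactorials Ts * (p ^ l) ^ t
    rowFactorials-lower [] = ≤-refl
    rowFactorials-lower {suc t} (T ∷ Ts) = begin
      l ^ (holes T + total Ts) * (q ^ l * (q ^ l) ^ t) ≡⟨ cong (_* (q ^ l * (q ^ l) ^ t)) (^-distribˡ-+-* l (holes T) (total Ts)) ⟩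
      l ^ holes T * l ^ total Ts * (q ^ l * (q ^ l) ^ t) ≡⟨ interchange (l ^ holes T) (l ^ total Ts) (q ^ l) _ ⟩
      l ^ holes T * q ^ l * (l ^ total Ts * (q ^ l) ^ t) ≤⟨ *-mono-≤ (poisson-bound n l (holes T)) (rowFactorials-lower Ts) ⟩
      holes T ! * p ^ l * (rowFactorials Ts * (p ^ l) ^ t) ≡⟨ interchange (holes T !) (p ^ l) (rowFactorials Ts) _ ⟩
      holes T ! * rowFactorials Ts * (p ^ l * (p ^ l) ^ t) ∎

    columns-lower : (Ts : Vec MaskRow n) → (α * l) ^ total Ts * (q ^ l) ^ n ≤ ∏ (λ j → gfact (left Ts (λ _ → n) j)) * (p ^ l) ^ n
    columns-lower Ts = begin
      (α * l) ^ total Ts * (q ^ l) ^ n ≡⟨ cong₂ _*_ (trans (cong ((α * l) ^_) (sym (∑-columnHoles Ts))) (sym (∏-^∑ (α * l) c))) (sym (∏-const n (q ^ l))) ⟩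
      ∏ (λ j → (α * l) ^ c j) * ∏ {n} (λ _ → q ^ l) ≡⟨ ∏-* (λ j → (α * l) ^ c j) (λ _ → q ^ l) ⟨
      ∏ (λ j → (α * l) ^ c j * q ^ l) ≤⟨ ∏-mono one ⟩
      ∏ (λ j → gfact (left Ts (λ _ → n) j) * p ^ l) ≡⟨ ∏-* (λ j → gfact (left Ts (λ _ → n) j)) (λ _ → p ^ l) ⟩
      ∏ (λ j → gfact (left Ts (λ _ → n) j)) * ∏ {n} (λ _ → p ^ l) ≡⟨ cong (∏ (λ j → gfact (left Ts (λ _ → n) j)) *_) (∏-const n (p ^ l)) ⟩
      ∏ (λ j → gfact (left Ts (λ _ → n) j)) * (p ^ l) ^ n ∎
      where
      c = columnHoles Ts
      one : ∀ j → (α * l) ^ c j * q ^ l ≤ gfact (left Ts (λ _ → n) j) * p ^ l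
      one j = begin
        (α * l) ^ c j * q ^ l ≡⟨ trans (cong (_* q ^ l) (^-distribʳ-* α l (c j))) (*-assoc (α ^ c j) _ _) ⟩
        α ^ c j * (l ^ c j * q ^ l) ≤⟨ *-monoʳ-≤ (α ^ c j) (poisson-bound n l (c j)) ⟩
        α ^ c j * (c j ! * p ^ l) ≡⟨ *-assoc (α ^ c j) _ _ ⟨
        α ^ c j * c j ! * p ^ l ≤⟨ *-monoˡ-≤ (p ^ l) (gfact-lower (c j)) ⟩
        gfact (c j) * p ^ l ≡⟨ cong (λ z → gfact z * p ^ l) (left≡ Ts (λ _ → n) j 0 refl) ⟨
        gfact (left Ts (λ _ → n) j) * p ^ l ∎

    -- `poisson-bound` is used once for every row, through the factorials a_i!, and once for every
    -- column, through `gfact` of its holes. This removes all dependence on the mask but the number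
    -- of holes, and is the source of two of the three factors e^l.
    mask-bound : (Ts : Vec MaskRow n) (Z : List (Vec Row n)) → All (LatinOff Ts full) Z → AllPairs (λ L L′ → ¬ Agree Ts L L′) Z →
      length Z * (l * l) ^ total Ts * (β ^ n * (q ^ l * q ^ l)) ^ n ≤ (gfact n * (p ^ l * p ^ l)) ^ n * (n + s) ^ total Ts
    mask-bound Ts Z ok distinct = cancelˡ-≤ {α ^ h} (m^n>0 α {{>-nonZero α>0}} h) (begin
      α ^ h * (N * (l * l) ^ h * (β ^ n * (q ^ l * q ^ l)) ^ n)
        ≡⟨ cong₂ (λ a b → α ^ h * (N * a * b)) (^-distribʳ-* l l h) (trans (^-distribʳ-* (β ^ n) (q ^ l * q ^ l) n) (cong ((β ^ n) ^ n *_) (^-distribʳ-* (q ^ l) (q ^ l) n))) ⟩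
      α ^ h * (N * (l ^ h * l ^ h) * (B * (Q * Q)))
        ≡⟨ e1 (α ^ h) N (l ^ h) B Q ⟩
      N * B * (l ^ h * Q) * (α ^ h * l ^ h * Q)
        ≡⟨ cong (λ z → N * B * (l ^ h * Q) * (z * Q)) (^-distribʳ-* α l h) ⟨
      N * B * (l ^ h * Q) * ((α * l) ^ h * Q)
        ≤⟨ *-mono-≤ (*-monoʳ-≤ (N * B) (rowFactorials-lower Ts)) (columns-lower Ts) ⟩
      N * B * (rowFactorials Ts * P) * (Π * P)
        ≡⟨ e2 N B (rowFactorials Ts) P Π ⟩
      N * rowFactorials Ts * B * Π * (P * P)
        ≤⟨ *-monoˡ-≤ (P * P) (*-monoˡ-≤ Π (*-monoˡ-≤ B (classes-bound Ts Z ok distinct))) ⟩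
      length (arrays Ts full) * B * Π * (P * P)
        ≤⟨ *-monoˡ-≤ (P * P) main ⟩
      gfact n ^ n * (α ^ h * (n + s) ^ h) * (P * P)
        ≡⟨ e3 (gfact n ^ n) (α ^ h) ((n + s) ^ h) (P * P) ⟩
      α ^ h * (gfact n ^ n * (P * P) * (n + s) ^ h)
        ≡⟨ cong (λ z → α ^ h * (z * (n + s) ^ h)) (trans (^-distribʳ-* (gfact n) (p ^ l * p ^ l) n) (cong (gfact n ^ n *_) (^-distribʳ-* (p ^ l) (p ^ l) n))) ⟨
      α ^ h * ((gfact n * (p ^ l * p ^ l)) ^ n * (n + s) ^ h) ∎)
      where
      h = total Ts
      N = length Z
      B = (β ^ n) ^ n
      P = (p ^ l) ^ n
      Q = (q ^ l) ^ n
      Π = ∏ (λ j → gfact (left Ts (λ _ → n) j))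
      e1 : ∀ a N x B Q → a * (N * (x * x) * (B * (Q * Q))) ≡ N * B * (x * Q) * (a * x * Q)
      e1 = solve-∀
      e2 : ∀ N B r P Π → N * B * (r * P) * (Π * P) ≡ N * r * B * Π * (P * P)
      e2 = solve-∀
      e3 : ∀ g a b P → g * (a * b) * P ≡ a * (g * P * b)
      e3 = solve-∀
      cards : ∀ (j : Fin n) → card (full j) ≡ n
      cards j = card-true n
      main : length (arrays Ts full) * B * Π ≤ gfact n ^ n * (α ^ h * (n + s) ^ h)
      main = subst₂ (λ a b → length (arrays Ts full) * B * a ≤ b)
        (∏-cong (λ j → cong gfact (left-cong Ts cards j)))
        (cong₂ _*_ (trans (∏-cong (λ j → cong gfact (cards j))) (∏-const n (gfact n))) (^-distribʳ-* α (n + s) h))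
        (arrays-bound Ts full)

∈-allVecs : {X : Set} {xs : List X} → (∀ a → a ∈ xs) → ∀ {N} (v : Vec X N) → v ∈ allVecs xs N
∈-allVecs h [] = here refl
∈-allVecs {xs = xs} h (a ∷ v) = ∈.∈-concatMap⁺ (λ a → map (a ∷_) (allVecs xs _)) (lose (h a) (∈.∈-map⁺ (a ∷_) (∈-allVecs h v)))

-- Peeling

sumL-∈ : {X : Set} {xs : List X} {x : X} (f : X → ℕ) → x ∈ xs → f x ≤ sumL xs f
sumL-∈ f (here refl) = m≤m+n _ _
sumL-∈ {xs = y ∷ xs} f (there p) = ≤-trans (sumL-∈ f p) (m≤n+m _ (f y))

-- The removal of one element, described by the properties it transports; quantifying over `Q` makes
-- an equality test on elements unnecessary.
record Selection {X : Set} (R : X → X → Set) (P : X → Set) (xs : List X) : Set₁ where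
  field
    chosen : X
    satisfies : P chosen
    holds : ∀ {Q : X → Set} → All Q xs → Q chosen
    others : List X
    length-others : length xs ≡ suc (length others)
    restrict : ∀ {Q : X → Set} → All Q xs → All Q others
    restrict-pairs : AllPairs R xs → AllPairs R others
    related : AllPairs R xs → All (R chosen) others

select : {X : Set} {R : X → X → Set} {P : X → Set} → (∀ {x y} → R x y → R y x) → ∀ {xs} → Any P xs → Selection R P xs
select sym-R {x ∷ xs} (here px) = record
  { chosen = x ; satisfies = px ; holds = λ { (q ∷ _) → q } ; others = xs ; length-others = refl
  ; restrict = λ { (_ ∷ qs) → qs } ; restrict-pairs = λ { (_ ∷ rs) → rs } ; related = λ { (r ∷ _) → r } }
select {X} {R} sym-R {x ∷ xs} (there p) = record
  { chosen = chosen ; satisfies = satisfies ; holds = λ { (_ ∷ qs) → holds qs } ; others = x ∷ others ; length-others = cong suc length-others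
  ; restrict = λ { (q ∷ qs) → q ∷ restrict qs }
  ; restrict-pairs = λ { (r ∷ rs) → restrict r ∷ restrict-pairs rs }
  ; related = λ { (r ∷ rs) → sym-R (holds r) ∷ related rs } }
  where open Selection (select {R = R} sym-R p)

allBools : List Bool
allBools = true ∷ false ∷ []

∈-allBools : ∀ b → b ∈ allBools
∈-allBools true = here refl
∈-allBools false = there (here refl)

module Peeling (n : ℕ) (n>0 : 0 < n) (α β s : ℕ) (α>0 : 0 < α) (s>0 : 0 < s)
  (step : ∀ d → β * suc d * (d + s) ^ d ≤ α * (suc d + s) ^ suc d) where
  open TraceCount n n>0 α β s α>0 s>0 step public

  Mask : Set
  Mask = Vec MaskRow n

  allMaskRows : List MaskRow
  allMaskRows = allVecs allBools n

  allMasks : List Mask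
  allMasks = allVecs allMaskRows n

  ∈-allMasks : ∀ T → T ∈ allMasks
  ∈-allMasks = ∈-allVecs (∈-allVecs ∈-allBools)

  -- Vectors have decidable equality, unlike records of functions, and equal vectors give the same
  -- concept.
  rowsOf : LatinSquare n → Vec Row n
  rowsOf c = tabulate (λ i → tabulate (entry c i))

  lookup-rowsOf : ∀ c i j → lookup (lookup (rowsOf c) i) j ≡ entry c i j
  lookup-rowsOf c i j = trans (cong (λ z → lookup z j) (Vec.lookup∘tabulate _ i)) (Vec.lookup∘tabulate (entry c i) j)

  rowsOf⇒Same : ∀ c c′ → rowsOf c ≡ rowsOf c′ → SameConcept c c′
  rowsOf⇒Same c c′ eq (i , j , k) = mk⇔ (trans (sym e)) (trans e)
    where e : entry c i j ≡ entry c′ i j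
          e = trans (sym (lookup-rowsOf c i j)) (trans (cong (λ z → lookup (lookup z i) j) eq) (lookup-rowsOf c′ i j))

  rowsOf-latinOff : (Ts : Mask) (c : LatinSquare n) → LatinOff Ts full (rowsOf c)
  rowsOf-latinOff Ts c = go Ts full (rowsOf c) perms (λ _ _ → refl)
      (λ j i i′ eq → colUnique c j i i′ (trans (sym (lookup-rowsOf c i j)) (trans eq (lookup-rowsOf c i′ j))))
    where
    perms : ∀ i → IsPerm (lookup (rowsOf c) i)
    perms i w with rowExists c i w
    ... | j₀ , refl = trans (occ-lookup w (lookup (rowsOf c) i)) (trans (∑-cong (λ j → cong (λ z → δ z w) (lookup-rowsOf c i j)))
      (trans (∑-single (λ j → δ (entry c i j) w) j₀ (λ j j≢j₀ → ⟦⟧-no (entry c i j ≟ w) (j≢j₀ ∘ rowUnique c i j j₀))) (δ-refl w)))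
    go : ∀ {t} (Ts : Vec MaskRow t) D (L : Vec Row t) → (∀ i → IsPerm (lookup L i)) → (∀ i j → D j (lookup (lookup L i) j) ≡ true) →
      (∀ j i i′ → lookup (lookup L i) j ≡ lookup (lookup L i′) j → i ≡ i′) → LatinOff Ts D L
    go [] D [] _ _ _ = tt
    go (T ∷ Ts) D (x ∷ L) perm fits inj = perm zero , (λ j → trans (cong (lookup T j ∨_) (fits zero j)) (Bool.∨-zeroʳ (lookup T j))) ,
      go Ts (removeOff T D x) L (perm ∘ suc) fits′ (λ j i i′ eq → Fin.suc-injective (inj j (suc i) (suc i′) eq))
      where
      fits′ : ∀ i j → removeOff T D x j (lookup (lookup L i) j) ≡ true
      fits′ i j with lookup T j
      ... | true = fits (suc i) j
      ... | false = ∖-true (D j) (lookup x j) _ (fits (suc i) j) (λ eq → case inj j (suc i) zero eq of λ ())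

  Teaches : List (LatinSquare n) → LatinSquare n → Mask → Set
  Teaches X c T = All (λ c′ → Agree T (rowsOf c) (rowsOf c′) → rowsOf c ≡ rowsOf c′) X

  _≟ᴸ_ : (L L′ : Vec Row n) → Dec (L ≡ L′)
  _≟ᴸ_ = Vec.≡-dec (Vec.≡-dec _≟_)

  module _ (k : ℕ) where

    -- Teaching sets are replaced by masks. There are finitely many, so the alternative that drives
    -- `peel` is decidable.
    Easy : List (LatinSquare n) → LatinSquare n → Set
    Easy X c = Any (λ T → k ≤ total T × Teaches X c T) allMasks

    easy? : ∀ X c → Dec (Easy X c)
    easy? X c = Any.any? (λ T → (k ≤? total T) ×-dec All.all? (λ c′ → agree? T (rowsOf c) (rowsOf c′) →-dec (rowsOf c ≟ᴸ rowsOf c′)) X) allMasks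

    Distinct : LatinSquare n → LatinSquare n → Set
    Distinct c c′ = rowsOf c ≢ rowsOf c′

    Hard : Set
    Hard = Σ (List (LatinSquare n)) λ Y → (∃ λ c → c ∈ Y) × (∀ c → c ∈ Y → ¬ Easy Y c)

    -- Each mask separates its square from those peeled later. This one-sided condition suffices:
    -- two squares with the same mask are then distinguished by their entries outside it.
    record Traced (X : List (LatinSquare n)) : Set₁ where
      field
        traces : List (LatinSquare n × Mask)
        length-traces : length traces ≡ length X
        large : All (λ z → k ≤ total (proj₂ z)) traces
        inherit : ∀ {Q : LatinSquare n → Set} → All Q X → All (Q ∘ proj₁) traces
        separated : AllPairs (λ z z′ → ¬ Agree (proj₂ z) (rowsOf (proj₁ z)) (rowsOf (proj₁ z′))) traces

    peel : ∀ m X → length X ≡ m → AllPairs Distinct X → Hard ⊎ Traced X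
    peel zero [] _ _ = inj₂ (record { traces = [] ; length-traces = refl ; large = [] ; inherit = λ _ → [] ; separated = [] })
    peel (suc m) X@(c₀ ∷ _) len distinct with Any.any? (easy? X) X
    -- Nothing can be peeled off, so the family reached here is the witness for the lower bound.
    ... | no ¬easy = inj₁ (X , (c₀ , here refl) , λ c c∈X e → ¬easy (lose c∈X e))
    ... | yes easy = extend (peel m others (suc-injective (trans (sym length-others) len)) (restrict-pairs distinct))
      where
      open Selection (select {R = Distinct} (λ h eq → h (sym eq)) easy)
      T = proj₁ (Any.satisfied satisfies)
      teaches = proj₂ (Any.satisfied satisfies)
      extend : Hard ⊎ Traced others → Hard ⊎ Traced X
      extend (inj₁ hard) = inj₁ hard
      extend (inj₂ tr) = inj₂ (record
        { traces = (chosen , T) ∷ traces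
        ; length-traces = trans (cong suc length-traces) (sym length-others)
        ; large = proj₁ teaches ∷ large
        ; inherit = λ qs → holds qs ∷ inherit (restrict qs)
        ; separated = All.zipWith (λ (h , c≢) agree → c≢ (h agree)) (inherit (restrict (proj₂ teaches)) , inherit (related distinct)) ∷ separated
        })
        where open Traced tr

    -- The symbol is dropped: a triple tests a cell for one symbol, and revealing the cell tells at
    -- least as much.
    hit : List (Ω n) → Fin n → Fin n → Bool
    hit [] i j = false
    hit ((a , b , _) ∷ S) i j = does (a ≟ i) ∧ does (b ≟ j) ∨ hit S i j

    ∑∑-hit : ∀ S → ∑ (λ i → ∑ (λ j → bit (hit S i j))) ≤ length S
    ∑∑-hit [] = ≤-reflexive (∑-zero {n} (λ _ → ∑-zero {n} (λ _ → refl)))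
    ∑∑-hit ((a , b , c) ∷ S) = begin
      ∑ (λ i → ∑ (λ j → bit (does (a ≟ i) ∧ does (b ≟ j) ∨ hit S i j))) ≤⟨ ∑-mono (λ i → ∑-mono (λ j → bits (does (a ≟ i)) (does (b ≟ j)) (hit S i j))) ⟩
      ∑ (λ i → ∑ (λ j → δ a i * δ b j + bit (hit S i j))) ≡⟨ ∑-cong (λ i → ∑-+ (λ j → δ a i * δ b j) (λ j → bit (hit S i j))) ⟩
      ∑ (λ i → ∑ (λ j → δ a i * δ b j) + ∑ (λ j → bit (hit S i j))) ≡⟨ ∑-+ (λ i → ∑ (λ j → δ a i * δ b j)) (λ i → ∑ (λ j → bit (hit S i j))) ⟩
      ∑ (λ i → ∑ (λ j → δ a i * δ b j)) + ∑ (λ i → ∑ (λ j → bit (hit S i j))) ≤⟨ +-mono-≤ (≤-reflexive one) (∑∑-hit S) ⟩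
      suc (length S) ∎
      where
      bits : ∀ x y z → bit (x ∧ y ∨ z) ≤ bit x * bit y + bit z
      bits true true _ = s≤s z≤n
      bits true false z = ≤-refl
      bits false _ z = ≤-refl
      one : ∑ (λ i → ∑ (λ j → δ a i * δ b j)) ≡ 1
      one = trans (∑-cong (λ i → trans (sym (*-distribˡ-∑ (δ a i) (δ b))) (cong (δ a i *_) (trans (∑-single (δ b) b (λ w w≢b → ⟦⟧-no (b ≟ w) (w≢b ∘ sym))) (δ-refl b)))))
        (∑-δ a (λ _ → 1))

    maskOf : List (Ω n) → Mask
    maskOf S = tabulate (λ i → tabulate (λ j → not (hit S i j)))

    lookup-maskOf : ∀ S i j → lookup (lookup (maskOf S) i) j ≡ not (hit S i j)
    lookup-maskOf S i j = trans (cong (λ z → lookup z j) (Vec.lookup∘tabulate _ i)) (Vec.lookup∘tabulate _ j)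

    total-∑ : ∀ {t} (Ts : Vec MaskRow t) → total Ts ≡ ∑ (λ i → holes (lookup Ts i))
    total-∑ [] = refl
    total-∑ (T ∷ Ts) = cong (holes T +_) (total-∑ Ts)

    total-maskOf : ∀ S → n ^ 2 ≤ length S + total (maskOf S)
    total-maskOf S = begin
      n * (n * 1) ≡⟨ trans (∑-const n (n * 1)) refl ⟨
      ∑ {n} (λ _ → n * 1) ≡⟨ ∑-cong {n} (λ _ → ∑-const n 1) ⟨
      ∑ {n} (λ i → ∑ {n} (λ j → 1)) ≡⟨ ∑-cong (λ i → trans (∑-cong (λ j → bits (hit S i j))) (∑-+ (λ j → bit (hit S i j)) (λ j → bit (not (hit S i j))))) ⟩
      ∑ (λ i → ∑ (λ j → bit (hit S i j)) + ∑ (λ j → bit (not (hit S i j)))) ≡⟨ ∑-+ (λ i → ∑ (λ j → bit (hit S i j))) (λ i → ∑ (λ j → bit (not (hit S i j)))) ⟩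
      ∑ (λ i → ∑ (λ j → bit (hit S i j))) + ∑ (λ i → ∑ (λ j → bit (not (hit S i j)))) ≤⟨ +-mono-≤ (∑∑-hit S) (≤-reflexive (sym (trans (total-∑ (maskOf S)) (∑-cong (λ i → trans (holes-∑ (lookup (maskOf S) i)) (∑-cong (λ j → cong bit (lookup-maskOf S i j)))))))) ⟩
      length S + total (maskOf S) ∎
      where
      bits : ∀ b → 1 ≡ bit b + bit (not b)
      bits true = refl
      bits false = refl

    hit-∈ : ∀ S {i j l} → (i , j , l) ∈ S → hit S i j ≡ true
    hit-∈ ((a , b , c) ∷ S) {i} {j} (here refl) with a ≟ a | b ≟ b
    ... | yes _ | yes _ = refl
    ... | no ¬p | _ = ⊥-elim (¬p refl)
    ... | yes _ | no ¬p = ⊥-elim (¬p refl)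
    hit-∈ ((a , b , c) ∷ S) {i} {j} (there p) = trans (cong (does (a ≟ i) ∧ does (b ≟ j) ∨_) (hit-∈ S p)) (Bool.∨-zeroʳ _)

    -- A teaching set with fewer than n² - k triples touches so few cells that its mask has more
    -- than k holes, and revealing these cells still teaches, which contradicts hardness.
    hard⇒RTD : Hard → RTDAtLeast n (n ^ 2 ∸ k)
    hard⇒RTD (Y , (c₀ , c₀∈Y) , hard) = (_∈ Y) , (c₀ , c₀∈Y) , λ c c∈Y S teaching → ≮⇒≥ λ short →
      hard c c∈Y (lose (∈-allMasks (maskOf S)) (
        <⇒≤ (+-cancelˡ-< (length S) k (total (maskOf S)) (≤-trans (m<n∸o⇒m+o<n short) (total-maskOf S))) ,
        All.tabulate (λ {c′} c′∈Y agree → case rowsOf c ≟ᴸ rowsOf c′ of λ where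
          (yes eq) → eq
          (no c≢c′) → ⊥-elim (teaching c′ c′∈Y
            (λ same → c≢c′ (vec-ext _ _ λ i → vec-ext _ _ λ j → trans (lookup-rowsOf c i j)
              (trans (Equivalence.to (same (i , j , entry c′ i j)) refl) (sym (lookup-rowsOf c′ i j)))))
            (λ { (i , j , l) ω∈S →
              let e : entry c i j ≡ entry c′ i j
                  e = trans (sym (lookup-rowsOf c i j)) (trans (agree i j (trans (lookup-maskOf S i j) (cong not (hit-∈ S ω∈S)))) (lookup-rowsOf c′ i j))
              in mk⇔ (trans (sym e)) (trans e) })))))
      where
      m<n∸o⇒m+o<n : ∀ {m} → m < n ^ 2 ∸ k → m + k < n ^ 2
      m<n∸o⇒m+o<n {m} h = ≤-trans (+-monoˡ-≤ k h) (≤-reflexive (m∸n+n≡m {n ^ 2} {k} (<⇒≤ (m<n∸o⇒o<n h))))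
        where
        m<n∸o⇒o<n : m < n ^ 2 ∸ k → k < n ^ 2
        m<n∸o⇒o<n h with k <? n ^ 2
        ... | yes p = p
        ... | no ¬p = ⊥-elim (<⇒≱ h (≤-trans (≤-reflexive (m≤n⇒m∸n≡0 (≮⇒≥ ¬p))) z≤n))

-- Summation over masks and comparison of the two counts

prodV : {X : Set} → (X → ℕ) → ∀ {N} → Vec X N → ℕ
prodV f [] = 1
prodV f (a ∷ v) = f a * prodV f v

sumL-prodV : {X : Set} (xs : List X) (f : X → ℕ) → ∀ N → sumL (allVecs xs N) (prodV f) ≡ sumL xs f ^ N
sumL-prodV xs f zero = refl
sumL-prodV xs f (suc N) = trans (sumL-consAll xs (λ _ → allVecs xs N) (prodV f))
  (trans (sumL-cong xs (λ a → trans (sym (*-distribˡ-sumL (f a) (allVecs xs N) (prodV f))) (cong (f a *_) (sumL-prodV xs f N))))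
    (sym (*-distribʳ-sumL (sumL xs f ^ N) xs f)))

module Counting (n : ℕ) (n>0 : 0 < n) (α β s : ℕ) (α>0 : 0 < α) (s>0 : 0 < s)
  (step : ∀ d → β * suc d * (d + s) ^ d ≤ α * (suc d + s) ^ suc d)
  (l : ℕ) (l>0 : 0 < l) (l-large : n * (n + s) ≤ l * l * l) where
  open Peeling n n>0 α β s α>0 s>0 step public

  -- Exponential tilting: holes weigh l and revealed cells n, so that masks with about l n holes
  -- dominate, and the sum over all masks is a pure power.
  rowW : ∀ {N} → Vec Bool N → ℕ
  rowW = prodV (λ b → if b then l else n)

  maskW : ∀ {t} → Vec MaskRow t → ℕ
  maskW = prodV rowW

  rowW-power : ∀ {N} (T : Vec Bool N) → n ^ holes T * rowW T ≡ l ^ holes T * n ^ N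
  rowW-power [] = refl
  rowW-power {suc N} (true ∷ T) = trans (interchange n (n ^ holes T) l (rowW T)) (trans (cong (n * l *_) (rowW-power T)) (e2 n l (l ^ holes T) (n ^ N)))
    where
    e2 : ∀ n l x y → n * l * (x * y) ≡ l * x * (n * y)
    e2 = solve-∀
  rowW-power {suc N} (false ∷ T) = trans (x∙yz≈y∙xz (n ^ holes T) n (rowW T)) (trans (cong (n *_) (rowW-power T)) (x∙yz≈y∙xz n (l ^ holes T) (n ^ N)))

  maskW-power : ∀ {t} (Ts : Vec MaskRow t) → n ^ total Ts * maskW Ts ≡ l ^ total Ts * (n ^ n) ^ t
  maskW-power [] = refl
  maskW-power {suc t} (T ∷ Ts) = trans (cong (_* (rowW T * maskW Ts)) (^-distribˡ-+-* n (holes T) (total Ts))) (trans (interchange (n ^ holes T) (n ^ total Ts) (rowW T) (maskW Ts))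
    (trans (cong₂ _*_ (rowW-power T) (maskW-power Ts)) (trans (interchange (l ^ holes T) (n ^ n) (l ^ total Ts) ((n ^ n) ^ t)) (cong (_* (n ^ n * (n ^ n) ^ t)) (sym (^-distribˡ-+-* l (holes T) (total Ts)))))))

  ∑-maskW : sumL allMasks maskW ≡ ((l + n) ^ n) ^ n
  ∑-maskW = trans (sumL-prodV allMaskRows rowW n) (cong (_^ n) (trans (sumL-prodV allBools (λ b → if b then l else n) n) (cong (λ z → (l + z) ^ n) (+-identityʳ n))))

  private
    k a b P Q E G : ℕ
    k = l * n
    a = l * l * l
    b = n * (n + s)
    P = p ^ l
    Q = q ^ l
    E = β ^ n * (Q * Q)
    G = gfact n * (P * P)

  module _ {X : List (LatinSquare n)} (tr : Traced k X) where
    open Traced tr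

    withMask : Mask → List (LatinSquare n × Mask)
    withMask T = filter (λ z → Vec.≡-dec (Vec.≡-dec Bool._≟_) (proj₂ z) T) traces

    withMask-bound : ∀ T → length (withMask T) * (l * l) ^ total T * E ^ n ≤ G ^ n * (n + s) ^ total T
    withMask-bound T = subst (λ z → z * (l * l) ^ total T * E ^ n ≤ G ^ n * (n + s) ^ total T) (length-map (rowsOf ∘ proj₁) (withMask T))
      (mask-bound l T (map (rowsOf ∘ proj₁) (withMask T))
        (All.map⁺ (All.universal (λ z → rowsOf-latinOff T (proj₁ z)) (withMask T)))
        (AllPairs.map⁺ (AllPairs.map (λ { (sep , refl , _) → sep })
          (AllPairs-All (AllPairs.filter⁺ is-T separated) (All.all-filter is-T traces)))))
      where is-T = λ (z : LatinSquare n × Mask) → Vec.≡-dec (Vec.≡-dec Bool._≟_) (proj₂ z) T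

    -- After division by its weight a mask with h holes contributes (b/a)^h = (n (n + s)/l³)^h. Only
    -- masks with h ≥ k occur in the traces, so a common bound with exponent k holds for all masks.
    withMask-weighted : ∀ T → length (withMask T) * (a ^ k * E ^ n * (n ^ n) ^ n) ≤ G ^ n * b ^ k * maskW T
    withMask-weighted T with k ≤? total T
    ... | no k≰ = ≤-trans (≤-reflexive (cong (_* (a ^ k * E ^ n * (n ^ n) ^ n)) (length≡0 (All.zipWith (λ { (k≤ , refl) → k≰ k≤ })
        (All.filter⁺ (λ z → Vec.≡-dec (Vec.≡-dec Bool._≟_) (proj₂ z) T) large , All.all-filter (λ z → Vec.≡-dec (Vec.≡-dec Bool._≟_) (proj₂ z) T) traces))))) z≤n
    ... | yes k≤h = cancelˡ-≤ {l ^ h * a ^ e} (*-mono-≤ (m^n>0 l {{l≢0}} h) (m^n>0 a {{a≢0}} e)) (begin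
      l ^ h * a ^ e * (N * (a ^ k * E ^ n * (n ^ n) ^ n))
        ≡⟨ e1 (l ^ h) (a ^ e) N (a ^ k) (E ^ n) ((n ^ n) ^ n) ⟩
      N * (a ^ k * a ^ e) * E ^ n * (l ^ h * (n ^ n) ^ n)
        ≡⟨ cong₂ (λ x y → N * x * E ^ n * y) a^h (maskW-power T) ⟨
      N * (l ^ h * (l * l) ^ h) * E ^ n * (n ^ h * W)
        ≡⟨ e2 N (l ^ h) ((l * l) ^ h) (E ^ n) (n ^ h) W ⟩
      N * (l * l) ^ h * E ^ n * (l ^ h * (n ^ h * W))
        ≤⟨ *-monoˡ-≤ _ (withMask-bound T) ⟩
      G ^ n * (n + s) ^ h * (l ^ h * (n ^ h * W))
        ≡⟨ e3 (G ^ n) ((n + s) ^ h) (l ^ h) (n ^ h) W ⟩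
      G ^ n * l ^ h * W * (n ^ h * (n + s) ^ h)
        ≡⟨ cong (G ^ n * l ^ h * W *_) b^h ⟩
      G ^ n * l ^ h * W * (b ^ k * b ^ e)
        -- Holes beyond the k-th do not increase the bound, because b ≤ a.
        ≤⟨ *-monoʳ-≤ (G ^ n * l ^ h * W) (*-monoʳ-≤ (b ^ k) (^-monoˡ-≤ e l-large)) ⟩
      G ^ n * l ^ h * W * (b ^ k * a ^ e)
        ≡⟨ e4 (G ^ n) (l ^ h) W (b ^ k) (a ^ e) ⟩
      l ^ h * a ^ e * (G ^ n * b ^ k * W) ∎)
      where
      N = length (withMask T)
      W = maskW T
      h = total T
      e = h ∸ k
      l≢0 = >-nonZero l>0
      a≢0 = >-nonZero (*-mono-≤ (*-mono-≤ l>0 l>0) l>0)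
      h≡ : k + e ≡ h
      h≡ = m+[n∸m]≡n k≤h
      a^h : l ^ h * (l * l) ^ h ≡ a ^ k * a ^ e
      a^h = trans (*-comm (l ^ h) _) (trans (sym (^-distribʳ-* (l * l) l h)) (trans (cong (a ^_) (sym h≡)) (^-distribˡ-+-* a k e)))
      b^h : n ^ h * (n + s) ^ h ≡ b ^ k * b ^ e
      b^h = trans (sym (^-distribʳ-* n (n + s) h)) (trans (cong (b ^_) (sym h≡)) (^-distribˡ-+-* b k e))
      e1 : ∀ x y N A E z → x * y * (N * (A * E * z)) ≡ N * (A * y) * E * (x * z)
      e1 = solve-∀
      e2 : ∀ N x y E z W → N * (x * y) * E * (z * W) ≡ N * y * E * (x * (z * W))
      e2 = solve-∀
      e3 : ∀ G x l n W → G * x * (l * (n * W)) ≡ G * l * W * (n * x)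
      e3 = solve-∀
      e4 : ∀ G l W b a → G * l * W * (b * a) ≡ l * a * (G * b * W)
      e4 = solve-∀

    traces≤ : length traces ≤ sumL allMasks (λ T → length (withMask T))
    traces≤ = begin
      length traces ≡⟨ length-sumL traces ⟩
      sumL traces (λ _ → 1) ≤⟨ sumL-mono traces (λ z → ≤-trans (≤-reflexive (sym (⟦⟧-yes (proj₂ z ≟ᴹ proj₂ z) refl))) (sumL-∈ (λ T → ⟦ proj₂ z ≟ᴹ T ⟧) (∈-allMasks (proj₂ z)))) ⟩
      sumL traces (λ z → sumL allMasks (λ T → ⟦ proj₂ z ≟ᴹ T ⟧)) ≡⟨ sumL-swap traces allMasks _ ⟩
      sumL allMasks (λ T → sumL traces (λ z → ⟦ proj₂ z ≟ᴹ T ⟧)) ≡⟨ sumL-cong allMasks (λ T → length-filter (λ z → proj₂ z ≟ᴹ T) traces) ⟨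
      sumL allMasks (λ T → length (withMask T)) ∎
      where
      _≟ᴹ_ : (T T′ : Mask) → Dec (T ≡ T′)
      _≟ᴹ_ = Vec.≡-dec (Vec.≡-dec Bool._≟_)

    traced-bound : length X * (a ^ k * E ^ n * (n ^ n) ^ n) ≤ G ^ n * b ^ k * ((l + n) ^ n) ^ n
    traced-bound = begin
      length X * c ≡⟨ cong (_* c) length-traces ⟨
      length traces * c ≤⟨ *-monoˡ-≤ c traces≤ ⟩
      sumL allMasks (λ T → length (withMask T)) * c ≡⟨ *-distribʳ-sumL c allMasks (λ T → length (withMask T)) ⟩
      sumL allMasks (λ T → length (withMask T) * c) ≤⟨ sumL-mono allMasks withMask-weighted ⟩
      sumL allMasks (λ T → G ^ n * b ^ k * maskW T) ≡⟨ *-distribˡ-sumL (G ^ n * b ^ k) allMasks maskW ⟨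
      G ^ n * b ^ k * sumL allMasks maskW ≡⟨ cong (G ^ n * b ^ k *_) ∑-maskW ⟩
      G ^ n * b ^ k * ((l + n) ^ n) ^ n ∎
      where
      c = a ^ k * E ^ n * (n ^ n) ^ n

  gfact≤ : ∀ d → gfact d * s ! ≡ α ^ d * (d + s) !
  gfact≤ zero = refl
  gfact≤ (suc d) = trans (e1 α (suc d + s) (gfact d) (s !)) (trans (cong (α * (suc d + s) *_) (gfact≤ d)) (interchange α (suc d + s) (α ^ d) ((d + s) !)))
    where
    e1 : ∀ a x g s → a * x * g * s ≡ a * x * (g * s)
    e1 = solve-∀

  gfact-upper : gfact n ≤ α ^ n * (n ! * (n + s) ^ s)
  gfact-upper = begin
    gfact n ≡⟨ *-identityʳ _ ⟨
    gfact n * 1 ≤⟨ *-monoʳ-≤ (gfact n) (!>0 s) ⟩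
    gfact n * s ! ≡⟨ gfact≤ n ⟩
    α ^ n * (n + s) ! ≤⟨ *-monoʳ-≤ (α ^ n) (!≤!^ n s) ⟩
    α ^ n * (n ! * (n + s) ^ s) ∎

  -- Since k = l n, all factors are n-th powers and a root is taken. Then n! cancels between the
  -- number of Latin squares and `gfact n`, and n^n between the mask weights and their sum.
  counting-inequality : Traced k allSquares → q ^ n * (a ^ l * (β ^ n * (Q * Q * Q))) ≤ 36 * p ^ n * (α ^ n * (n + s) ^ s) * (P * P * P) * b ^ l
  counting-inequality tr = cancelˡ-≤ {n ^ n * n !} (*-mono-≤ (self^self>0 n) (!>0 n)) (begin
    n ^ n * n ! * (q ^ n * (a ^ l * (β ^ n * (Q * Q * Q))))
      ≡⟨ e1 (n ^ n) (n !) (q ^ n) (a ^ l) (β ^ n) Q ⟩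
    n ! * q ^ n * (a ^ l * E * n ^ n * Q)
      ≤⟨ root ⟩
    36 * p ^ n * (G * b ^ l * (n ^ n * P))
      ≤⟨ *-monoʳ-≤ (36 * p ^ n) (*-monoˡ-≤ (n ^ n * P) (*-monoˡ-≤ (b ^ l) (*-monoˡ-≤ (P * P) gfact-upper))) ⟩
    36 * p ^ n * (α ^ n * (n ! * (n + s) ^ s) * (P * P) * b ^ l * (n ^ n * P))
      ≡⟨ e2 (36 * p ^ n) (α ^ n) (n !) ((n + s) ^ s) P (b ^ l) (n ^ n) ⟩
    n ^ n * n ! * (36 * p ^ n * (α ^ n * (n + s) ^ s) * (P * P * P) * b ^ l) ∎)
    where
    M = length allSquares
    e1 : ∀ N f q A B Q → N * f * (q * (A * (B * (Q * Q * Q)))) ≡ f * q * (A * (B * (Q * Q)) * N * Q)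
    e1 = solve-∀
    e2 : ∀ p A f S P B N → p * (A * (f * S) * (P * P) * B * (N * P)) ≡ N * f * (p * (A * S) * (P * P * P) * B)
    e2 = solve-∀
    e3 : ∀ x y z w → x * y * z * w ≡ y * (x * z * w)
    e3 = solve-∀
    n-powers : (a ^ l * E * n ^ n * Q) ^ n ≡ a ^ k * E ^ n * (n ^ n) ^ n * Q ^ n
    n-powers = trans (^-distribʳ-* (a ^ l * E * n ^ n) Q n) (cong (_* Q ^ n) (trans (^-distribʳ-* (a ^ l * E) (n ^ n) n)
      (cong (_* (n ^ n) ^ n) (trans (^-distribʳ-* (a ^ l) E n) (cong (_* E ^ n) (^-*-assoc a l n))))))
    n-powers′ : (G * b ^ l * (n ^ n * P)) ^ n ≡ G ^ n * b ^ k * (n ^ n * P) ^ n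
    n-powers′ = trans (^-distribʳ-* (G * b ^ l) (n ^ n * P) n) (cong (_* (n ^ n * P) ^ n) (trans (^-distribʳ-* G (b ^ l) n) (cong (G ^ n *_) (^-*-assoc b l n))))
    upper : M * (a ^ l * E * n ^ n * Q) ^ n ≤ (G * b ^ l * (n ^ n * P)) ^ n
    upper = begin
      M * (a ^ l * E * n ^ n * Q) ^ n ≡⟨ cong (M *_) n-powers ⟩
      M * (a ^ k * E ^ n * (n ^ n) ^ n * Q ^ n) ≡⟨ *-assoc M _ (Q ^ n) ⟨
      M * (a ^ k * E ^ n * (n ^ n) ^ n) * Q ^ n ≤⟨ *-monoˡ-≤ (Q ^ n) (traced-bound tr) ⟩
      G ^ n * b ^ k * ((l + n) ^ n) ^ n * Q ^ n ≡⟨ trans (*-assoc (G ^ n * b ^ k) _ _) (cong (G ^ n * b ^ k *_) (sym (^-distribʳ-* ((l + n) ^ n) Q n))) ⟩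
      G ^ n * b ^ k * ((l + n) ^ n * Q) ^ n ≤⟨ *-monoʳ-≤ (G ^ n * b ^ k) (^-monoˡ-≤ n (subst (λ z → z ^ n * Q ≤ n ^ n * P) (+-comm n l) ([n+l]^n-bound n l))) ⟩
      G ^ n * b ^ k * (n ^ n * P) ^ n ≡⟨ n-powers′ ⟨
      (G * b ^ l * (n ^ n * P)) ^ n ∎
    root : n ! * q ^ n * (a ^ l * E * n ^ n * Q) ≤ 36 * p ^ n * (G * b ^ l * (n ^ n * P))
    root = ^-cancel-≤ n n>0 (begin
      (n ! * q ^ n * (a ^ l * E * n ^ n * Q)) ^ n ≡⟨ ^-distribʳ-* (n ! * q ^ n) _ n ⟩
      (n ! * q ^ n) ^ n * (a ^ l * E * n ^ n * Q) ^ n ≤⟨ *-monoˡ-≤ _ length-allSquares ⟩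
      M * (36 * p ^ n) ^ n * (a ^ l * E * n ^ n * Q) ^ n ≡⟨ trans (cong (_* (a ^ l * E * n ^ n * Q) ^ n) (*-comm M _)) (*-assoc ((36 * p ^ n) ^ n) M _) ⟩
      (36 * p ^ n) ^ n * (M * (a ^ l * E * n ^ n * Q) ^ n) ≤⟨ *-monoʳ-≤ ((36 * p ^ n) ^ n) upper ⟩
      (36 * p ^ n) ^ n * (G * b ^ l * (n ^ n * P)) ^ n ≡⟨ ^-distribʳ-* (36 * p ^ n) _ n ⟨
      (36 * p ^ n * (G * b ^ l * (n ^ n * P))) ^ n ∎)

  hard-or-count : Hard k ⊎ (q ^ n * (a ^ l * (β ^ n * (Q * Q * Q))) ≤ 36 * p ^ n * (α ^ n * (n + s) ^ s) * (P * P * P) * b ^ l)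
  hard-or-count with peel k (length allSquares) allSquares refl
    (AllPairs.map (λ {c} {c′} ¬same eq → ¬same (rowsOf⇒Same c c′ eq)) distinct-allSquares)
  ... | inj₁ hard = inj₁ hard
  ... | inj₂ tr = inj₂ (counting-inequality tr)

-- Asymptotics

-- A discrete root: an upward search must pass X by the argument X + 1.
threshold : (f : ℕ → ℕ) (X : ℕ) → f 0 ≤ X → (∀ y → y ≤ f y) → ∃ λ l → f l ≤ X × X < f (suc l)
threshold f X f0≤X grows = case go (suc X) of λ where
    (inj₁ found) → found
    (inj₂ f≤X) → ⊥-elim (1+n≰n (≤-trans (grows (suc X)) f≤X))
  where
  go : ∀ t → (∃ λ l → f l ≤ X × X < f (suc l)) ⊎ f t ≤ X
  go zero = inj₂ f0≤X
  go (suc t) with go t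
  ... | inj₁ found = inj₁ found
  ... | inj₂ f≤X with f (suc t) ≤? X
  ... | yes p = inj₂ p
  ... | no ¬p = inj₁ (t , f≤X , ≰⇒> ¬p)

tangent-step : ∀ N d → d ^ suc N + suc N * d ^ N ≤ suc d ^ suc N
tangent-step N d = +-cancelʳ-≤ (N * d ^ suc N) _ _ (≤-trans (≤-reflexive (e N d (d ^ N))) (tangent N (suc d) d))
  where e : ∀ N d x → d * x + suc N * x + N * (d * x) ≡ suc N * suc d * x
        e = solve-∀

-- expNum n M d = M! n^M Σ_{j ≤ M} (d/n)^j / j!
expNum : ℕ → ℕ → ℕ → ℕ
expNum n zero d = 1
expNum n (suc M) d = suc M * n * expNum n M d + d ^ suc M

-- With S_M(d) the partial sum normalised, this is S_(M+1)(d + 1) ≥ S_(M+1)(d) + S_M(d)/n, a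
-- discrete form of the differential equation of exp.
expNum-step : ∀ n M d → expNum n (suc M) d + suc M * expNum n M d ≤ expNum n (suc M) (suc d)
expNum-step n zero d = ≤-reflexive (e n d)
  where e : ∀ n d → 1 * n * 1 + d * 1 + 1 * 1 ≡ 1 * n * 1 + suc d * 1
        e = solve-∀
expNum-step n (suc M) d = begin
  suc (suc M) * n * X + d ^ suc (suc M) + suc (suc M) * (suc M * n * Y + d ^ suc M)
    ≡⟨ e (suc (suc M)) n X (d ^ suc (suc M)) (suc M) Y (d ^ suc M) ⟩
  suc (suc M) * n * (X + suc M * Y) + (d ^ suc (suc M) + suc (suc M) * d ^ suc M)
    ≤⟨ +-mono-≤ (*-monoʳ-≤ (suc (suc M) * n) (expNum-step n M d)) (tangent-step (suc M) d) ⟩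
  suc (suc M) * n * expNum n (suc M) (suc d) + suc d ^ suc (suc M) ∎
  where
  X = expNum n (suc M) d
  Y = expNum n M d
  e : ∀ a n X p b Y z → a * n * X + p + a * (b * n * Y + z) ≡ a * n * (X + b * Y) + (p + a * z)
  e = solve-∀

-- Induction on the exponent d avoids binomial coefficients; only d = n is used later, where the
-- right side becomes a partial sum of the series of e.
exp-bound : ∀ n d → suc n ^ d * d ! ≤ expNum n d d
exp-bound n zero = ≤-refl
exp-bound n (suc d) = begin
  suc n * suc n ^ d * (suc d * d !) ≡⟨ interchange (suc n) (suc n ^ d) (suc d) (d !) ⟩
  suc n * suc d * (suc n ^ d * d !) ≤⟨ *-monoʳ-≤ (suc n * suc d) (exp-bound n d) ⟩
  suc n * suc d * expNum n d d ≡⟨ e2 n (suc d) (expNum n d d) ⟩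
  suc d * n * expNum n d d + suc d * expNum n d d ≤⟨ +-monoˡ-≤ (suc d * expNum n d d) (m≤m+n (suc d * n * expNum n d d) (d ^ suc d)) ⟩
  expNum n (suc d) d + suc d * expNum n d d ≤⟨ expNum-step n d d ⟩
  expNum n (suc d) (suc d) ∎
  where
  e2 : ∀ n b x → suc n * b * x ≡ b * n * x + b * x
  e2 = solve-∀

expNum-diagonal : ∀ n M → expNum n M n ≡ n ^ M * eSumNum M
expNum-diagonal n zero = refl
expNum-diagonal n (suc M) = trans (cong (λ z → suc M * n * z + n ^ suc M) (expNum-diagonal n M)) (e (suc M) n (n ^ M) (eSumNum M))
  where e : ∀ a n x y → a * n * (x * y) + n * x ≡ n * x * (a * y + 1)
        e = solve-∀

-- Stated with its exact slack j!, which becomes the room in `gap`.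
eUpper-decreasing : ∀ j → eUpperNum (suc j) * eUpperDen j + j ! ≡ eUpperNum j * eUpperDen (suc j)
eUpper-decreasing j = e j (eSumNum j) (j !)
  where e : ∀ j s f → (suc j * (suc j * s + 1) + 1) * (j * f) + f ≡ (j * s + 1) * (suc j * (suc j * f))
        e = solve-∀

eUpperDen>0 : ∀ k → 0 < k → 0 < eUpperDen k
eUpperDen>0 k k>0 = *-mono-≤ k>0 (!>0 k)

eUpper-antitone : ∀ k t → 0 < k → eUpperNum (t + k) * eUpperDen k ≤ eUpperNum k * eUpperDen (t + k)
eUpper-antitone k zero _ = ≤-refl
eUpper-antitone k (suc t) k>0 = cancelˡ-≤ {eUpperDen j} (eUpperDen>0 j (≤-trans k>0 (m≤n+m k t))) (begin
  eUpperDen j * (eUpperNum (suc j) * eUpperDen k) ≡⟨ e1 (eUpperDen j) (eUpperNum (suc j)) (eUpperDen k) ⟩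
  eUpperNum (suc j) * eUpperDen j * eUpperDen k ≤⟨ *-monoˡ-≤ (eUpperDen k) (≤-trans (m≤m+n _ (j !)) (≤-reflexive (eUpper-decreasing j))) ⟩
  eUpperNum j * eUpperDen (suc j) * eUpperDen k ≡⟨ e2 (eUpperNum j) (eUpperDen (suc j)) (eUpperDen k) ⟩
  eUpperDen (suc j) * (eUpperNum j * eUpperDen k) ≤⟨ *-monoʳ-≤ (eUpperDen (suc j)) (eUpper-antitone k t k>0) ⟩
  eUpperDen (suc j) * (eUpperNum k * eUpperDen j) ≡⟨ e3 (eUpperDen (suc j)) (eUpperNum k) (eUpperDen j) ⟩
  eUpperDen j * (eUpperNum k * eUpperDen (suc j)) ∎)
  where
  j = t + k
  e1 : ∀ a b c → a * (b * c) ≡ b * a * c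
  e1 = solve-∀
  e2 : ∀ a b c → a * b * c ≡ b * (a * c)
  e2 = solve-∀
  e3 : ∀ a b c → a * (b * c) ≡ c * (b * a)
  e3 = solve-∀

eSum-monotone : ∀ n t → eSumNum n * (t + n) ! ≤ eSumNum (t + n) * n !
eSum-monotone n zero = ≤-refl
eSum-monotone n (suc t) = begin
  eSumNum n * (suc j * j !) ≡⟨ x∙yz≈y∙xz (eSumNum n) (suc j) (j !) ⟩
  suc j * (eSumNum n * j !) ≤⟨ *-monoʳ-≤ (suc j) (eSum-monotone n t) ⟩
  suc j * (eSumNum j * n !) ≡⟨ *-assoc (suc j) (eSumNum j) (n !) ⟨
  suc j * eSumNum j * n ! ≤⟨ *-monoˡ-≤ (n !) (m≤m+n (suc j * eSumNum j) 1) ⟩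
  eSumNum (suc j) * n ! ∎
  where
  j = t + n

-- Partial sums increase and upper bounds decrease, so both are compared at the larger of the two
-- indices.
eSum≤eUpper : ∀ n k → 0 < k → eSumNum n * eUpperDen k ≤ eUpperNum k * n !
eSum≤eUpper n k k>0 with ≤-total n k
... | inj₁ n≤k = begin
  eSumNum n * (k * k !) ≡⟨ x∙yz≈y∙xz (eSumNum n) k (k !) ⟩
  k * (eSumNum n * k !) ≤⟨ *-monoʳ-≤ k (subst (λ z → eSumNum n * z ! ≤ eSumNum z * n !) (m∸n+n≡m n≤k) (eSum-monotone n (k ∸ n))) ⟩
  k * (eSumNum k * n !) ≡⟨ *-assoc k (eSumNum k) (n !) ⟨
  k * eSumNum k * n ! ≤⟨ *-monoˡ-≤ (n !) (m≤m+n (k * eSumNum k) 1) ⟩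
  eUpperNum k * n ! ∎
... | inj₂ k≤n = cancelˡ-≤ {n} (≤-trans k>0 k≤n) (begin
  n * (eSumNum n * eUpperDen k) ≡⟨ *-assoc n (eSumNum n) _ ⟨
  n * eSumNum n * eUpperDen k ≤⟨ *-monoˡ-≤ (eUpperDen k) (m≤m+n (n * eSumNum n) 1) ⟩
  eUpperNum n * eUpperDen k ≤⟨ subst (λ z → eUpperNum z * eUpperDen k ≤ eUpperNum k * eUpperDen z) (m∸n+n≡m k≤n) (eUpper-antitone k (n ∸ k) k>0) ⟩
  eUpperNum k * (n * n !) ≡⟨ x∙yz≈y∙xz (eUpperNum k) n (n !) ⟩
  n * (eUpperNum k * n !) ∎)

eLo≤eUpper : ∀ n k → 0 < k → eLo-num n * eUpperDen k ≤ eUpperNum k * eLo-den n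
eLo≤eUpper n k k>0 = cancelˡ-≤ (!>0 n) (begin
  n ! * (u * eUpperDen k) ≡⟨ e1 (n !) u (eUpperDen k) ⟩
  u * n ! * eUpperDen k ≤⟨ *-monoˡ-≤ (eUpperDen k) (≤-trans (exp-bound n n) (≤-reflexive (expNum-diagonal n n))) ⟩
  v * eSumNum n * eUpperDen k ≡⟨ *-assoc v _ _ ⟩
  v * (eSumNum n * eUpperDen k) ≤⟨ *-monoʳ-≤ v (eSum≤eUpper n k k>0) ⟩
  v * (eUpperNum k * n !) ≡⟨ e2 v (eUpperNum k) (n !) ⟩
  n ! * (eUpperNum k * v) ∎)
  where
  u = eLo-num n
  v = eLo-den n
  e1 : ∀ a b c → a * (b * c) ≡ b * a * c
  e1 = solve-∀
  e2 : ∀ a b c → a * (b * c) ≡ c * (b * a)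
  e2 = solve-∀

-- Bernoulli's inequality for (1 - 1/(x + 1))^(N+1); the hypothesis is (N + 1)(V + 1) ≤ x + 1.
growth : ∀ V N x → suc N * V + N ≤ x → V * suc x ^ suc N ≤ suc V * x ^ suc N
growth V N x x-large = +-cancelʳ-≤ (suc V * (N * suc x ^ suc N)) _ _ (begin
  V * suc x ^ suc N + suc V * (N * suc x ^ suc N)
    ≡⟨ e1 V N x (suc x ^ N) ⟩
  suc x ^ N * (V * suc x + suc V * (N * suc x))
    ≤⟨ *-monoʳ-≤ (suc x ^ N) lin ⟩
  suc x ^ N * (suc V * (suc N * x))
    ≡⟨ e2 (suc x ^ N) (suc V) (suc N * x) ⟩
  suc V * (suc N * x * suc x ^ N)
    ≤⟨ *-monoʳ-≤ (suc V) (tangent N x (suc x)) ⟩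
  suc V * (x ^ suc N + N * suc x ^ suc N)
    ≡⟨ *-distribˡ-+ (suc V) (x ^ suc N) (N * suc x ^ suc N) ⟩
  suc V * x ^ suc N + suc V * (N * suc x ^ suc N) ∎)
  where
  e1 : ∀ V N x y → V * (suc x * y) + suc V * (N * (suc x * y)) ≡ y * (V * suc x + suc V * (N * suc x))
  e1 = solve-∀
  e2 : ∀ y a b → y * (a * b) ≡ a * (b * y)
  e2 = solve-∀
  e3 : ∀ V N x → V * suc x + suc V * (N * suc x) ≡ V * x + N * suc V * x + (suc N * V + N)
  e3 = solve-∀
  e4 : ∀ V N x → V * x + N * suc V * x + x ≡ suc V * (suc N * x)
  e4 = solve-∀
  lin : V * suc x + suc V * (N * suc x) ≤ suc V * (suc N * x)
  lin = ≤-trans (≤-reflexive (e3 V N x)) (≤-trans (+-monoʳ-≤ (V * x + N * suc V * x) x-large) (≤-reflexive (e4 V N x)))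

-- The ratio ((V+1)/V)^x / x^13 is nondecreasing from x₁ on, so the exponential eventually beats c x^12.
exponential-beats : ∀ V c → 0 < V → ∃ λ x₀ → ∀ x → x₀ ≤ x → c * x ^ 12 * V ^ x < suc V ^ x
exponential-beats V@(suc _) c _ = x₁ + suc (c * x₁ ^ 13) , bound
  where
  -- The threshold of `growth V 12`, from which x^13 grows by a factor at most (V + 1)/V per step.
  x₁ = 13 * V + 12
  grow : ∀ t → (t + x₁) ^ 13 * V ^ (t + x₁) ≤ suc V ^ (t + x₁) * x₁ ^ 13
  grow zero = ≤-trans (≤-reflexive (*-comm (x₁ ^ 13) _)) (*-monoˡ-≤ (x₁ ^ 13) (^-monoˡ-≤ x₁ (n≤1+n V)))
  grow (suc t) = begin
    suc y ^ 13 * (V * V ^ y) ≡⟨ e1 (suc y ^ 13) V (V ^ y) ⟩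
    V * suc y ^ 13 * V ^ y ≤⟨ *-monoˡ-≤ (V ^ y) (growth V 12 y (m≤n+m x₁ t)) ⟩
    suc V * y ^ 13 * V ^ y ≡⟨ *-assoc (suc V) (y ^ 13) _ ⟩
    suc V * (y ^ 13 * V ^ y) ≤⟨ *-monoʳ-≤ (suc V) (grow t) ⟩
    suc V * (suc V ^ y * x₁ ^ 13) ≡⟨ *-assoc (suc V) (suc V ^ y) (x₁ ^ 13) ⟨
    suc V * suc V ^ y * x₁ ^ 13 ∎
    where
    y = t + x₁
    e1 : ∀ a b c → a * (b * c) ≡ b * a * c
    e1 = solve-∀
  bound : ∀ x → x₁ + suc (c * x₁ ^ 13) ≤ x → c * x ^ 12 * V ^ x < suc V ^ x
  bound x x₀≤x = ≰⇒> λ le → <⇒≱ (*-monoˡ-< (x ^ 12 * V ^ x) {{m*n≢0 (x ^ 12) (V ^ x) {{m^n≢0 x 12 {{x≢0}}}} {{m^n≢0 V x}}}} (≤-trans (m≤n+m (suc (c * x₁ ^ 13)) x₁) x₀≤x)) (begin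
    x * (x ^ 12 * V ^ x) ≡⟨ *-assoc x _ _ ⟨
    x ^ 13 * V ^ x ≤⟨ subst (λ z → z ^ 13 * V ^ z ≤ suc V ^ z * x₁ ^ 13) (m∸n+n≡m x₁≤x) (grow (x ∸ x₁)) ⟩
    suc V ^ x * x₁ ^ 13 ≤⟨ *-monoˡ-≤ (x₁ ^ 13) le ⟩
    c * x ^ 12 * V ^ x * x₁ ^ 13 ≡⟨ e2 c (x ^ 12) (V ^ x) (x₁ ^ 13) ⟩
    c * x₁ ^ 13 * (x ^ 12 * V ^ x) ∎)
    where
    x₁≤x : x₁ ≤ x
    x₁≤x = ≤-trans (m≤m+n x₁ _) x₀≤x
    x≢0 : NonZero x
    x≢0 = >-nonZero (≤-trans (≤-trans (s≤s z≤n) (m≤n+m (suc (c * x₁ ^ 13)) x₁)) x₀≤x)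
    e2 : ∀ a b c d → a * b * c * d ≡ a * d * (b * c)
    e2 = solve-∀

-- `T` bounds (1 + 1/r)^(64 r); it is given by an equation so that 3^64 stays symbolic.
module Asymptotics (n r l V T : ℕ) (n>0 : 0 < n) (r>0 : 0 < r) (V>0 : 0 < V) (T≡ : T ≡ 3 ^ 64) (l>0 : 0 < l) where
  private
    p = eHi-num n
    q = eHi-den n
    u = eLo-num n
    v = eLo-den n
    s = 2 * r
    a = l * l * l
    b = n * (n + s)
    P = p ^ l
    Q = q ^ l
  open Weights n r

  cubes : ∀ x y z → x ^ l * x ^ l * x ^ l * y ^ l * z ^ l ≡ (x * x * x * y * z) ^ l
  cubes x y z = sym (trans (^-distribʳ-* (x * x * x * y) z l) (cong (_* z ^ l) (trans (^-distribʳ-* (x * x * x) y l) (cong (_* y ^ l)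
    (trans (^-distribʳ-* (x * x) x l) (cong (_* x ^ l) (^-distribʳ-* x x l)))))))

  module _ (counting : q ^ n * (a ^ l * (β ^ n * (Q * Q * Q))) ≤ 36 * p ^ n * (α ^ n * (n + s) ^ s) * (P * P * P) * b ^ l)
    (ratio : p * p * p * b * suc V ≤ q * q * q * a * V) where

    without-ratio : q ^ n * β ^ n * suc V ^ l ≤ 36 * p ^ n * (α ^ n * (n + s) ^ s) * V ^ l
    without-ratio = cancelˡ-≤ {a ^ l * (Q * Q * Q)} (*-mono-≤ (m^n>0 a {{>-nonZero (*-mono-≤ (*-mono-≤ l>0 l>0) l>0)}} l) (*-mono-≤ (*-mono-≤ Q>0 Q>0) Q>0)) (begin
      a ^ l * (Q * Q * Q) * (q ^ n * β ^ n * suc V ^ l)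
        ≡⟨ e1 (a ^ l) (Q * Q * Q) (q ^ n) (β ^ n) (suc V ^ l) ⟩
      q ^ n * (a ^ l * (β ^ n * (Q * Q * Q))) * suc V ^ l
        ≤⟨ *-monoˡ-≤ (suc V ^ l) counting ⟩
      36 * p ^ n * (α ^ n * (n + s) ^ s) * (P * P * P) * b ^ l * suc V ^ l
        ≡⟨ e2 (36 * p ^ n * (α ^ n * (n + s) ^ s)) (P * P * P) (b ^ l) (suc V ^ l) ⟩
      36 * p ^ n * (α ^ n * (n + s) ^ s) * (P * P * P * b ^ l * suc V ^ l)
        ≡⟨ cong (36 * p ^ n * (α ^ n * (n + s) ^ s) *_) (cubes p b (suc V)) ⟩
      36 * p ^ n * (α ^ n * (n + s) ^ s) * (p * p * p * b * suc V) ^ l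
        ≤⟨ *-monoʳ-≤ (36 * p ^ n * (α ^ n * (n + s) ^ s)) (^-monoˡ-≤ l ratio) ⟩
      36 * p ^ n * (α ^ n * (n + s) ^ s) * (q * q * q * a * V) ^ l
        ≡⟨ cong (36 * p ^ n * (α ^ n * (n + s) ^ s) *_) (cubes q a V) ⟨
      36 * p ^ n * (α ^ n * (n + s) ^ s) * (Q * Q * Q * a ^ l * V ^ l)
        ≡⟨ e3 (36 * p ^ n * (α ^ n * (n + s) ^ s)) (Q * Q * Q) (a ^ l) (V ^ l) ⟩
      a ^ l * (Q * Q * Q) * (36 * p ^ n * (α ^ n * (n + s) ^ s) * V ^ l) ∎)
      where
      Q>0 : 0 < Q
      Q>0 = m^n>0 q {{>-nonZero (m^n>0 n {{>-nonZero n>0}} (suc n))}} l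
      e1 : ∀ a Q q β w → a * Q * (q * β * w) ≡ q * (a * (β * Q)) * w
      e1 = solve-∀
      e2 : ∀ c P b w → c * P * b * w ≡ c * (P * b * w)
      e2 = solve-∀
      e3 : ∀ c Q a w → c * (Q * a * w) ≡ a * Q * (c * w)
      e3 = solve-∀

    -- The 1/e per cell of the Latin square count cancels the e in α/β exactly: q β/(p α) is r n/((r
    -- + 1)(n + 1)). Its n-th power leaves (1 + 1/r)^n and eLo ≤ 3, whence 108 = 36 · 3.
    without-e : r ^ n * suc V ^ l ≤ 108 * (suc r ^ n * (n + s) ^ s * V ^ l)
    without-e = cancelˡ-≤ {(u * v) ^ n * v} (*-mono-≤ (m^n>0 (u * v) {{>-nonZero (*-mono-≤ u>0 v>0)}} n) v>0) (begin
      (u * v) ^ n * n ^ n * (r ^ n * suc V ^ l)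
        ≡⟨ trans (e0 ((u * v) ^ n) (n ^ n) (r ^ n) (suc V ^ l)) (cong (_* suc V ^ l) left) ⟩
      q ^ n * β ^ n * suc V ^ l
        ≤⟨ without-ratio ⟩
      36 * p ^ n * (α ^ n * (n + s) ^ s) * V ^ l
        ≡⟨ e1 (p ^ n) (α ^ n) ((n + s) ^ s) (V ^ l) ⟩
      36 * (p ^ n * α ^ n) * ((n + s) ^ s * V ^ l)
        ≡⟨ cong (λ z → 36 * z * ((n + s) ^ s * V ^ l)) right ⟩
      36 * ((u * v) ^ n * u * suc r ^ n) * ((n + s) ^ s * V ^ l)
        ≤⟨ *-monoˡ-≤ _ (*-monoʳ-≤ 36 (*-monoˡ-≤ (suc r ^ n) (*-monoʳ-≤ ((u * v) ^ n) (eLo≤3 n)))) ⟩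
      36 * ((u * v) ^ n * (3 * v) * suc r ^ n) * ((n + s) ^ s * V ^ l)
        ≡⟨ e2 ((u * v) ^ n) v (suc r ^ n) ((n + s) ^ s) (V ^ l) ⟩
      (u * v) ^ n * v * (108 * (suc r ^ n * (n + s) ^ s * V ^ l)) ∎)
      where
      u>0 : 0 < u
      u>0 = m^n>0 (suc n) n
      v>0 : 0 < v
      v>0 = self^self>0 n
      e0 : ∀ x y z w → x * y * (z * w) ≡ x * y * z * w
      e0 = solve-∀
      e1 : ∀ p a s w → 36 * p * (a * s) * w ≡ 36 * (p * a) * (s * w)
      e1 = solve-∀
      e2 : ∀ x v r s w → 36 * (x * (3 * v) * r) * (s * w) ≡ x * v * (108 * (r * s * w))
      e2 = solve-∀
      e3 : ∀ u v n r → u * v * n * r ≡ n * v * (r * u)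
      e3 = solve-∀
      e4 : ∀ n u r v → n * u * (r * v) ≡ u * v * n * r
      e4 = solve-∀
      left : (u * v) ^ n * n ^ n * r ^ n ≡ q ^ n * β ^ n
      left = trans (cong (_* r ^ n) (sym (^-distribʳ-* (u * v) n n))) (trans (sym (^-distribʳ-* (u * v * n) r n)) (trans (cong (_^ n) (e3 u v n r)) (^-distribʳ-* q β n)))
      right : p ^ n * α ^ n ≡ (u * v) ^ n * u * suc r ^ n
      right = trans (sym (^-distribʳ-* p α n)) (trans (cong (_^ n) (e4 (suc n) u (suc r) v)) (trans (^-distribʳ-* (u * v * suc n) (suc r) n) (cong (_* suc r ^ n) (^-distribʳ-* (u * v) (suc n) n))))

    module _ (n≤64r² : n ≤ r * (64 * r)) where

      -- Raising the exponent from n to 64 r² only increases (1 + 1/r)^n, and (1 + 1/r)^r ≤ 3.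
      suc-r^n : suc r ^ n ≤ r ^ n * T ^ r
      suc-r^n = cancelˡ-≤ {r ^ e} (m^n>0 r {{>-nonZero r>0}} e) (begin
        r ^ e * suc r ^ n ≤⟨ *-monoˡ-≤ (suc r ^ n) (^-monoˡ-≤ e (n≤1+n r)) ⟩
        suc r ^ e * suc r ^ n ≡⟨ ^-distribˡ-+-* (suc r) e n ⟨
        suc r ^ (e + n) ≡⟨ cong (suc r ^_) e+n ⟩
        suc r ^ (r * (64 * r)) ≡⟨ ^-*-assoc (suc r) r (64 * r) ⟨
        (suc r ^ r) ^ (64 * r) ≤⟨ ^-monoˡ-≤ (64 * r) (eLo≤3 r) ⟩
        (3 * r ^ r) ^ (64 * r) ≡⟨ ^-distribʳ-* 3 (r ^ r) (64 * r) ⟩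
        3 ^ (64 * r) * (r ^ r) ^ (64 * r) ≡⟨ cong₂ _*_ (trans (sym (^-*-assoc 3 64 r)) (cong (_^ r) (sym T≡))) (trans (^-*-assoc r r (64 * r)) (cong (r ^_) (sym e+n))) ⟩
        T ^ r * r ^ (e + n) ≡⟨ cong (T ^ r *_) (^-distribˡ-+-* r e n) ⟩
        T ^ r * (r ^ e * r ^ n) ≡⟨ e1 (T ^ r) (r ^ e) (r ^ n) ⟩
        r ^ e * (r ^ n * T ^ r) ∎)
        where
        e = r * (64 * r) ∸ n
        e+n : e + n ≡ r * (64 * r)
        e+n = m∸n+n≡m n≤64r²
        e1 : ∀ a b c → a * (b * c) ≡ b * (c * a)
        e1 = solve-∀

      without-r : suc V ^ l ≤ 108 * (T ^ r * (n + s) ^ s * V ^ l)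
      without-r = cancelˡ-≤ {r ^ n} (m^n>0 r {{>-nonZero r>0}} n) (begin
        r ^ n * suc V ^ l ≤⟨ without-e ⟩
        108 * (suc r ^ n * (n + s) ^ s * V ^ l) ≤⟨ *-monoʳ-≤ 108 (*-monoˡ-≤ (V ^ l) (*-monoˡ-≤ ((n + s) ^ s) suc-r^n)) ⟩
        108 * (r ^ n * T ^ r * (n + s) ^ s * V ^ l) ≡⟨ e (r ^ n) (T ^ r) ((n + s) ^ s) (V ^ l) ⟩
        r ^ n * (108 * (T ^ r * (n + s) ^ s * V ^ l)) ∎)
        where
        e : ∀ a b c d → 108 * (a * b * c * d) ≡ a * (108 * (b * c * d))
        e = solve-∀

      module _ (x : ℕ) (xr≤l : x * r ≤ l) (n+s≤ : n + s ≤ 66 * x ^ 6) where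

        shortened : suc V ^ (x * r) ≤ 108 * (T ^ r * (n + s) ^ s * V ^ (x * r))
        shortened = cancelˡ-≤ {suc V ^ e} (m^n>0 (suc V) e) (begin
          suc V ^ e * suc V ^ (x * r) ≡⟨ trans (sym (^-distribˡ-+-* (suc V) e (x * r))) (cong (suc V ^_) e+) ⟩
          suc V ^ l ≤⟨ without-r ⟩
          108 * (T ^ r * (n + s) ^ s * V ^ l) ≡⟨ cong (λ z → 108 * (T ^ r * (n + s) ^ s * z)) (trans (cong (V ^_) (sym e+)) (^-distribˡ-+-* V e (x * r))) ⟩
          108 * (T ^ r * (n + s) ^ s * (V ^ e * V ^ (x * r))) ≤⟨ *-monoʳ-≤ 108 (*-monoʳ-≤ (T ^ r * (n + s) ^ s) (*-monoˡ-≤ (V ^ (x * r)) (^-monoˡ-≤ e (n≤1+n V)))) ⟩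
          108 * (T ^ r * (n + s) ^ s * (suc V ^ e * V ^ (x * r))) ≡⟨ e1 (T ^ r * (n + s) ^ s) (suc V ^ e) (V ^ (x * r)) ⟩
          suc V ^ e * (108 * (T ^ r * (n + s) ^ s * V ^ (x * r))) ∎)
          where
          e = l ∸ x * r
          e+ : e + x * r ≡ l
          e+ = m∸n+n≡m xr≤l
          e1 : ∀ a b c → 108 * (a * (b * c)) ≡ b * (108 * (a * c))
          e1 = solve-∀

        -- Since s = 2r, all terms are r-th powers up to the constant 108. The root of (n + s)^s is
        -- (n + s)², which yields x^12.
        polynomial-bound : suc V ^ x ≤ 108 * (T * (66 * 66)) * x ^ 12 * V ^ x
        polynomial-bound = ^-cancel-≤ r r>0 (begin
          (suc V ^ x) ^ r ≡⟨ ^-*-assoc (suc V) x r ⟩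
          suc V ^ (x * r) ≤⟨ shortened ⟩
          108 * (T ^ r * (n + s) ^ s * V ^ (x * r)) ≤⟨ *-mono-≤ (subst (_≤ 108 ^ r) (*-identityʳ 108) (^-monoʳ-≤ 108 r>0)) (*-monoˡ-≤ (V ^ (x * r)) (*-monoʳ-≤ (T ^ r) (^-monoˡ-≤ s n+s≤))) ⟩
          108 ^ r * (T ^ r * (66 * x ^ 6) ^ (2 * r) * V ^ (x * r)) ≡⟨ cong₂ (λ y z → 108 ^ r * (T ^ r * y * z)) (sym (^-*-assoc (66 * x ^ 6) 2 r)) (sym (^-*-assoc V x r)) ⟩
          108 ^ r * (T ^ r * ((66 * x ^ 6) ^ 2) ^ r * (V ^ x) ^ r) ≡⟨ sym (trans (^-distribʳ-* 108 _ r) (cong (108 ^ r *_) (trans (^-distribʳ-* (T * (66 * x ^ 6) ^ 2) (V ^ x) r) (cong (_* (V ^ x) ^ r) (^-distribʳ-* T ((66 * x ^ 6) ^ 2) r))))) ⟩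
          (108 * (T * (66 * x ^ 6) ^ 2 * V ^ x)) ^ r ≡⟨ cong (_^ r) (trans (e1 T (x ^ 6) (V ^ x)) (cong (λ z → 108 * (T * (66 * 66)) * z * V ^ x) (sym (^-distribˡ-+-* x 6 6)))) ⟩
          (108 * (T * (66 * 66)) * x ^ 12 * V ^ x) ^ r ∎)
          where
          e1 : ∀ T y w → 108 * (T * (66 * y * (66 * y * 1)) * w) ≡ 108 * (T * (66 * 66)) * (y * y) * w
          e1 = solve-∀

-- e³ n (n + s) / l³ < 1 with room to spare: l is (A/B) n^(2/3) up to rounding, and A′/B′ < A/B still
-- bounds e from above.
ratio-bound : ∀ {p q n s l A B A′ B′ V w} → 0 < n → 0 < A → 0 < B′ → 0 < V → 0 < w →
  p * B′ * n ≤ q * A′ * suc n →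
  A ^ 3 * n ^ 2 ≤ suc l ^ 3 * B ^ 3 →
  A′ * B * suc V ≤ A * B′ * V →
  suc n * w ≤ n * suc w → (n + s) * w ≤ n * suc w → suc l * w ≤ l * suc w →
  V * suc w ^ 7 ≤ suc V * w ^ 7 →
  p * p * p * (n * (n + s)) * suc V ≤ q * q * q * (l * l * l) * V
ratio-bound {p} {q} {n} {s} {l} {A} {B} {A′} {B′} {V} {w} n>0 A>0 B′>0 V>0 w>0 h₁ h₂ h₃ hn hs hl hw =
  cancelˡ-≤ {K} K>0 (begin
    K * (p * p * p * (n * (n + s)) * suc V)
      ≡⟨ e1 p n (n + s) (suc V) A B′ w V ⟩
    cube (p * B′ * n) * (A ^ 3 * n ^ 2) * ((n + s) * w) * (cube w * cube w * (V * cube (suc V)))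
      ≤⟨ *-monoˡ-≤ (cube w * cube w * (V * cube (suc V))) (*-mono-≤ (*-mono-≤ (cube-mono h₁) h₂) hs) ⟩
    cube (q * A′ * suc n) * (suc l ^ 3 * B ^ 3) * (n * suc w) * (cube w * cube w * (V * cube (suc V)))
      ≡⟨ e2 q A′ (suc n) (suc l) B n (suc w) w V (suc V) ⟩
    cube q * cube (A′ * B * suc V) * cube (suc n * w) * cube (suc l * w) * (n * suc w * V)
      ≤⟨ *-monoˡ-≤ (n * suc w * V) (*-mono-≤ (*-mono-≤ (*-monoʳ-≤ (cube q) (cube-mono h₃)) (cube-mono hn)) (cube-mono hl)) ⟩
    cube q * cube (A * B′ * V) * cube (n * suc w) * cube (l * suc w) * (n * suc w * V)
      ≡⟨ e3 q A B′ V n (suc w) l ⟩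
    cube q * cube l * cube (A * B′) * (n * n * n * n) * cube V * (V * suc w ^ 7)
      ≤⟨ *-monoʳ-≤ (cube q * cube l * cube (A * B′) * (n * n * n * n) * cube V) hw ⟩
    cube q * cube l * cube (A * B′) * (n * n * n * n) * cube V * (suc V * w ^ 7)
      ≡⟨ e4 q l A B′ n V (suc V) w ⟩
    cube (A * B′) * (n * n * n * n) * w ^ 7 * V * suc V * (V * (cube q * cube l * V))
      -- The cube of `h₃` gave three factors 1 + 1/V: one has paid for (1 + 1/w)^7, one goes into
      -- the conclusion, and the third is at least 1.
      ≤⟨ *-monoʳ-≤ (cube (A * B′) * (n * n * n * n) * w ^ 7 * V * suc V) (*-monoˡ-≤ (cube q * cube l * V) (n≤1+n V)) ⟩
    cube (A * B′) * (n * n * n * n) * w ^ 7 * V * suc V * (suc V * (cube q * cube l * V))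
      ≡⟨ *-assoc (cube (A * B′) * (n * n * n * n) * w ^ 7 * V * suc V) (suc V) _ ⟨
    K * (q * q * q * (l * l * l) * V) ∎)
  where
  cube : ℕ → ℕ
  cube x = x * x * x
  cube-mono : ∀ {x y} → x ≤ y → cube x ≤ cube y
  cube-mono h = *-mono-≤ (*-mono-≤ h h) h
  K = cube (A * B′) * (n * n * n * n) * w ^ 7 * V * suc V * suc V
  K>0 : 0 < K
  K>0 = *-mono-≤ (*-mono-≤ (*-mono-≤ (*-mono-≤ (*-mono-≤ (cube-mono (*-mono-≤ A>0 B′>0)) (*-mono-≤ (*-mono-≤ (*-mono-≤ n>0 n>0) n>0) n>0)) (m^n>0 w {{>-nonZero w>0}} 7)) V>0) (s≤s {0} {V} z≤n)) (s≤s {0} {V} z≤n)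
  e1 : ∀ p n x y A B w V →
    (A * B) * (A * B) * (A * B) * (n * n * n * n) * (w * (w * (w * (w * (w * (w * (w * 1))))))) * V * y * y * (p * p * p * (n * x) * y) ≡
    (p * B * n) * (p * B * n) * (p * B * n) * (A * (A * (A * 1)) * (n * (n * 1))) * (x * w) * ((w * w * w) * (w * w * w) * (V * (y * y * y)))
  e1 = solve-∀
  e2 : ∀ q A n₁ l₁ B n w₁ w V y →
    (q * A * n₁) * (q * A * n₁) * (q * A * n₁) * (l₁ * (l₁ * (l₁ * 1)) * (B * (B * (B * 1)))) * (n * w₁) * ((w * w * w) * (w * w * w) * (V * (y * y * y))) ≡
    (q * q * q) * ((A * B * y) * (A * B * y) * (A * B * y)) * ((n₁ * w) * (n₁ * w) * (n₁ * w)) * ((l₁ * w) * (l₁ * w) * (l₁ * w)) * (n * w₁ * V)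
  e2 = solve-∀
  e3 : ∀ q A B V n w l →
    (q * q * q) * ((A * B * V) * (A * B * V) * (A * B * V)) * ((n * w) * (n * w) * (n * w)) * ((l * w) * (l * w) * (l * w)) * (n * w * V) ≡
    (q * q * q) * (l * l * l) * ((A * B) * (A * B) * (A * B)) * (n * n * n * n) * (V * V * V) * (V * (w * (w * (w * (w * (w * (w * (w * 1))))))))
  e3 = solve-∀
  e4 : ∀ q l A B n V y w →
    (q * q * q) * (l * l * l) * ((A * B) * (A * B) * (A * B)) * (n * n * n * n) * (V * V * V) * (y * (w * (w * (w * (w * (w * (w * (w * 1)))))))) ≡
    (A * B) * (A * B) * (A * B) * (n * n * n * n) * (w * (w * (w * (w * (w * (w * (w * 1))))))) * V * y * (V * ((q * q * q) * (l * l * l) * V))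
  e4 = solve-∀

-- Choice of the parameters

module Constants (m : ℕ) (m>0 : 0 < m) where
  A B A′ B′ V w : ℕ
  A = eUpperNum m
  B = eUpperDen m
  A′ = eUpperNum (suc m)
  B′ = eUpperDen (suc m)
  -- A B′ and A′ B are integers with A B′ > A′ B, so the quotient of the bounds A/B and A′/B′ is at
  -- least 1 + 1/V.
  V = A′ * B
  -- The threshold of `growth V 6`. The exponent 7 pays for the cubes of (n + 1)/n and (l + 1)/l and
  -- for (n + s)/n.
  w = 7 * V + 6

  B>0 : 0 < B
  B>0 = eUpperDen>0 m m>0
  B′>0 : 0 < B′
  B′>0 = eUpperDen>0 (suc m) (s≤s z≤n)
  V>0 : 0 < V
  V>0 = *-mono-≤ (m≤n+m 1 (suc m * eSumNum (suc m))) B>0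

  gap : A′ * B * suc V ≤ A * B′ * V
  gap = begin
    V * suc V ≡⟨ *-comm V (suc V) ⟩
    suc V * V ≤⟨ *-monoˡ-≤ V (≤-trans (≤-trans (≤-reflexive (+-comm 1 V)) (+-monoʳ-≤ V (!>0 m))) (≤-reflexive (eUpper-decreasing m))) ⟩
    A * B′ * V ∎

  -- The case n = 1 of (1 + 1/n)^n below every upper bound for e. It gives (l + 1)³ > 8 n², from
  -- which the size of l is read off.
  2B≤A : 2 * B ≤ A
  2B≤A = ≤-trans (eLo≤eUpper 1 m m>0) (≤-reflexive (*-identityʳ A))

  module _ (n x l : ℕ) (x⁶≤n : x ^ 6 ≤ n) (n<[1+x]⁶ : n < suc x ^ 6) (2≤x : 2 ≤ x) (2w≤x : 2 * w ≤ x)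
    (l≤ : l ^ 3 * B ^ 3 ≤ A ^ 3 * n ^ 2) (<l : A ^ 3 * n ^ 2 < suc l ^ 3 * B ^ 3) where

    r s : ℕ
    -- About √n, which balances n/r, the exponent of (1 + 1/r)^n, against the exponent 2r of n + 2r,
    -- up to a logarithm.
    r = x ^ 3
    s = 2 * r

    1≤x : 1 ≤ x
    1≤x = ≤-trans (s≤s z≤n) 2≤x
    w≤x : w ≤ x
    w≤x = ≤-trans (m≤n*m w 2) 2w≤x
    x≤r : x ≤ r
    x≤r = subst (_≤ r) (*-identityʳ x) (^-monoʳ-≤ x {{>-nonZero 1≤x}} {1} {3} (s≤s z≤n))
    r>0 : 0 < r
    r>0 = ≤-trans 1≤x x≤r
    r²≤n : r * r ≤ n
    r²≤n = ≤-trans (≤-reflexive (sym (^-distribˡ-+-* x 3 3))) (x⁶≤n)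
    r≤n : r ≤ n
    r≤n = ≤-trans (≤-trans (≤-reflexive (sym (*-identityʳ r))) (*-monoʳ-≤ r r>0)) r²≤n
    n>0 : 0 < n
    n>0 = ≤-trans r>0 r≤n
    n≤64x⁶ : n ≤ 64 * x ^ 6
    n≤64x⁶ = begin
      n ≤⟨ <⇒≤ n<[1+x]⁶ ⟩
      suc x ^ 6 ≤⟨ ^-monoˡ-≤ 6 (≤-trans (+-monoˡ-≤ x 1≤x) (≤-reflexive (cong (x +_) (sym (+-identityʳ x))))) ⟩
      (2 * x) ^ 6 ≡⟨ ^-distribʳ-* 2 x 6 ⟩
      64 * x ^ 6 ∎
    x⁶≡r² : x ^ 6 ≡ r * r
    x⁶≡r² = ^-distribˡ-+-* x 3 3
    n≤64r² : n ≤ r * (64 * r)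
    n≤64r² = ≤-trans n≤64x⁶ (≤-reflexive (trans (cong (64 *_) x⁶≡r²) (e r)))
      where e : ∀ r → 64 * (r * r) ≡ r * (64 * r)
            e = solve-∀
    n+s≤ : n + s ≤ 66 * x ^ 6
    n+s≤ = begin
      n + 2 * r ≤⟨ +-mono-≤ n≤64x⁶ (*-monoʳ-≤ 2 (≤-trans (≤-reflexive (sym (*-identityʳ r))) (≤-trans (*-monoʳ-≤ r r>0) (≤-reflexive (sym x⁶≡r²))))) ⟩
      64 * x ^ 6 + 2 * x ^ 6 ≡⟨ *-distribʳ-+ (x ^ 6) 64 2 ⟨
      66 * x ^ 6 ∎

    8n²< : 8 * n ^ 2 < suc l ^ 3
    8n²< = *-cancelʳ-< (B ^ 3) _ _ (begin-strict
      8 * n ^ 2 * B ^ 3 ≡⟨ e (n ^ 2) (B ^ 3) ⟩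
      8 * B ^ 3 * n ^ 2 ≡⟨ cong (_* n ^ 2) (^-distribʳ-* 2 B 3) ⟨
      (2 * B) ^ 3 * n ^ 2 ≤⟨ *-monoˡ-≤ (n ^ 2) (^-monoˡ-≤ 3 2B≤A) ⟩
      A ^ 3 * n ^ 2 <⟨ <l ⟩
      suc l ^ 3 * B ^ 3 ∎)
      where e : ∀ a b → 8 * a * b ≡ 8 * b * a
            e = solve-∀

    2xr≤l : 2 * (x * r) ≤ l
    2xr≤l = ≮⇒≥ λ l<2xr → <⇒≱ 8n²< (begin
      suc l ^ 3 ≤⟨ ^-monoˡ-≤ 3 l<2xr ⟩
      (2 * (x * x ^ 3)) ^ 3 ≡⟨ e x ⟩
      8 * (x ^ 6) ^ 2 ≤⟨ *-monoʳ-≤ 8 (^-monoˡ-≤ 2 (x⁶≤n)) ⟩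
      8 * n ^ 2 ∎)
      where
      e : ∀ x → (2 * (x * (x * (x * (x * 1))))) * ((2 * (x * (x * (x * (x * 1))))) * ((2 * (x * (x * (x * (x * 1))))) * 1)) ≡
        8 * ((x * (x * (x * (x * (x * (x * 1)))))) * ((x * (x * (x * (x * (x * (x * 1)))))) * 1))
      e = solve-∀
    xr≤l : x * r ≤ l
    xr≤l = ≤-trans (m≤n*m (x * r) 2) 2xr≤l
    x≤l : x ≤ l
    x≤l = ≤-trans (≤-trans (≤-reflexive (sym (*-identityʳ x))) (*-monoʳ-≤ x r>0)) xr≤l
    l>0 : 0 < l
    l>0 = ≤-trans 1≤x x≤l
    5≤l : 5 ≤ l
    5≤l = ≤-trans (≤-trans (m≤m+n 5 3) (*-monoʳ-≤ 2 (*-mono-≤ 2≤x (≤-trans 2≤x x≤r)))) 2xr≤l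

    l³-large : n * (n + s) ≤ l * l * l
    l³-large = *-cancelˡ-≤ 2 (begin
      2 * (n * (n + s)) ≤⟨ *-monoʳ-≤ 2 (*-monoʳ-≤ n (+-monoʳ-≤ n (*-monoʳ-≤ 2 r≤n))) ⟩
      2 * (n * (n + 2 * n)) ≤⟨ m≤m+n _ (2 * (n * n)) ⟩
      2 * (n * (n + 2 * n)) + 2 * (n * n) ≡⟨ e n ⟩
      8 * n ^ 2 ≤⟨ <⇒≤ 8n²< ⟩
      suc l ^ 3 ≡⟨ *-identityˡ _ ⟨
      -- From l = 5 on, rounding l down at most halves its cube.
      1 * suc l ^ 3 ≤⟨ growth 1 2 l 5≤l ⟩
      2 * l ^ 3 ≡⟨ cong (2 *_) (e′ l) ⟩
      2 * (l * l * l) ∎)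
      where
      e : ∀ n → 2 * (n * (n + 2 * n)) + 2 * (n * n) ≡ 8 * (n * (n * 1))
      e = solve-∀
      e′ : ∀ l → l * (l * (l * 1)) ≡ l * l * l
      e′ = solve-∀

    ratio : eHi-num n * eHi-num n * eHi-num n * (n * (n + s)) * suc V ≤ eHi-den n * eHi-den n * eHi-den n * (l * l * l) * V
    ratio = ratio-bound {eHi-num n} {eHi-den n} {n} {s} {l} {A} {B} {A′} {B′} {V} {w} n>0 (≤-trans (*-mono-≤ {1} {2} (s≤s z≤n) B>0) 2B≤A) B′>0 V>0 (≤-trans (s≤s z≤n) (≤-reflexive (sym (+-suc (7 * V) 5))))
      e-bound (<⇒≤ <l) gap
      (close n (≤-trans w≤x (≤-trans x≤r r≤n))) s-close (close l (≤-trans w≤x x≤l)) (growth V 6 w ≤-refl)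
      where
      close : ∀ y → w ≤ y → suc y * w ≤ y * suc w
      close y w≤y = ≤-trans (+-monoˡ-≤ (y * w) w≤y) (≤-reflexive (sym (*-suc y w)))
      s-close : (n + s) * w ≤ n * suc w
      s-close = begin
        (n + 2 * r) * w ≡⟨ e n r w ⟩
        r * (2 * w) + n * w ≤⟨ +-monoˡ-≤ (n * w) (≤-trans (*-monoʳ-≤ r (≤-trans 2w≤x x≤r)) r²≤n) ⟩
        n + n * w ≡⟨ *-suc n w ⟨
        n * suc w ∎
        where e : ∀ n r w → (n + 2 * r) * w ≡ r * (2 * w) + n * w
              e = solve-∀
      e-bound : eHi-num n * B′ * n ≤ eHi-den n * A′ * suc n
      e-bound = begin
        suc n * eLo-num n * B′ * n ≡⟨ e₁ (suc n) (eLo-num n) B′ n ⟩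
        suc n * n * (eLo-num n * B′) ≤⟨ *-monoʳ-≤ (suc n * n) (eLo≤eUpper n (suc m) (s≤s z≤n)) ⟩
        suc n * n * (A′ * eLo-den n) ≡⟨ e₂ (suc n) n A′ (eLo-den n) ⟩
        n * eLo-den n * A′ * suc n ∎
        where
        e₁ : ∀ a u b n → a * u * b * n ≡ a * n * (u * b)
        e₁ = solve-∀
        e₂ : ∀ a n b v → a * n * (b * v) ≡ n * v * b * a
        e₂ = solve-∀

    open Weights n r using (α; β; weight-step)
    open Counting n n>0 α β s (*-mono-≤ (s≤s {0} {r} z≤n) (self^self>0 n)) (≤-trans r>0 (m≤n*m r 2)) weight-step l l>0 l³-large
      using (hard-or-count; hard⇒RTD)

    rtd-bound : ∀ T → T ≡ 3 ^ 64 → 108 * (T * (66 * 66)) * x ^ 12 * V ^ x < suc V ^ x → RTDAtLeast n (n ^ 2 ∸ l * n)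
    rtd-bound T T≡ beaten = [ hard⇒RTD (l * n) , (λ count → ⊥-elim (<⇒≱ beaten
        (Asymptotics.polynomial-bound n r l V T n>0 r>0 V>0 T≡ l>0 count ratio n≤64r² x xr≤l n+s≤))) ]′ hard-or-count

    density-bound : (n ^ 2 ∸ (n ^ 2 ∸ l * n)) ^ 3 * B ^ 3 ≤ A ^ 3 * n ^ 5
    density-bound = begin
      (n ^ 2 ∸ (n ^ 2 ∸ l * n)) ^ 3 * B ^ 3 ≤⟨ *-monoˡ-≤ (B ^ 3) (^-monoˡ-≤ 3 (m∸[m∸n]≤n (n ^ 2) (l * n))) ⟩
      (l * n) ^ 3 * B ^ 3 ≡⟨ trans (cong (_* B ^ 3) (^-distribʳ-* l n 3)) (e (l ^ 3) (n ^ 3) (B ^ 3)) ⟩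
      n ^ 3 * (l ^ 3 * B ^ 3) ≤⟨ *-monoʳ-≤ (n ^ 3) l≤ ⟩
      n ^ 3 * (A ^ 3 * n ^ 2) ≡⟨ trans (x∙yz≈y∙xz (n ^ 3) (A ^ 3) (n ^ 2)) (cong (A ^ 3 *_) (sym (^-distribˡ-+-* n 3 2))) ⟩
      A ^ 3 * n ^ 5 ∎
      where
      m∸[m∸n]≤n : ∀ m n → m ∸ (m ∸ n) ≤ n
      m∸[m∸n]≤n m n = ≤-trans (∸-monoˡ-≤ (m ∸ n) (m≤n+m∸n m n)) (≤-reflexive (m+n∸n≡m n (m ∸ n)))
      e : ∀ a b c → a * b * c ≡ b * (a * c)
      e = solve-∀

n≤n^suc : ∀ n k → n ≤ n ^ suc k
n≤n^suc zero k = z≤n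
n≤n^suc n@(suc _) k = ≤-trans (≤-reflexive (sym (*-identityʳ n))) (*-monoʳ-≤ n (m^n>0 n k))

-- Cubing turns n^(5/3) into n^5. The bound `eUpperNum m / eUpperDen m` tends to e, so having an `N`
-- for every m amounts to the term o(1).
theorem3 : (m : ℕ) → 1 ≤ m →
    ∃ λ N → (n : ℕ) → N ≤ n →
    ∃ λ R → RTDAtLeast n R ×
    ((n ^ 2 ∸ R) ^ 3 * eUpperDen m ^ 3 ≤ eUpperNum m ^ 3 * n ^ 5)
theorem3 m m>0 = large (3 ^ 64) refl
  where
  open Constants m m>0
  large : ∀ T → T ≡ 3 ^ 64 → ∃ λ N → (n : ℕ) → N ≤ n → ∃ λ R → RTDAtLeast n R × ((n ^ 2 ∸ R) ^ 3 * B ^ 3 ≤ A ^ 3 * n ^ 5)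
  large T T≡ with exponential-beats V (108 * (T * (66 * 66))) V>0
  -- For n beyond this, x, the sixth root of n rounded down, is at least x₁, 2w and 2.
  ... | x₁ , beats = (x₁ + 2 * w + 2) ^ 6 , λ n n-large →
    let (x , x⁶≤n , n<) = threshold (_^ 6) n z≤n (λ y → n≤n^suc y 5)
        (l , l≤ , <l) = threshold (λ l → l ^ 3 * B ^ 3) (A ^ 3 * n ^ 2) z≤n
          (λ y → ≤-trans (≤-reflexive (sym (*-identityʳ y))) (*-mono-≤ (n≤n^suc y 2) (m^n>0 B {{>-nonZero B>0}} 3)))
        x₀≤x : x₁ + 2 * w + 2 ≤ x
        x₀≤x = ≮⇒≥ λ x<x₀ → <⇒≱ n< (≤-trans (^-monoˡ-≤ 6 x<x₀) n-large)
        2≤x = ≤-trans (m≤n+m 2 (x₁ + 2 * w)) x₀≤x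
        2w≤x = ≤-trans (≤-trans (m≤n+m (2 * w) x₁) (m≤m+n (x₁ + 2 * w) 2)) x₀≤x
        x₁≤x = ≤-trans (≤-trans (m≤m+n x₁ (2 * w)) (m≤m+n (x₁ + 2 * w) 2)) x₀≤x
    in n ^ 2 ∸ l * n , rtd-bound n x l x⁶≤n n< 2≤x 2w≤x l≤ <l T T≡ (beats x x₁≤x) , density-bound n x l x⁶≤n n< 2≤x 2w≤x l≤ <l
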